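{- Let $\varepsilon>0$, let $n^{1/2+\varepsilon}\leq d=d(n)\leq n/2$ (with $dn$ even), and let $\mathbf{G}_n\sim\mathcal{G}_{n,d}$. There exists a universal large constant $k\in\mathbb{N}$ such that the following holds with high probability: for every partition $[n]=V_1\sqcup\dots\sqcup V_k$ of the vertex set of $\mathbf{G}_n$ with $n/(3k)\le|V_i|\le 3n/k$ for every $i\in[k]$, after three rounds of colour refinement started from the colouring given by this partition, all colour classes are singletons.
   Context: $\mathcal{G}_{n,d}$ is the uniform distribution over $d$-regular graphs on $[n]=\{1,\dots,n\}$; "with high probability" means with probability tending to $1$ as $n\to\infty$. Colour refinement: from a colouring $C_{t-1}$, $C_t(v)=(C_{t-1}(v),\{\!\{C_{t-1}(w):w\in N(v)\}\!\})$ (multiset of neighbours' colours); the initial colouring gives colour $i$ to vertices of $V_i$. -}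

module Defs where

open import Data.Nat using (ℕ; zero; suc; _+_; _*_; _≤ᵇ_; _≡ᵇ_)
open import Data.Bool using (Bool; true; false; _∧_; _∨_; not; if_then_else_)
open import Data.Fin using (Fin; toℕ)
open import Data.List using (List; []; _∷_; map; concatMap; allFin)

countB : {A : Set} → List A → (A → Bool) → ℕ
countB [] f = 0
countB (x ∷ xs) f = (if f x then 1 else 0) + countB xs f

allB : {A : Set} → List A → (A → Bool) → Bool
allB [] f = true
allB (x ∷ xs) f = f x ∧ allB xs f

consF : {A : Set} {n : ℕ} → A → (Fin n → A) → Fin (suc n) → A
consF a f Fin.zero = a
consF a f (Fin.suc i) = f i

allFuns : {A : Set} (n : ℕ) → List A → List (Fin n → A)
allFuns zero xs = (λ ()) ∷ []
allFuns (suc n) xs = concatMap (λ f → map (λ a → consF a f) xs) (allFuns n xs)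

eqFin : {n : ℕ} → Fin n → Fin n → Bool
eqFin u v = toℕ u ≡ᵇ toℕ v

Adj : ℕ → Set
Adj n = Fin n → Fin n → Bool

allAdj : (n : ℕ) → List (Adj n)
allAdj n = allFuns n (allFuns n (true ∷ false ∷ []))

isSimpleGraph : {n : ℕ} → Adj n → Bool
isSimpleGraph {n} A =
  allB (allFin n) (λ u → not (A u u) ∧ allB (allFin n) (λ v → if A u v then A v u else not (A v u)))

degree : {n : ℕ} → Adj n → Fin n → ℕ
degree {n} A v = countB (allFin n) (λ w → A v w)

isRegular : {n : ℕ} → ℕ → Adj n → Bool
isRegular {n} d A = allB (allFin n) (λ v → degree A v ≡ᵇ d)

isRegGraph : {n : ℕ} → ℕ → Adj n → Bool
isRegGraph d A = isSimpleGraph A ∧ isRegular d A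

-- Colour refinement, started from the partition p : [n] → [k] (colour of v is p v).
-- sameColour A p t u v = true  iff  C_t(u) = C_t(v).
-- C_t(u) = C_t(v) iff C_{t-1}(u) = C_{t-1}(v) and the multisets of C_{t-1}-colours of
-- neighbours agree, i.e. for every colour c (every colour realised by some vertex x)
-- u and v have the same number of neighbours of colour c.
sameColour : {n k : ℕ} → Adj n → (Fin n → Fin k) → ℕ → Fin n → Fin n → Bool
sameColour A p zero u v = eqFin (p u) (p v)
sameColour {n} A p (suc t) u v =
  sameColour A p t u v ∧
  allB (allFin n) (λ x →
    countB (allFin n) (λ w → A u w ∧ sameColour A p t w x)
      ≡ᵇ countB (allFin n) (λ w → A v w ∧ sameColour A p t w x))

discreteAfter : {n k : ℕ} → Adj n → (Fin n → Fin k) → ℕ → Bool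
discreteAfter {n} A p t =
  allB (allFin n) (λ u → allB (allFin n) (λ v → not (sameColour A p t u v) ∨ eqFin u v))

partSize : {n k : ℕ} → (Fin n → Fin k) → Fin k → ℕ
partSize {n} p i = countB (allFin n) (λ v → eqFin (p v) i)

-- n/(3k) ≤ |V_i| ≤ 3n/k for all i, written multiplicatively
balanced : {n k : ℕ} → (Fin n → Fin k) → Bool
balanced {n} {k} p =
  allB (allFin k) (λ i → (n ≤ᵇ 3 * k * partSize p i) ∧ (k * partSize p i ≤ᵇ 3 * n))

goodGraph : (k : ℕ) {n : ℕ} → Adj n → Bool
goodGraph k {n} A = allB (allFuns n (allFin k)) (λ p → not (balanced p) ∨ discreteAfter A p 3)

totalCount : ℕ → ℕ → ℕ
totalCount n d = countB (allAdj n) (λ A → isRegGraph d A)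

badCount : ℕ → ℕ → ℕ → ℕ
badCount k n d = countB (allAdj n) (λ A → isRegGraph d A ∧ not (goodGraph k A))

{-# OPTIONS --safe #-}
module Submission where

-- After one round, two vertices share a colour only if they have the
-- same degree into every part, and after each later round only if they agree on
-- every vertex whose colour was already unique.  So it suffices that, outside an
-- event of small probability,
--   (1) at most n / 12 vertices share their colour after round 1,
--   (2) at most d / 32 do after round 2,
--   (3) |N(u) ∖ N(v)| > d / 32 for all u ≠ v.
-- (1) and (2) are union bounds over partitions, vertex sets and families of pairs,
-- for graphs with independent edges of odds d : n - 1 - d.  They have room for the
-- factor n^O(n) lost when conditioning on regularity: balancing a degree sequence
-- never decreases its number of realisations, so the regular sequence is the most
-- popular one, and dn / 2 is the most likely number of edges.  (3) fails with
-- probability exp(-Ω(d)), too much for that comparison; it follows by switching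
-- edges between v and a vertex z with |N(v) ∖ N(z)| ≥ d / 2, within regular graphs.

open import Defs
open import Data.Bool using (Bool; true; false; _∧_; _∨_; not; if_then_else_; T?; _xor_)
open import Data.Bool.Properties using (T-≡; not-involutive; ∨-identityʳ; ∧-comm; ∨-comm)
open import Data.Empty using (⊥-elim)
open import Data.Fin using (Fin; toℕ; fromℕ<) renaming (zero to fzero; suc to fsuc)
import Data.Fin.Properties as Fin
open import Data.List using (List; []; _∷_; map; concatMap; allFin; tabulate; length; _++_; filter; cartesianProduct)
import Data.List.Properties as List
open import Data.List.Membership.Propositional using (_∈_)
open import Data.List.Membership.Propositional.Properties using (∈-allFin; ∈-map⁺; ∈-concatMap⁺; ∈-filter⁻; ∈-cartesianProduct⁺)
open import Data.List.Relation.Unary.All using (All; []; _∷_)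
import Data.List.Relation.Unary.All as All
open import Data.List.Relation.Unary.AllPairs using (AllPairs; []; _∷_)
import Data.List.Relation.Unary.AllPairs.Properties as AllPairs
open import Data.List.Relation.Unary.Any using (here; there)
import Data.List.Relation.Unary.Any as Any
open import Data.Nat
open import Data.Nat.DivMod using (_/_; _%_; m≡m%n+[m/n]*n; m%n<n; m/n*n≤m; m≥n⇒m/n>0; m*n/n≡m; /-monoˡ-≤)
open import Data.Nat.Divisibility using (_∣_; divides)
open import Data.Nat.Properties
open import Data.Nat.Tactic.RingSolver using (solve-∀)
open import Data.Product using (Σ; ∃; _×_; _,_; proj₁; proj₂)
open import Data.Sum using (_⊎_; inj₁; inj₂)
open import Data.Vec using (Vec; []; _∷_; lookup; updateAt)
import Data.Vec as Vec
import Data.Vec.Properties as Vec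
open import Data.Vec.Relation.Unary.All using ([]; _∷_) renaming (All to VAll)
import Data.Vec.Relation.Unary.All as VAll
open import Function using (_∘_; id; Equivalence)
open import Relation.Binary.Definitions using (tri<; tri≈; tri>)
open import Relation.Binary.PropositionalEquality hiding ([_])
open import Relation.Nullary using (yes; no)

-- The partition is chosen after the graph, so a fixed one must fail with probability well below
-- k^-n; families of pairs and the loss from conditioning on regularity raise the requirement to
-- roughly n^-3n. Round one meets it with n / 24 pairs: each has to agree on at least half of the k
-- parts, and agreement on one part has probability at most n^(-1/32), so the exponent grows
-- linearly in k and a constant k suffices. In round two a pair must agree on at least n / 2 single
-- vertices, on each with probability at most 1 - d / 2n; d / 64 pairs then give about exp(-d² /
-- 256), which beats n^3n once d² exceeds a large multiple of n log n. This is where the exponent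
-- 1/2 + ε enters. Probabilities are never divided out: they appear as inequalities between weighted
-- sums over all bit matrices, and independence of an edge means that flipping it permutes these
-- matrices and changes the weight by a fixed ratio.

variable
  𝒜 ℬ : Set
  n k : ℕ

[_] : ∀ n → List (Fin n)
[_] = allFin

-- An explicit remainder turns a polynomial inequality into an identity within reach of the ring
-- solver.
≤-by : ∀ {x y} z → y ≡ x + z → x ≤ y
≤-by {x} z refl = m≤m+n x z

-- Boolean tests and indicators

true≢false : true ≢ false
true≢false ()

¬true⇒false : ∀ {b} → b ≢ true → b ≡ false
¬true⇒false {true} h = ⊥-elim (h refl)
¬true⇒false {false} h = refl

bool-ext : ∀ {b c} → (b ≡ true → c ≡ true) → (c ≡ true → b ≡ true) → b ≡ c
bool-ext {true} {c} f g = sym (f refl)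
bool-ext {false} {true} f g = g refl
bool-ext {false} {false} f g = refl

∧-true : ∀ {b c} → b ∧ c ≡ true → b ≡ true × c ≡ true
∧-true {true} {true} h = refl , refl

∧-intro : ∀ {b c} → b ≡ true → c ≡ true → b ∧ c ≡ true
∧-intro refl refl = refl

not-true : ∀ {b} → not b ≡ true → b ≡ false
not-true {false} h = refl

not-false : ∀ {b} → not b ≡ false → b ≡ true
not-false {true} h = refl

≡ᵇ-true : ∀ {m n} → (m ≡ᵇ n) ≡ true → m ≡ n
≡ᵇ-true {m} {n} h = ≡ᵇ⇒≡ m n (Equivalence.from T-≡ h)

≡ᵇ-intro : ∀ {m n} → m ≡ n → (m ≡ᵇ n) ≡ true
≡ᵇ-intro {m} {n} h = Equivalence.to T-≡ (≡⇒≡ᵇ m n h)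

≤ᵇ-true : ∀ {m n} → (m ≤ᵇ n) ≡ true → m ≤ n
≤ᵇ-true {m} {n} h = ≤ᵇ⇒≤ m n (Equivalence.from T-≡ h)

≤ᵇ-intro : ∀ {m n} → m ≤ n → (m ≤ᵇ n) ≡ true
≤ᵇ-intro h = Equivalence.to T-≡ (≤⇒≤ᵇ h)

≤ᵇ-false : ∀ {m n} → (m ≤ᵇ n) ≡ false → n < m
≤ᵇ-false {m} {n} h = ≰⇒> λ m≤n → true≢false (trans (sym (≤ᵇ-intro m≤n)) h)

eqFin-refl : (u : Fin n) → eqFin u u ≡ true
eqFin-refl u = ≡ᵇ-intro {toℕ u} refl

eqFin-true : {u v : Fin n} → eqFin u v ≡ true → u ≡ v
eqFin-true {u = u} h = Fin.toℕ-injective (≡ᵇ-true {toℕ u} h)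

eqFin-false : {u v : Fin n} → u ≢ v → eqFin u v ≡ false
eqFin-false h = ¬true⇒false λ e → h (eqFin-true e)

eqFin-≢ : {u v : Fin n} → eqFin u v ≡ false → u ≢ v
eqFin-≢ {u = u} h refl = true≢false (trans (sym (eqFin-refl u)) h)

ind : Bool → ℕ
ind b = if b then 1 else 0

ind≤1 : ∀ b → ind b ≤ 1
ind≤1 true = ≤-refl
ind≤1 false = z≤n

ind-mono : ∀ {b c} → (b ≡ true → c ≡ true) → ind b ≤ ind c
ind-mono {false} h = z≤n
ind-mono {true} {c} h rewrite h refl = ≤-refl

ind-∧ : ∀ b c → ind (b ∧ c) ≡ ind b * ind c
ind-∧ true true = refl
ind-∧ true false = refl
ind-∧ false c = refl

ind-split : ∀ b c → ind (b ∧ c) + ind (b ∧ not c) ≡ ind b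
ind-split true true = refl
ind-split true false = refl
ind-split false c = refl

-- Finite sums

∑ : List 𝒜 → (𝒜 → ℕ) → ℕ
∑ [] f = 0
∑ (x ∷ xs) f = f x + ∑ xs f

∑-cong : (xs : List 𝒜) {f g : 𝒜 → ℕ} → (∀ x → f x ≡ g x) → ∑ xs f ≡ ∑ xs g
∑-cong [] h = refl
∑-cong (x ∷ xs) h = cong₂ _+_ (h x) (∑-cong xs h)

∑-mono : (xs : List 𝒜) {f g : 𝒜 → ℕ} → (∀ x → f x ≤ g x) → ∑ xs f ≤ ∑ xs g
∑-mono [] h = z≤n
∑-mono (x ∷ xs) h = +-mono-≤ (h x) (∑-mono xs h)

interchange : ∀ a b c d → (a + b) + (c + d) ≡ (a + c) + (b + d)
interchange = solve-∀

∑-+ : (xs : List 𝒜) (f g : 𝒜 → ℕ) → ∑ xs (λ x → f x + g x) ≡ ∑ xs f + ∑ xs g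
∑-+ [] f g = refl
∑-+ (x ∷ xs) f g rewrite ∑-+ xs f g = interchange (f x) (g x) _ _

∑-*ˡ : (xs : List 𝒜) (c : ℕ) (f : 𝒜 → ℕ) → ∑ xs (λ x → c * f x) ≡ c * ∑ xs f
∑-*ˡ [] c f = sym (*-zeroʳ c)
∑-*ˡ (x ∷ xs) c f rewrite ∑-*ˡ xs c f = sym (*-distribˡ-+ c (f x) _)

∑-*ʳ : (xs : List 𝒜) (c : ℕ) (f : 𝒜 → ℕ) → ∑ xs (λ x → f x * c) ≡ ∑ xs f * c
∑-*ʳ xs c f = trans (∑-cong xs λ x → *-comm (f x) c) (trans (∑-*ˡ xs c f) (*-comm c _))

∑-const : (xs : List 𝒜) (c : ℕ) → ∑ xs (λ _ → c) ≡ length xs * c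
∑-const [] c = refl
∑-const (x ∷ xs) c = cong (c +_) (∑-const xs c)

∑-zero : (xs : List 𝒜) → ∑ xs (λ _ → 0) ≡ 0
∑-zero xs = trans (∑-const xs 0) (*-zeroʳ (length xs))

∑-swap : (xs : List 𝒜) (ys : List ℬ) (f : 𝒜 → ℬ → ℕ) →
         ∑ xs (λ x → ∑ ys (f x)) ≡ ∑ ys (λ y → ∑ xs (λ x → f x y))
∑-swap [] ys f = sym (∑-zero ys)
∑-swap (x ∷ xs) ys f rewrite ∑-swap xs ys f = sym (∑-+ ys (f x) _)

∑-++ : (xs ys : List 𝒜) (f : 𝒜 → ℕ) → ∑ (xs ++ ys) f ≡ ∑ xs f + ∑ ys f
∑-++ [] ys f = refl
∑-++ (x ∷ xs) ys f rewrite ∑-++ xs ys f = sym (+-assoc (f x) _ _)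

∑-map : (g : 𝒜 → ℬ) (xs : List 𝒜) (f : ℬ → ℕ) → ∑ (map g xs) f ≡ ∑ xs (f ∘ g)
∑-map g [] f = refl
∑-map g (x ∷ xs) f = cong (f (g x) +_) (∑-map g xs f)

∑-concatMap : (g : 𝒜 → List ℬ) (xs : List 𝒜) (f : ℬ → ℕ) →
              ∑ (concatMap g xs) f ≡ ∑ xs (λ x → ∑ (g x) f)
∑-concatMap g [] f = refl
∑-concatMap g (x ∷ xs) f =
  trans (∑-++ (g x) _ f) (cong (∑ (g x) f +_) (∑-concatMap g xs f))

∑-∈ : {x : 𝒜} {xs : List 𝒜} (f : 𝒜 → ℕ) → x ∈ xs → f x ≤ ∑ xs f
∑-∈ f (here refl) = m≤m+n _ _
∑-∈ f (there p) = ≤-trans (∑-∈ f p) (m≤n+m _ _)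

countB≡∑ : (xs : List 𝒜) (f : 𝒜 → Bool) → countB xs f ≡ ∑ xs (ind ∘ f)
countB≡∑ [] f = refl
countB≡∑ (x ∷ xs) f = cong (ind (f x) +_) (countB≡∑ xs f)

∑-≤const : (xs : List 𝒜) {f : 𝒜 → ℕ} (c : ℕ) → (∀ x → f x ≤ c) → ∑ xs f ≤ length xs * c
∑-≤const xs c h = ≤-trans (∑-mono xs h) (≤-reflexive (∑-const xs c))

length-allFin : ∀ n → length [ n ] ≡ n
length-allFin n = List.length-tabulate id

∑-allFin-const : ∀ n c → ∑ [ n ] (λ _ → c) ≡ n * c
∑-allFin-const n c = trans (∑-const [ n ] c) (cong (_* c) (length-allFin n))

∑-tabulate : ∀ {n} (g : Fin n → 𝒜) (f : 𝒜 → ℕ) → ∑ (tabulate g) f ≡ ∑ [ n ] (f ∘ g)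
∑-tabulate {n = zero} g f = refl
∑-tabulate {n = suc n} g f =
  cong (f (g fzero) +_)
    (trans (∑-tabulate (g ∘ fsuc) f) (sym (∑-tabulate fsuc (f ∘ g))))

∑-δ : ∀ {n} (x : Fin n) (f : Fin n → ℕ) → ∑ [ n ] (λ y → ind (eqFin y x) * f y) ≡ f x
∑-δ {suc n} fzero f =
  trans (cong (f fzero + 0 +_) (trans (∑-tabulate {n = n} fsuc _) (∑-zero [ n ])))
        (trans (+-identityʳ _) (+-identityʳ _))
∑-δ {suc n} (fsuc x) f = trans (∑-tabulate {n = n} fsuc _) (∑-δ x (f ∘ fsuc))

∑-point : (x : Fin n) {f : Fin n → ℕ} → (∀ y → y ≢ x → f y ≡ 0) → ∑ [ n ] f ≡ f x
∑-point {n} x {f} h = trans (∑-cong [ n ] eq) (∑-δ x f)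
  where
  eq : ∀ y → f y ≡ ind (eqFin y x) * f y
  eq y with eqFin y x in e
  ... | true = sym (+-identityʳ _)
  ... | false = h y (eqFin-≢ e)

∑-δ₁ : (x : Fin n) → ∑ [ n ] (λ y → ind (eqFin y x)) ≡ 1
∑-δ₁ x = trans (∑-point x λ y ne → cong ind (eqFin-false ne)) (cong ind (eqFin-refl x))

∑-filter : (P : 𝒜 → Bool) (xs : List 𝒜) (f : 𝒜 → ℕ) →
           ∑ (filter (λ x → T? (P x)) xs) f ≡ ∑ xs (λ x → ind (P x) * f x)
∑-filter P [] f = refl
∑-filter P (x ∷ xs) f with P x
... | true = cong₂ _+_ (sym (+-identityʳ (f x))) (∑-filter P xs f)
... | false = ∑-filter P xs f

length≡∑ : (xs : List 𝒜) → length xs ≡ ∑ xs (λ _ → 1)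
length≡∑ xs = sym (trans (∑-const xs 1) (*-identityʳ (length xs)))

length-filter : (P : 𝒜 → Bool) (xs : List 𝒜) →
                length (filter (λ x → T? (P x)) xs) ≡ ∑ xs (ind ∘ P)
length-filter P xs = trans (length≡∑ (filter (λ x → T? (P x)) xs)) (trans (∑-filter P xs _) (∑-cong xs λ x → *-identityʳ (ind (P x))))

allB-∈ : {xs : List 𝒜} {f : 𝒜 → Bool} → allB xs f ≡ true → ∀ {x} → x ∈ xs → f x ≡ true
allB-∈ h (here refl) = proj₁ (∧-true h)
allB-∈ {f = f} h (there {x} p) = allB-∈ (proj₂ (∧-true {f x} h)) p

allB-intro : (xs : List 𝒜) {f : 𝒜 → Bool} → (∀ x → f x ≡ true) → allB xs f ≡ true
allB-intro [] h = refl
allB-intro (x ∷ xs) h = ∧-intro (h x) (allB-intro xs h)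

allB-false : (xs : List 𝒜) {f : 𝒜 → Bool} → allB xs f ≡ false → ∃ λ x → x ∈ xs × f x ≡ false
allB-false (x ∷ xs) {f} h with f x in e
... | false = x , here refl , e
... | true with allB-false xs h
... | y , p , q = y , there p , q

allFin-true : {f : Fin n → Bool} → allB [ n ] f ≡ true → ∀ x → f x ≡ true
allFin-true h x = allB-∈ h (∈-allFin x)

∑≡0 : {x : 𝒜} {xs : List 𝒜} (f : 𝒜 → ℕ) → ∑ xs f ≡ 0 → x ∈ xs → f x ≡ 0
∑≡0 f h p = n≤0⇒n≡0 (≤-trans (∑-∈ f p) (≤-reflexive h))

∑-ind-≤1 : (P : Fin n → Bool) → (∀ x y → P x ≡ true → P y ≡ true → x ≡ y) →
           ∑ [ n ] (ind ∘ P) ≤ 1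
∑-ind-≤1 {n} P h with allB [ n ] (not ∘ P) in e
... | true = ≤-trans (≤-reflexive (trans (∑-cong [ n ] λ x → cong ind (not-true (allFin-true e x))) (∑-zero [ n ]))) z≤n
... | false with allB-false [ n ] e
... | x , _ , px = ≤-trans (∑-mono [ n ] λ y → ind-mono λ py → trans (cong (λ z → eqFin z x) (h y x py (not-false px))) (eqFin-refl x)) (≤-reflexive (∑-δ₁ x))

-- Enumerations of vectors and matrices

-- Functions lack a usable propositional equality without extensionality. Vectors have one, so
-- membership in the enumeration can be proved, and sums over `allFuns` are moved here.
allVec : (m : ℕ) → List 𝒜 → List (Vec 𝒜 m)
allVec zero xs = [] ∷ []
allVec (suc m) xs = concatMap (λ v → map (_∷ v) xs) (allVec m xs)

-- The function on Fin 0 is read off allFuns: absurd lambdas written at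
-- different places are not definitionally equal.
toFun : ∀ {m} → List 𝒜 → Vec 𝒜 m → Fin m → 𝒜
toFun xs [] = Data.List.lookup (allFuns 0 xs) fzero
toFun xs (a ∷ v) = consF a (toFun xs v)

∑-allFuns : ∀ m (xs : List 𝒜) (F : (Fin m → 𝒜) → ℕ) →
            ∑ (allFuns m xs) F ≡ ∑ (allVec m xs) (F ∘ toFun xs)
∑-allFuns zero xs F = refl
∑-allFuns (suc m) xs F = begin
  ∑ (allFuns (suc m) xs) F
    ≡⟨ ∑-concatMap _ (allFuns m xs) F ⟩
  ∑ (allFuns m xs) (λ f → ∑ (map (λ a → consF a f) xs) F)
    ≡⟨ ∑-cong (allFuns m xs) (λ f → ∑-map _ xs F) ⟩
  ∑ (allFuns m xs) (λ f → ∑ xs (λ a → F (consF a f)))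
    ≡⟨ ∑-allFuns m xs _ ⟩
  ∑ (allVec m xs) (λ v → ∑ xs (λ a → F (consF a (toFun xs v))))
    ≡⟨ ∑-cong (allVec m xs) (λ v → ∑-map _ xs (F ∘ toFun xs)) ⟨
  ∑ (allVec m xs) (λ v → ∑ (map (_∷ v) xs) (F ∘ toFun xs))
    ≡⟨ ∑-concatMap _ (allVec m xs) _ ⟨
  ∑ (allVec (suc m) xs) (F ∘ toFun xs) ∎
  where open ≡-Reasoning

∑-allVec-suc : ∀ m (xs : List 𝒜) (F : Vec 𝒜 (suc m) → ℕ) →
               ∑ (allVec (suc m) xs) F ≡ ∑ (allVec m xs) (λ v → ∑ xs (λ a → F (a ∷ v)))
∑-allVec-suc m xs F =
  trans (∑-concatMap _ (allVec m xs) F) (∑-cong (allVec m xs) λ v → ∑-map _ xs F)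

∑-allVec-map : (xs : List 𝒜) (ys : List ℬ) (g : ℬ → 𝒜) →
               (∀ H → ∑ xs H ≡ ∑ ys (H ∘ g)) →
               ∀ m G → ∑ (allVec m xs) G ≡ ∑ (allVec m ys) (G ∘ Vec.map g)
∑-allVec-map xs ys g h zero G = refl
∑-allVec-map xs ys g h (suc m) G = begin
  ∑ (allVec (suc m) xs) G
    ≡⟨ ∑-allVec-suc m xs G ⟩
  ∑ (allVec m xs) (λ v → ∑ xs (λ a → G (a ∷ v)))
    ≡⟨ ∑-allVec-map xs ys g h m _ ⟩
  ∑ (allVec m ys) (λ v → ∑ xs (λ a → G (a ∷ Vec.map g v)))
    ≡⟨ ∑-cong (allVec m ys) (λ v → h _) ⟩
  ∑ (allVec m ys) (λ v → ∑ ys (λ b → G (g b ∷ Vec.map g v)))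
    ≡⟨ ∑-allVec-suc m ys _ ⟨
  ∑ (allVec (suc m) ys) (G ∘ Vec.map g) ∎
  where open ≡-Reasoning

-- That φ permutes xs is expressed through sums, so the conclusion has the form of the hypothesis:
-- negation of a bit yields an update of a row, and that an update of a matrix.
∑-updateAt : (xs : List 𝒜) (φ : 𝒜 → 𝒜) → (∀ H → ∑ xs (H ∘ φ) ≡ ∑ xs H) →
             ∀ {m} (i : Fin m) (G : Vec 𝒜 m → ℕ) →
             ∑ (allVec m xs) (λ v → G (updateAt v i φ)) ≡ ∑ (allVec m xs) G
∑-updateAt xs φ h {suc m} fzero G =
  trans (∑-allVec-suc m xs _)
    (trans (∑-cong (allVec m xs) λ v → h (λ a → G (a ∷ v))) (sym (∑-allVec-suc m xs G)))
∑-updateAt xs φ h {suc m} (fsuc i) G =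
  trans (∑-allVec-suc m xs _)
    (trans (∑-updateAt xs φ h i (λ v → ∑ xs (λ a → G (a ∷ v)))) (sym (∑-allVec-suc m xs G)))

∈-allVec : ∀ {m} {xs : List 𝒜} (v : Vec 𝒜 m) → (∀ i → lookup v i ∈ xs) → v ∈ allVec m xs
∈-allVec [] h = here refl
∈-allVec {xs = xs} (a ∷ v) h =
  ∈-concatMap⁺ (λ v → map (_∷ v) xs)
    (Any.map (λ { refl → ∈-map⁺ (_∷ v) (h fzero) }) (∈-allVec v (h ∘ fsuc)))

length-allVec : ∀ m (xs : List 𝒜) → length (allVec m xs) ≡ length xs ^ m
length-allVec zero xs = refl
length-allVec (suc m) xs = begin
  length (allVec (suc m) xs)
    ≡⟨ length≡∑ (allVec (suc m) xs) ⟩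
  ∑ (allVec (suc m) xs) (λ _ → 1)
    ≡⟨ ∑-allVec-suc m xs _ ⟩
  ∑ (allVec m xs) (λ _ → ∑ xs (λ _ → 1))
    ≡⟨ ∑-const (allVec m xs) _ ⟩
  length (allVec m xs) * ∑ xs (λ _ → 1)
    ≡⟨ cong₂ _*_ (length-allVec m xs) (sym (length≡∑ xs)) ⟩
  length xs ^ m * length xs
    ≡⟨ *-comm (length xs ^ m) _ ⟩
  length xs ^ suc m ∎
  where open ≡-Reasoning

bits : List Bool
bits = true ∷ false ∷ []

Mat : ℕ → Set
Mat n = Vec (Vec Bool n) n

mats : (n : ℕ) → List (Mat n)
mats n = allVec n (allVec n bits)

adj : Mat n → Adj n
adj {n} M = toFun (allFuns n bits) (Vec.map (toFun bits) M)

∑-allAdj : (F : Adj n → ℕ) → ∑ (allAdj n) F ≡ ∑ (mats n) (F ∘ adj)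
∑-allAdj {n} F =
  trans (∑-allFuns n (allFuns n bits) F)
        (∑-allVec-map (allFuns n bits) (allVec n bits) (toFun bits) (∑-allFuns n bits) n _)

toFun-lookup : ∀ {m} (xs : List 𝒜) (v : Vec 𝒜 m) i → toFun xs v i ≡ lookup v i
toFun-lookup xs (a ∷ v) fzero = refl
toFun-lookup xs (a ∷ v) (fsuc i) = toFun-lookup xs v i

adj-lookup : (M : Mat n) (x y : Fin n) → adj M x y ≡ lookup (lookup M x) y
adj-lookup {n} M x y = begin
  toFun (allFuns n bits) (Vec.map (toFun bits) M) x y
    ≡⟨ cong (λ f → f y) (toFun-lookup (allFuns n bits) (Vec.map (toFun bits) M) x) ⟩
  lookup (Vec.map (toFun bits) M) x y
    ≡⟨ cong (λ f → f y) (Vec.lookup-map x (toFun bits) M) ⟩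
  toFun bits (lookup M x) y
    ≡⟨ toFun-lookup bits (lookup M x) y ⟩
  lookup (lookup M x) y ∎
  where open ≡-Reasoning

-- Flipping an edge

flipAt : Fin n → Fin n → Mat n → Mat n
flipAt x y M = updateAt M x (λ r → updateAt r y not)

flipE : Fin n → Fin n → Mat n → Mat n
flipE x y M = flipAt x y (flipAt y x M)

∑-flipAt : (x y : Fin n) (F : Mat n → ℕ) → ∑ (mats n) (F ∘ flipAt x y) ≡ ∑ (mats n) F
∑-flipAt {n} x y =
  ∑-updateAt (allVec n bits) (λ r → updateAt r y not)
    (∑-updateAt bits not (λ H → swap2 (H false) (H true)) y) x
  where
  swap2 : ∀ a b → a + (b + 0) ≡ b + (a + 0)
  swap2 = solve-∀

∑-flipE : (x y : Fin n) (F : Mat n → ℕ) → ∑ (mats n) (F ∘ flipE x y) ≡ ∑ (mats n) F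
∑-flipE x y F = trans (∑-flipAt y x (F ∘ flipAt x y)) (∑-flipAt x y F)

eqE : Fin n → Fin n → Fin n → Fin n → Bool
eqE x y u v = (eqFin u x ∧ eqFin v y) ∨ (eqFin u y ∧ eqFin v x)

adj-flipAt : (x y : Fin n) (M : Mat n) (u v : Fin n) →
               adj (flipAt x y M) u v ≡ (eqFin u x ∧ eqFin v y) xor adj M u v
adj-flipAt x y M u v rewrite adj-lookup (flipAt x y M) u v | adj-lookup M u v
  with eqFin u x in eu
... | false = cong (λ r → lookup r v) (Vec.lookup∘updateAt′ u x (eqFin-≢ eu) M)
... | true rewrite eqFin-true {u = u} eu
  | Vec.lookup∘updateAt x {λ r → updateAt r y not} M
  with eqFin v y in ev
... | false = Vec.lookup∘updateAt′ v y (eqFin-≢ ev) (lookup M x)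
... | true rewrite eqFin-true {u = v} ev = Vec.lookup∘updateAt y (lookup M x)

-- A pointwise relation, since adjacency functions before and after a flip can only be compared
-- value by value; its symmetry lets removals be read as additions.
Flip : Fin n → Fin n → Adj n → Adj n → Set
Flip x y A A′ = ∀ u v → A′ u v ≡ eqE x y u v xor A u v

adj-flipE : {x y : Fin n} → x ≢ y → (M : Mat n) → Flip x y (adj M) (adj (flipE x y M))
adj-flipE {x = x} {y} x≢y M u v
  rewrite adj-flipAt x y (flipAt y x M) u v | adj-flipAt y x M u v
  with eqFin u x in eu | eqFin u y in ev
... | true | true = ⊥-elim (x≢y (trans (sym (eqFin-true {u = u} eu)) (eqFin-true ev)))
... | false | _ = refl
... | true | false with eqFin v y
... | true = refl
... | false = refl

Flip-sym : {x y : Fin n} {A A′ : Adj n} → Flip x y A A′ → Flip x y A′ A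
Flip-sym {x = x} {y} {A} h u v rewrite h u v with eqE x y u v
... | true = sym (not-involutive (A u v))
... | false = refl

eqE-sym : (x y u v : Fin n) → eqE x y u v ≡ eqE x y v u
eqE-sym x y u v = trans (∨-comm (eqFin u x ∧ eqFin v y) _)
  (cong₂ _∨_ (∧-comm (eqFin u y) _) (∧-comm (eqFin u x) _))

eqE-other : {x y u : Fin n} → u ≢ x → u ≢ y → ∀ v → eqE x y u v ≡ false
eqE-other u≢x u≢y v rewrite eqFin-false u≢x | eqFin-false u≢y = refl

eqE-left : {x y : Fin n} → x ≢ y → ∀ v → eqE x y x v ≡ eqFin v y
eqE-left {x = x} x≢y v rewrite eqFin-refl x | eqFin-false x≢y = ∨-identityʳ _

eqE-diag : {x y : Fin n} → x ≢ y → ∀ u → eqE x y u u ≡ false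
eqE-diag {x = x} {y} x≢y u with eqFin u x in eu | eqFin u y in ev
... | true | true = ⊥-elim (x≢y (trans (sym (eqFin-true {u = u} eu)) (eqFin-true ev)))
... | true | false = refl
... | false | true = refl
... | false | false = refl

-- Simple graphs and degrees

record Simple {n} (A : Adj n) : Set where
  field
    irrefl : ∀ u → A u u ≡ false
    symm : ∀ u v → A u v ≡ A v u

open Simple public

simple-sound : {A : Adj n} → isSimpleGraph A ≡ true → Simple A
simple-sound {A = A} h = record { irrefl = irr ; symm = sy }
  where
  irr : ∀ u → A u u ≡ false
  irr u = not-true (proj₁ (∧-true (allFin-true h u)))
  sy : ∀ u v → A u v ≡ A v u
  sy u v with A u v | allFin-true (proj₂ (∧-true {not (A u u)} (allFin-true h u))) v
  ... | true | e = sym e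
  ... | false | e = sym (not-true e)

simple-complete : {A : Adj n} → Simple A → isSimpleGraph A ≡ true
simple-complete {n} {A} s = allB-intro [ n ] λ u →
  ∧-intro (cong not (irrefl s u)) (allB-intro [ n ] λ v → aux u v)
  where
  aux : ∀ u v → (if A u v then A v u else not (A v u)) ≡ true
  aux u v rewrite symm s u v with A v u
  ... | true = refl
  ... | false = refl

Simple-Flip : {x y : Fin n} {A A′ : Adj n} → x ≢ y → Flip x y A A′ → Simple A → Simple A′
Simple-Flip {x = x} {y} x≢y f s = record
  { irrefl = λ u → trans (f u u) (trans (cong (_xor _) (eqE-diag x≢y u)) (irrefl s u))
  ; symm = λ u v → trans (f u v) (trans (cong₂ _xor_ (eqE-sym x y u v) (symm s u v)) (sym (f v u)))
  }

simple-flipE : {x y : Fin n} → x ≢ y → (M : Mat n) →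
               isSimpleGraph (adj (flipE x y M)) ≡ isSimpleGraph (adj M)
simple-flipE {x = x} {y} x≢y M = bool-ext
  (simple-complete ∘ Simple-Flip x≢y (Flip-sym (adj-flipE x≢y M)) ∘ simple-sound)
  (simple-complete ∘ Simple-Flip x≢y (adj-flipE x≢y M) ∘ simple-sound)

deg : Adj n → Fin n → ℕ
deg {n} A u = ∑ [ n ] (ind ∘ A u)

deg≤n : (A : Adj n) (u : Fin n) → deg A u ≤ n
deg≤n {n} A u = ≤-trans (∑-mono [ n ] λ v → ind≤1 (A u v))
  (≤-reflexive (trans (∑-allFin-const n 1) (*-identityʳ n)))

deg-Flip : {x y : Fin n} {A A′ : Adj n} → x ≢ y → Flip x y A A′ → Simple A → A x y ≡ false →
           ∀ u → deg A′ u ≡ deg A u + (ind (eqFin u x) + ind (eqFin u y))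
deg-Flip {n} {x} {y} {A} {A′} x≢y f s Axy u = begin
  ∑ [ n ] (ind ∘ A′ u)
    ≡⟨ ∑-cong [ n ] eq ⟩
  ∑ [ n ] (λ v → ind (A u v) +
      (ind (eqFin u x) * ind (eqFin v y) + ind (eqFin u y) * ind (eqFin v x)))
    ≡⟨ ∑-+ [ n ] _ _ ⟩
  deg A u + ∑ [ n ] (λ v →
      ind (eqFin u x) * ind (eqFin v y) + ind (eqFin u y) * ind (eqFin v x))
    ≡⟨ cong (deg A u +_) (∑-+ [ n ] _ _) ⟩
  deg A u + (∑ [ n ] (λ v → ind (eqFin u x) * ind (eqFin v y)) +
             ∑ [ n ] (λ v → ind (eqFin u y) * ind (eqFin v x)))
    ≡⟨ cong (deg A u +_) (cong₂ _+_ (pt (ind (eqFin u x)) y) (pt (ind (eqFin u y)) x)) ⟩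
  deg A u + (ind (eqFin u x) + ind (eqFin u y)) ∎
  where
  open ≡-Reasoning
  pt : ∀ c z → ∑ [ n ] (λ v → c * ind (eqFin v z)) ≡ c
  pt c z = trans (∑-*ˡ [ n ] c _) (trans (cong (c *_) (∑-δ₁ z)) (*-identityʳ c))
  eq : ∀ v → ind (A′ u v) ≡ ind (A u v) +
      (ind (eqFin u x) * ind (eqFin v y) + ind (eqFin u y) * ind (eqFin v x))
  eq v rewrite f u v with eqFin u x in eu | eqFin u y in ev
  ... | true | true = ⊥-elim (x≢y (trans (sym (eqFin-true {u = u} eu)) (eqFin-true ev)))
  ... | false | false = sym (+-identityʳ _)
  ... | true | false with eqFin v y in ew
  ...   | false = sym (+-identityʳ _)
  ...   | true rewrite eqFin-true {u = u} eu | eqFin-true {u = v} ew | Axy = refl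
  eq v | false | true with eqFin v x in ew
  ...   | false = sym (+-identityʳ _)
  ...   | true rewrite eqFin-true {u = u} ev | eqFin-true {u = v} ew | symm s y x | Axy = refl

Flip-edge : {x y : Fin n} {A A′ : Adj n} → Flip x y A A′ → A′ x y ≡ not (A x y)
Flip-edge {x = x} {y} f rewrite f x y | eqFin-refl x | eqFin-refl y = refl

deg-Flip⁻ : {x y : Fin n} {A A′ : Adj n} → x ≢ y → Flip x y A A′ → Simple A → A x y ≡ true →
            ∀ u → deg A u ≡ deg A′ u + (ind (eqFin u x) + ind (eqFin u y))
deg-Flip⁻ {A = A} {A′} x≢y f s Axy =
  deg-Flip {A = A′} {A} x≢y (Flip-sym {A = A} {A′} f) (Simple-Flip x≢y f s)
    (trans (Flip-edge {A = A} {A′} f) (cong not Axy))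

e₂ : Adj n → ℕ
e₂ {n} A = ∑ [ n ] (deg A)

e₂-Flip : {x y : Fin n} {A A′ : Adj n} → x ≢ y → Flip x y A A′ → Simple A → A x y ≡ false →
          e₂ A′ ≡ e₂ A + 2
e₂-Flip {n} {x} {y} {A} {A′} x≢y f s Axy = begin
  ∑ [ n ] (deg A′)
    ≡⟨ ∑-cong [ n ] (deg-Flip {A = A} {A′} x≢y f s Axy) ⟩
  ∑ [ n ] (λ u → deg A u + (ind (eqFin u x) + ind (eqFin u y)))
    ≡⟨ trans (∑-+ [ n ] _ _) (cong (e₂ A +_) (∑-+ [ n ] _ _)) ⟩
  e₂ A + (∑ [ n ] (λ u → ind (eqFin u x)) + ∑ [ n ] (λ u → ind (eqFin u y)))
    ≡⟨ cong (e₂ A +_) (cong₂ _+_ (∑-δ₁ x) (∑-δ₁ y)) ⟩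
  e₂ A + 2 ∎
  where open ≡-Reasoning

e₂≤n² : (A : Adj n) → e₂ A ≤ n * n
e₂≤n² {n} A = ≤-trans (∑-mono [ n ] (deg≤n A)) (≤-reflexive (∑-allFin-const n n))

-- The handshake lemma: removing one vertex removes its row and an equal column, while the diagonal
-- contributes nothing.
even-double-sum : (xs : List 𝒜) (f : 𝒜 → 𝒜 → ℕ) → (∀ x → f x x ≡ 0) → (∀ x y → f x y ≡ f y x) →
                  ∃ λ h → ∑ xs (λ x → ∑ xs (f x)) ≡ 2 * h
even-double-sum [] f irr sy = 0 , refl
even-double-sum (x ∷ xs) f irr sy with even-double-sum xs f irr sy
... | h , e = ∑ xs (f x) + h , (begin
  (f x x + ∑ xs (f x)) + ∑ xs (λ y → f y x + ∑ xs (f y))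
    ≡⟨ cong₂ _+_ (cong (_+ ∑ xs (f x)) (irr x)) (∑-+ xs _ _) ⟩
  ∑ xs (f x) + (∑ xs (λ y → f y x) + ∑ xs (λ y → ∑ xs (f y)))
    ≡⟨ cong (∑ xs (f x) +_) (cong₂ _+_ (∑-cong xs (λ y → sy y x)) e) ⟩
  ∑ xs (f x) + (∑ xs (f x) + 2 * h)
    ≡⟨ dbl (∑ xs (f x)) h ⟩
  2 * (∑ xs (f x) + h) ∎)
  where
  open ≡-Reasoning
  dbl : ∀ a b → a + (a + 2 * b) ≡ 2 * (a + b)
  dbl = solve-∀

e₂-even : {A : Adj n} → Simple A → ∃ λ h → e₂ A ≡ 2 * h
e₂-even {n} {A} s = even-double-sum [ n ] (λ u v → ind (A u v))
  (λ u → cong ind (irrefl s u)) (λ u v → cong ind (symm s u v))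

-- Graphs with independent edges

-- Edges are counted as ordered pairs, hence the halves; the diagonal only adds a
-- constant to the exponent of b.
wt : ℕ → ℕ → ℕ → ℕ → ℕ
wt n a b e = a ^ ⌊ e /2⌋ * b ^ ⌊ n * n ∸ e /2⌋

-- One more edge is two more ordered pairs and trades one factor b for one factor a. The hypothesis
-- keeps the truncated difference in the exponent of b honest.
wt-step : ∀ n a b e → e + 2 ≤ n * n → wt n a b (e + 2) * b ≡ wt n a b e * a
wt-step n a b e h rewrite +-comm e 2 = begin
  a * a ^ ⌊ e /2⌋ * b ^ ⌊ n * n ∸ (2 + e) /2⌋ * b
    ≡⟨ shuffle a b (a ^ ⌊ e /2⌋) (b ^ ⌊ n * n ∸ (2 + e) /2⌋) ⟩
  a ^ ⌊ e /2⌋ * (b * b ^ ⌊ n * n ∸ (2 + e) /2⌋) * a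
    ≡⟨ cong (λ r → a ^ ⌊ e /2⌋ * b ^ ⌊ r /2⌋ * a) rest ⟨
  a ^ ⌊ e /2⌋ * b ^ ⌊ n * n ∸ e /2⌋ * a ∎
  where
  open ≡-Reasoning
  shuffle : ∀ a b x y → a * x * y * b ≡ x * (b * y) * a
  shuffle = solve-∀
  rest : n * n ∸ e ≡ 2 + (n * n ∸ (2 + e))
  rest = begin
    n * n ∸ e ≡⟨ cong (_∸ e) (m+[n∸m]≡n h) ⟨
    2 + e + (n * n ∸ (2 + e)) ∸ e
      ≡⟨ cong (_∸ e) (cong (_+ (n * n ∸ (2 + e))) (+-comm 2 e)) ⟩
    e + 2 + (n * n ∸ (2 + e)) ∸ e ≡⟨ cong (_∸ e) (+-assoc e 2 _) ⟩
    e + (2 + (n * n ∸ (2 + e))) ∸ e ≡⟨ m+n∸m≡n e _ ⟩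
    2 + (n * n ∸ (2 + e)) ∎

-- 𝔼 a b m ψ sums ψ (number of ones) over m bits, a one weighing a and a zero b.
𝔼 : ℕ → ℕ → ℕ → (ℕ → ℕ) → ℕ
𝔼 a b zero ψ = ψ 0
𝔼 a b (suc m) ψ = a * 𝔼 a b m (ψ ∘ suc) + b * 𝔼 a b m ψ

𝔼-cong : ∀ a b m {f g} → (∀ j → f j ≡ g j) → 𝔼 a b m f ≡ 𝔼 a b m g
𝔼-cong a b zero h = h 0
𝔼-cong a b (suc m) h =
  cong₂ _+_ (cong (a *_) (𝔼-cong a b m (h ∘ suc))) (cong (b *_) (𝔼-cong a b m h))

𝔼-mono : ∀ a b m {f g} → (∀ j → f j ≤ g j) → 𝔼 a b m f ≤ 𝔼 a b m g
𝔼-mono a b zero h = h 0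
𝔼-mono a b (suc m) h =
  +-mono-≤ (*-monoʳ-≤ a (𝔼-mono a b m (h ∘ suc))) (*-monoʳ-≤ b (𝔼-mono a b m h))

𝔼-linear : ∀ a b m c d f g →
           𝔼 a b m (λ j → c * f j + d * g j) ≡ c * 𝔼 a b m f + d * 𝔼 a b m g
𝔼-linear a b zero c d f g = refl
𝔼-linear a b (suc m) c d f g
  rewrite 𝔼-linear a b m c d (f ∘ suc) (g ∘ suc) | 𝔼-linear a b m c d f g =
  shuffle a b c d (𝔼 a b m (f ∘ suc)) (𝔼 a b m (g ∘ suc)) (𝔼 a b m f) (𝔼 a b m g)
  where
  shuffle : ∀ a b c d x y z w → a * (c * x + d * y) + b * (c * z + d * w)
            ≡ c * (a * x + b * z) + d * (a * y + b * w)
  shuffle = solve-∀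

𝔼-*ʳ : ∀ a b m c f → 𝔼 a b m (λ j → f j * c) ≡ 𝔼 a b m f * c
𝔼-*ʳ a b m c f = begin
  𝔼 a b m (λ j → f j * c)
    ≡⟨ 𝔼-cong a b m (λ j → trans (*-comm (f j) c) (sym (+-identityʳ (c * f j)))) ⟩
  𝔼 a b m (λ j → c * f j + 0 * f j)
    ≡⟨ 𝔼-linear a b m c 0 f f ⟩
  c * 𝔼 a b m f + 0
    ≡⟨ trans (+-identityʳ _) (*-comm c _) ⟩
  𝔼 a b m f * c ∎
  where open ≡-Reasoning

cnt : List (Fin n) → Fin n → Adj n → ℕ
cnt C u A = ∑ C (ind ∘ A u)

degIn : (Fin n → Fin k) → Adj n → Fin k → Fin n → ℕ
degIn {n} p A j u = ∑ [ n ] (λ y → ind (A u y ∧ eqFin (p y) j))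

module Weighted (n a b : ℕ) where

  w : Mat n → ℕ
  w M = ind (isSimpleGraph (adj M)) * wt n a b (e₂ (adj M))

  -- The unnormalised expectation: dividing by `S (λ _ → 1)` gives the mean of F in the random graph
  -- with edge probability a / (a + b).
  S : (Mat n → ℕ) → ℕ
  S F = ∑ (mats n) (λ M → w M * F M)

  S-cong : ∀ {F G} → (∀ M → F M ≡ G M) → S F ≡ S G
  S-cong h = ∑-cong (mats n) λ M → cong (w M *_) (h M)

  S-mono : ∀ {F G} → (∀ M → F M ≤ G M) → S F ≤ S G
  S-mono h = ∑-mono (mats n) λ M → *-monoʳ-≤ (w M) (h M)

  S-+ : ∀ F G → S (λ M → F M + G M) ≡ S F + S G
  S-+ F G = trans (∑-cong (mats n) λ M → *-distribˡ-+ (w M) (F M) (G M)) (∑-+ (mats n) _ _)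

  S-*ʳ : ∀ F c → S (λ M → F M * c) ≡ S F * c
  S-*ʳ F c = trans (∑-cong (mats n) λ M → sym (*-assoc (w M) (F M) c)) (∑-*ʳ (mats n) c _)

  S-*ˡ : ∀ c F → S (λ M → c * F M) ≡ c * S F
  S-*ˡ c F = trans (S-cong λ M → *-comm c (F M)) (trans (S-*ʳ F c) (*-comm (S F) c))

  S-∑ : (xs : List 𝒜) (F : 𝒜 → Mat n → ℕ) → S (λ M → ∑ xs (λ x → F x M)) ≡ ∑ xs (λ x → S (F x))
  S-∑ xs F = trans (∑-cong (mats n) λ M → sym (∑-*ˡ xs (w M) (λ x → F x M)))
                   (∑-swap (mats n) xs (λ M x → w M * F x M))

  -- Detailed balance for one edge. The indicators select the graphs in which the flip adds the
  -- edge; in all other cases both sides vanish.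
  w-flip : ∀ {x y} → x ≢ y → ∀ M →
           w (flipE x y M) * ind (adj (flipE x y M) x y) * b ≡ w M * ind (not (adj M x y)) * a
  w-flip {x} {y} x≢y M
    rewrite simple-flipE x≢y M | Flip-edge {A = adj M} (adj-flipE x≢y M)
    with adj M x y in Axy | isSimpleGraph (adj M) in s
  ... | true | true rewrite *-zeroʳ (wt n a b (e₂ (adj (flipE x y M))) + 0)
                          | *-zeroʳ (wt n a b (e₂ (adj M)) + 0) = refl
  ... | true | false = refl
  ... | false | false = refl
  ... | false | true = begin
    (W′ + 0) * 1 * b ≡⟨ one W′ b ⟩
    W′ * b ≡⟨ cong (λ e → wt n a b e * b) step ⟩
    wt n a b (e₂ (adj M) + 2) * b
      ≡⟨ wt-step n a b (e₂ (adj M)) (subst (_≤ n * n) step (e₂≤n² (adj (flipE x y M)))) ⟩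
    W * a ≡⟨ one W a ⟨
    (W + 0) * 1 * a ∎
    where
    open ≡-Reasoning
    W′ = wt n a b (e₂ (adj (flipE x y M)))
    W = wt n a b (e₂ (adj M))
    one : ∀ x y → (x + 0) * 1 * y ≡ x * y
    one = solve-∀
    step : e₂ (adj (flipE x y M)) ≡ e₂ (adj M) + 2
    step = e₂-Flip x≢y (adj-flipE x≢y M) (simple-sound s) Axy

  S-edge-flip : ∀ {x y} → x ≢ y → (F : Mat n → ℕ) → (∀ M → F (flipE x y M) ≡ F M) →
                S (λ M → ind (adj M x y) * F M) * b ≡ S (λ M → ind (not (adj M x y)) * F M) * a
  S-edge-flip {x} {y} x≢y F inv = begin
    S (λ M → ind (adj M x y) * F M) * b
      ≡⟨ ∑-*ʳ (mats n) b _ ⟨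
    ∑ (mats n) (λ M → w M * (ind (adj M x y) * F M) * b)
      ≡⟨ ∑-flipE x y _ ⟨
    ∑ (mats n) (λ M → w (flipE x y M) * (ind (adj (flipE x y M) x y) * F (flipE x y M)) * b)
      ≡⟨ ∑-cong (mats n) eq ⟩
    ∑ (mats n) (λ M → w M * (ind (not (adj M x y)) * F M) * a)
      ≡⟨ ∑-*ʳ (mats n) a _ ⟩
    S (λ M → ind (not (adj M x y)) * F M) * a ∎
    where
    open ≡-Reasoning
    shuffle : ∀ w i f c → w * (i * f) * c ≡ w * i * c * f
    shuffle = solve-∀
    eq : ∀ M → w (flipE x y M) * (ind (adj (flipE x y M) x y) * F (flipE x y M)) * b
             ≡ w M * (ind (not (adj M x y)) * F M) * a
    eq M rewrite inv M
               | shuffle (w (flipE x y M)) (ind (adj (flipE x y M) x y)) (F M) b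
               | shuffle (w M) (ind (not (adj M x y))) (F M) a
               | w-flip x≢y M = refl

  S-split : ∀ x y F → S F ≡ S (λ M → ind (adj M x y) * F M) + S (λ M → ind (not (adj M x y)) * F M)
  S-split x y F = trans (S-cong eq) (S-+ _ _)
    where
    eq : ∀ M → F M ≡ ind (adj M x y) * F M + ind (not (adj M x y)) * F M
    eq M with adj M x y
    ... | true = sym (trans (+-identityʳ _) (+-identityʳ _))
    ... | false = sym (+-identityʳ _)

  -- When F ignores the edge xy, the part of `S F` with the edge and the part without it stand in
  -- the ratio a : b, so the edge is independent of F.
  S-edge : ∀ {x y} → x ≢ y → (F : Mat n → ℕ) → (∀ M → F (flipE x y M) ≡ F M) →
           S (λ M → ind (adj M x y) * F M) * (a + b) ≡ a * S F
  S-edge {x} {y} x≢y F inv = begin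
    P * (a + b) ≡⟨ *-distribˡ-+ P a b ⟩
    P * a + P * b ≡⟨ cong (P * a +_) (S-edge-flip x≢y F inv) ⟩
    P * a + N * a ≡⟨ *-distribʳ-+ a P N ⟨
    (P + N) * a ≡⟨ cong (_* a) (S-split x y F) ⟨
    S F * a ≡⟨ *-comm (S F) a ⟩
    a * S F ∎
    where
    open ≡-Reasoning
    P = S (λ M → ind (adj M x y) * F M)
    N = S (λ M → ind (not (adj M x y)) * F M)

  S-nonedge : ∀ {x y} → x ≢ y → (F : Mat n → ℕ) → (∀ M → F (flipE x y M) ≡ F M) →
              S (λ M → ind (not (adj M x y)) * F M) * (a + b) ≡ b * S F
  S-nonedge {x} {y} x≢y F inv = begin
    N * (a + b) ≡⟨ *-distribˡ-+ N a b ⟩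
    N * a + N * b ≡⟨ cong (_+ N * b) (S-edge-flip x≢y F inv) ⟨
    P * b + N * b ≡⟨ *-distribʳ-+ b P N ⟨
    (P + N) * b ≡⟨ cong (_* b) (S-split x y F) ⟨
    S F * b ≡⟨ *-comm (S F) b ⟩
    b * S F ∎
    where
    open ≡-Reasoning
    P = S (λ M → ind (adj M x y) * F M)
    N = S (λ M → ind (not (adj M x y)) * F M)

  -- The edges from u to C are independent of all that ignores them, so their number can be replaced
  -- by a binomial variable. They are averaged one by one: `Ψ′` holds the edge to x inside the
  -- integrand until the others are done, and still ignores those because x does not recur in C.
  S-count : ∀ u (C : List (Fin n)) → AllPairs _≢_ C → All (u ≢_) C → (Ψ : ℕ → Mat n → ℕ) →
            (∀ {x} → x ∈ C → ∀ j M → Ψ j (flipE u x M) ≡ Ψ j M) →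
            S (λ M → Ψ (cnt C u (adj M)) M) * (a + b) ^ length C
              ≡ S (λ M → 𝔼 a b (length C) (λ j → Ψ j M))
  S-count u [] [] [] Ψ inv = *-identityʳ _
  S-count u (x ∷ C) (x∉C ∷ uC) (u≢x ∷ u∉C) Ψ inv = begin
    S (λ M → Ψ (ind (adj M u x) + cnt C u (adj M)) M) * (Q * Q ^ m)
      ≡⟨ cong (_* (Q * Q ^ m)) (S-cong λ M → case (adj M u x) (cnt C u (adj M)) M) ⟩
    S (λ M → Ψ′ (cnt C u (adj M)) M) * (Q * Q ^ m)
      ≡⟨ shuffle (S (λ M → Ψ′ (cnt C u (adj M)) M)) Q (Q ^ m) ⟩
    S (λ M → Ψ′ (cnt C u (adj M)) M) * Q ^ m * Q
      ≡⟨ cong (_* Q) (S-count u C uC u∉C Ψ′ inv′) ⟩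
    S (λ M → 𝔼 a b m (λ j → Ψ′ j M)) * Q
      ≡⟨ cong (_* Q) (trans (S-cong λ M → 𝔼-linear a b m (ind (adj M u x)) (ind (not (adj M u x))) (λ j → Ψ (suc j) M) (λ j → Ψ j M)) (S-+ _ _)) ⟩
    (S (λ M → ind (adj M u x) * G₁ M) + S (λ M → ind (not (adj M u x)) * G₀ M)) * Q
      ≡⟨ *-distribʳ-+ Q (S (λ M → ind (adj M u x) * G₁ M)) _ ⟩
    S (λ M → ind (adj M u x) * G₁ M) * Q + S (λ M → ind (not (adj M u x)) * G₀ M) * Q
      ≡⟨ cong₂ _+_ (S-edge u≢x G₁ (λ M → 𝔼-cong a b m λ j → inv (here refl) (suc j) M))
                   (S-nonedge u≢x G₀ (λ M → 𝔼-cong a b m λ j → inv (here refl) j M)) ⟩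
    a * S G₁ + b * S G₀
      ≡⟨ cong₂ _+_ (sym (S-*ˡ a G₁)) (sym (S-*ˡ b G₀)) ⟩
    S (λ M → a * G₁ M) + S (λ M → b * G₀ M)
      ≡⟨ S-+ _ _ ⟨
    S (λ M → 𝔼 a b (suc m) (λ j → Ψ j M)) ∎
    where
    open ≡-Reasoning
    Q = a + b
    m = length C
    G₁ G₀ : Mat n → ℕ
    G₁ M = 𝔼 a b m (λ j → Ψ (suc j) M)
    G₀ M = 𝔼 a b m (λ j → Ψ j M)
    Ψ′ : ℕ → Mat n → ℕ
    Ψ′ j M = ind (adj M u x) * Ψ (suc j) M + ind (not (adj M u x)) * Ψ j M
    shuffle : ∀ s q r → s * (q * r) ≡ s * r * q
    shuffle = solve-∀
    case : ∀ β c M → Ψ (ind β + c) M ≡ ind β * Ψ (suc c) M + ind (not β) * Ψ c M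
    case true c M = sym (trans (+-identityʳ _) (+-identityʳ _))
    case false c M = sym (+-identityʳ _)
    inv′ : ∀ {y} → y ∈ C → ∀ j M → Ψ′ j (flipE u y M) ≡ Ψ′ j M
    inv′ {y} y∈C j M
      rewrite inv (there y∈C) (suc j) M | inv (there y∈C) j M
            | adj-flipE (All.lookup u∉C y∈C) M u x
            | eqE-left (All.lookup u∉C y∈C) x
            | eqFin-false (All.lookup x∉C y∈C) = refl

  -- Meant for ρ the contribution to the degree of u from outside C, and δ the degree of its
  -- partner. Neither sees the edges from u to C, so both act as constants and a point bound uniform
  -- in them suffices.
  S-step : .{{_ : NonZero (a + b)}} → ∀ u (C : List (Fin n)) → AllPairs _≢_ C → All (u ≢_) C →
           (F ρ δ : Mat n → ℕ) →
           (∀ {x} → x ∈ C → ∀ M → F (flipE u x M) ≡ F M) →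
           (∀ {x} → x ∈ C → ∀ M → ρ (flipE u x M) ≡ ρ M) →
           (∀ {x} → x ∈ C → ∀ M → δ (flipE u x M) ≡ δ M) →
           ∀ num den →
           (∀ r t → 𝔼 a b (length C) (λ j → ind (j + r ≡ᵇ t)) * num ≤ den * (a + b) ^ length C) →
           S (λ M → ind (cnt C u (adj M) + ρ M ≡ᵇ δ M) * F M) * num ≤ den * S F
  S-step u C uC u∉C F ρ δ invF invρ invδ num den bound =
    *-cancelʳ-≤ _ _ (Q ^ m) {{m^n≢0 Q m}} (begin
      X * num * Q ^ m ≡⟨ swap₃ X num (Q ^ m) ⟩
      X * Q ^ m * num
        ≡⟨ cong (_* num) (S-count u C uC u∉C Ψ inv) ⟩
      S (λ M → 𝔼 a b m (λ j → Ψ j M)) * num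
        ≡⟨ S-*ʳ _ num ⟨
      S (λ M → 𝔼 a b m (λ j → Ψ j M) * num)
        ≤⟨ S-mono le ⟩
      S (λ M → F M * (den * Q ^ m))
        ≡⟨ S-*ʳ F _ ⟩
      S F * (den * Q ^ m) ≡⟨ swap₄ (S F) den (Q ^ m) ⟩
      den * S F * Q ^ m ∎)
    where
    open ≤-Reasoning
    Q = a + b
    m = length C
    Ψ : ℕ → Mat n → ℕ
    Ψ j M = ind (j + ρ M ≡ᵇ δ M) * F M
    X = S (λ M → Ψ (cnt C u (adj M)) M)
    swap₃ : ∀ x y z → x * y * z ≡ x * z * y
    swap₃ = solve-∀
    swap₄ : ∀ x y z → x * (y * z) ≡ y * x * z
    swap₄ = solve-∀
    inv : ∀ {x} → x ∈ C → ∀ j M → Ψ j (flipE u x M) ≡ Ψ j M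
    inv x∈C j M rewrite invF x∈C M | invρ x∈C M | invδ x∈C M = refl
    le : ∀ M → 𝔼 a b m (λ j → Ψ j M) * num ≤ F M * (den * Q ^ m)
    le M = begin
      𝔼 a b m (λ j → Ψ j M) * num ≡⟨ cong (_* num) (𝔼-*ʳ a b m (F M) _) ⟩
      𝔼 a b m (λ j → ind (j + ρ M ≡ᵇ δ M)) * F M * num ≡⟨ swap₃ (𝔼 a b m (λ j → ind (j + ρ M ≡ᵇ δ M))) (F M) num ⟩
      𝔼 a b m (λ j → ind (j + ρ M ≡ᵇ δ M)) * num * F M ≤⟨ *-monoˡ-≤ (F M) (bound (ρ M) (δ M)) ⟩
      den * Q ^ m * F M ≡⟨ *-comm _ (F M) ⟩
      F M * (den * Q ^ m) ∎

-- Agreement of the degree vectors of many pairs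

Pairs : ℕ → ℕ → Set
Pairs n m = Vec (Fin n × Fin n) m

memB : ∀ {m} → Fin n → Pairs n m → Bool
memB x [] = false
memB x ((u , v) ∷ ps) = (eqFin x u ∨ eqFin x v) ∨ memB x ps

-- The first components are new at each step: the edges from u to vertices outside
-- all pairs then occur in no condition but that on u's own pair.
indepB : ∀ {m} → Pairs n m → Bool
indepB [] = true
indepB ((u , v) ∷ ps) = (not (eqFin u v) ∧ not (memB u ps)) ∧ indepB ps

∨-falseˡ : ∀ {b c} → b ∨ c ≡ false → b ≡ false
∨-falseˡ {false} h = refl

∨-falseʳ : ∀ {b c} → b ∨ c ≡ false → c ≡ false
∨-falseʳ {false} h = h

∨-introˡ : ∀ {b c} → b ≡ true → b ∨ c ≡ true
∨-introˡ refl = refl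

∨-introʳ : ∀ b {c} → c ≡ true → b ∨ c ≡ true
∨-introʳ true h = refl
∨-introʳ false h = h

∑-memB : ∀ {m} (ps : Pairs n m) → ∑ [ n ] (λ x → ind (memB x ps)) ≤ m * 2
∑-memB {n} [] = ≤-reflexive (∑-zero [ n ])
∑-memB {n} ((u , v) ∷ ps) = begin
  ∑ [ n ] (λ x → ind ((eqFin x u ∨ eqFin x v) ∨ memB x ps))
    ≤⟨ ∑-mono [ n ] (λ x → ind-∨₃ (eqFin x u) (eqFin x v) (memB x ps)) ⟩
  ∑ [ n ] (λ x → (ind (eqFin x u) + ind (eqFin x v)) + ind (memB x ps))
    ≡⟨ trans (∑-+ [ n ] _ _) (cong (_+ ∑ [ n ] (λ x → ind (memB x ps))) (∑-+ [ n ] _ _)) ⟩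
  ∑ [ n ] (λ x → ind (eqFin x u)) + ∑ [ n ] (λ x → ind (eqFin x v)) +
    ∑ [ n ] (λ x → ind (memB x ps))
    ≤⟨ +-mono-≤ (≤-reflexive (cong₂ _+_ (∑-δ₁ u) (∑-δ₁ v))) (∑-memB ps) ⟩
  2 + _ ∎
  where
  open ≤-Reasoning
  ind-∨₃ : ∀ a b c → ind ((a ∨ b) ∨ c) ≤ (ind a + ind b) + ind c
  ind-∨₃ true b c = s≤s z≤n
  ind-∨₃ false true c = s≤s z≤n
  ind-∨₃ false false c = ≤-refl

block : (Fin n → Bool) → (Fin n → Fin k) → Fin k → List (Fin n)
block {n} T p j = filter (λ y → T? (T y ∧ eqFin (p y) j)) [ n ]

∈-block : {T : Fin n → Bool} {p : Fin n → Fin k} {j : Fin k} {y : Fin n} →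
          y ∈ block T p j → T y ≡ true × p y ≡ j
∈-block {n} {T = T} {p} {j} {y} h
  with ∧-true {T y} (Equivalence.to T-≡ (proj₂ (∈-filter⁻ (λ y → T? (T y ∧ eqFin (p y) j)) {xs = allFin n} h)))
... | t , e = t , eqFin-true e

allFin-distinct : ∀ n → AllPairs _≢_ [ n ]
allFin-distinct n = AllPairs.tabulate⁺ id

agree : (Fin n → Fin k) → List (Fin k) → Fin n → Fin n → Adj n → ℕ
agree p [] u v A = 1
agree p (j ∷ js) u v A = ind (degIn p A j u ≡ᵇ degIn p A j v) * agree p js u v A

agreeAll : ∀ {m} → (Fin n → Fin k) → List (Fin k) → Pairs n m → Adj n → ℕ
agreeAll p js [] A = 1
agreeAll p js ((u , v) ∷ ps) A = agree p js u v A * agreeAll p js ps A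

degIn-other : (p : Fin n → Fin k) {u x y : Fin n} → u ≢ x → y ≢ u → y ≢ x →
              ∀ M j → degIn p (adj (flipE u x M)) j y ≡ degIn p (adj M) j y
degIn-other {n} p {u} {x} {y} u≢x y≢u y≢x M j = ∑-cong [ n ] λ z →
  cong (λ β → ind (β ∧ eqFin (p z) j))
    (trans (adj-flipE u≢x M y z) (cong (_xor adj M y z) (eqE-other y≢u y≢x z)))

degIn-other-colour : (p : Fin n → Fin k) {u x : Fin n} → u ≢ x → ∀ M {j} → p x ≢ j →
                     degIn p (adj (flipE u x M)) j u ≡ degIn p (adj M) j u
degIn-other-colour {n} p {u} {x} u≢x M {j} px≢j = ∑-cong [ n ] eq
  where
  eq : ∀ z → ind (adj (flipE u x M) u z ∧ eqFin (p z) j) ≡ ind (adj M u z ∧ eqFin (p z) j)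
  eq z rewrite adj-flipE u≢x M u z | eqE-left u≢x z with eqFin z x in e
  ... | false = refl
  ... | true rewrite eqFin-true {u = z} e | eqFin-false px≢j with adj M u x
  ...   | true = refl
  ...   | false = refl

agree-other : (p : Fin n → Fin k) {u x y z : Fin n} → u ≢ x → y ≢ u → y ≢ x → z ≢ u → z ≢ x →
              ∀ M js → agree p js y z (adj (flipE u x M)) ≡ agree p js y z (adj M)
agree-other p u≢x y≢u y≢x z≢u z≢x M [] = refl
agree-other p u≢x y≢u y≢x z≢u z≢x M (j ∷ js)
  rewrite degIn-other p u≢x y≢u y≢x M j | degIn-other p u≢x z≢u z≢x M j
        | agree-other p u≢x y≢u y≢x z≢u z≢x M js = refl

-- Separates the edges that will be randomised, those ending in T, from the remaining ones, which
-- only shift the count.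
degIn-block : (T : Fin n → Bool) (p : Fin n → Fin k) (A : Adj n) (j : Fin k) (u : Fin n) →
              degIn p A j u ≡ cnt (block T p j) u A +
                ∑ [ n ] (λ y → ind (A u y ∧ eqFin (p y) j) * ind (not (T y)))
degIn-block {n} T p A j u = begin
  degIn p A j u
    ≡⟨ ∑-cong [ n ] (λ y → eq (T y) (eqFin (p y) j) (A u y)) ⟩
  ∑ [ n ] (λ y → ind (T y ∧ eqFin (p y) j) * ind (A u y) +
    ind (A u y ∧ eqFin (p y) j) * ind (not (T y)))
    ≡⟨ ∑-+ [ n ] _ _ ⟩
  ∑ [ n ] (λ y → ind (T y ∧ eqFin (p y) j) * ind (A u y)) + rest
    ≡⟨ cong (_+ rest) (∑-filter (λ y → T y ∧ eqFin (p y) j) [ n ] (ind ∘ A u)) ⟨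
  cnt (block T p j) u A + rest ∎
  where
  open ≡-Reasoning
  rest = ∑ [ n ] (λ y → ind (A u y ∧ eqFin (p y) j) * ind (not (T y)))
  eq : ∀ t e α → ind (α ∧ e) ≡ ind (t ∧ e) * ind α + ind (α ∧ e) * ind (not t)
  eq true true true = refl
  eq true true false = refl
  eq true false true = refl
  eq true false false = refl
  eq false true true = refl
  eq false true false = refl
  eq false false true = refl
  eq false false false = refl

module Agreement (n a b : ℕ) .{{_ : NonZero (a + b)}} (T : Fin n → Bool) (p : Fin n → Fin k)
                 (num den : ℕ) where
  open Weighted n a b

  -- Uniformity in r and t allows the shift and the target to depend on the rest of the graph.
  Bounded : Fin k → Set
  Bounded j = ∀ r t →
    𝔼 a b (length (block T p j)) (λ i → ind (i + r ≡ᵇ t)) * num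
      ≤ den * (a + b) ^ length (block T p j)

  -- Blocks of distinct colours are disjoint, so an edge from u into the block of j affects neither
  -- the degrees of u into other colours nor any degree of v. Hence the point bounds multiply over
  -- the colours.
  S-agree-pair : ∀ {u v} → u ≢ v → T u ≡ false → T v ≡ false → (F : Mat n → ℕ) →
                 (∀ {x} → T x ≡ true → ∀ M → F (flipE u x M) ≡ F M) →
                 ∀ js → AllPairs _≢_ js → All Bounded js →
                 S (λ M → agree p js u v (adj M) * F M) * num ^ length js ≤ den ^ length js * S F
  S-agree-pair u≢v Tu Tv F inv [] [] [] =
    ≤-reflexive (trans (*-identityʳ _) (trans (S-cong λ M → +-identityʳ (F M)) (sym (+-identityʳ _))))
  S-agree-pair {u} {v} u≢v Tu Tv F inv (j ∷ js) (j∉js ∷ ujs) (bj ∷ bjs) = begin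
    S (λ M → ind (degIn p (adj M) j u ≡ᵇ δ M) * agree p js u v (adj M) * F M) * (num * N)
      ≡⟨ cong (_* (num * N)) (S-cong λ M → trans (*-assoc (ind (degIn p (adj M) j u ≡ᵇ δ M)) _ _)
           (cong (λ s → ind (s ≡ᵇ δ M) * F′ M) (degIn-block T p (adj M) j u))) ⟩
    S (λ M → ind (cnt C u (adj M) + ρ M ≡ᵇ δ M) * F′ M) * (num * N)
      ≡⟨ *-assoc X num N ⟨
    S (λ M → ind (cnt C u (adj M) + ρ M ≡ᵇ δ M) * F′ M) * num * N
      ≤⟨ *-monoˡ-≤ N (S-step u C uC u∉C F′ ρ δ invF invρ invδ num den bj) ⟩
    den * S F′ * N ≡⟨ *-assoc den (S F′) N ⟩
    den * (S F′ * N) ≤⟨ *-monoʳ-≤ den (S-agree-pair u≢v Tu Tv F inv js ujs bjs) ⟩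
    den * (den ^ length js * S F) ≡⟨ *-assoc den _ _ ⟨
    den * den ^ length js * S F ∎
    where
    open ≤-Reasoning
    N = num ^ length js
    C = block T p j
    δ ρ F′ : Mat n → ℕ
    δ M = degIn p (adj M) j v
    ρ M = ∑ [ n ] (λ y → ind (adj M u y ∧ eqFin (p y) j) * ind (not (T y)))
    F′ M = agree p js u v (adj M) * F M
    X = S (λ M → ind (cnt C u (adj M) + ρ M ≡ᵇ δ M) * F′ M)
    T≢ : ∀ {x y} → T x ≡ true → T y ≡ false → y ≢ x
    T≢ tx ty refl = true≢false (trans (sym tx) ty)
    inC : ∀ {x} → x ∈ C → T x ≡ true × p x ≡ j
    inC = ∈-block {T = T} {p} {j}
    uC : AllPairs _≢_ C
    uC = AllPairs.filter⁺ _ (allFin-distinct n)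
    u∉C : All (u ≢_) C
    u∉C = All.tabulate λ x∈C → T≢ (proj₁ (inC x∈C)) Tu
    invδ : ∀ {x} → x ∈ C → ∀ M → δ (flipE u x M) ≡ δ M
    invδ x∈C M = degIn-other p (T≢ tx Tu) (u≢v ∘ sym) (T≢ tx Tv) M j
      where tx = proj₁ (inC x∈C)
    invρ : ∀ {x} → x ∈ C → ∀ M → ρ (flipE u x M) ≡ ρ M
    invρ {x} x∈C M = ∑-cong [ n ] eq
      where
      tx : T x ≡ true
      tx = proj₁ (inC x∈C)
      u≢x : u ≢ x
      u≢x = T≢ tx Tu
      eq : ∀ y → ind (adj (flipE u x M) u y ∧ eqFin (p y) j) * ind (not (T y))
               ≡ ind (adj M u y ∧ eqFin (p y) j) * ind (not (T y))
      eq y rewrite adj-flipE u≢x M u y | eqE-left u≢x y with eqFin y x in e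
      ... | false = refl
      ... | true rewrite eqFin-true {u = y} e | tx =
        trans (*-zeroʳ (ind (not (adj M u x) ∧ eqFin (p x) j))) (sym (*-zeroʳ (ind (adj M u x ∧ eqFin (p x) j))))
    invAgree : ∀ {x} → T x ≡ true → p x ≡ j → ∀ is → All (j ≢_) is → ∀ M →
               agree p is u v (adj (flipE u x M)) ≡ agree p is u v (adj M)
    invAgree tx refl [] [] M = refl
    invAgree {x} tx refl (i ∷ is) (j≢i ∷ j∉is) M
      rewrite degIn-other-colour p (T≢ tx Tu) M j≢i
            | degIn-other p (T≢ tx Tu) (u≢v ∘ sym) (T≢ tx Tv) M i
            | invAgree tx refl is j∉is M = refl
    invF : ∀ {x} → x ∈ C → ∀ M → F′ (flipE u x M) ≡ F′ M
    invF x∈C M = cong₂ _*_ (invAgree (proj₁ (inC x∈C)) (proj₂ (inC x∈C)) js j∉js M)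
                           (inv (proj₁ (inC x∈C)) M)

  S-agreeAll : ∀ {m} (ps : Pairs n m) → (∀ x → memB x ps ≡ true → T x ≡ false) → indepB ps ≡ true →
               ∀ js → AllPairs _≢_ js → All Bounded js →
               S (agreeAll p js ps ∘ adj) * num ^ (m * length js) ≤ den ^ (m * length js) * S (λ _ → 1)
  S-agreeAll [] Tps ind-ps js ujs bjs = ≤-reflexive (trans (*-identityʳ _) (sym (+-identityʳ _)))
  S-agreeAll {suc m} ((u , v) ∷ ps) Tps ind-ps js ujs bjs = begin
    S (λ M → agree p js u v (adj M) * F M) * num ^ (l + m * l)
      ≡⟨ cong (X *_) (^-distribˡ-+-* num l (m * l)) ⟩
    X * (num ^ l * num ^ (m * l)) ≡⟨ *-assoc X _ _ ⟨
    X * num ^ l * num ^ (m * l)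
      ≤⟨ *-monoˡ-≤ (num ^ (m * l)) (S-agree-pair u≢v Tu Tv F inv js ujs bjs) ⟩
    den ^ l * S F * num ^ (m * l) ≡⟨ *-assoc (den ^ l) (S F) _ ⟩
    den ^ l * (S F * num ^ (m * l))
      ≤⟨ *-monoʳ-≤ (den ^ l) (S-agreeAll ps (λ x h → Tps x (∨-introʳ (eqFin x u ∨ eqFin x v) h)) (proj₂ (∧-true ind-ps)) js ujs bjs) ⟩
    den ^ l * (den ^ (m * l) * S (λ _ → 1)) ≡⟨ *-assoc (den ^ l) _ _ ⟨
    den ^ l * den ^ (m * l) * S (λ _ → 1)
      ≡⟨ cong (_* S (λ _ → 1)) (^-distribˡ-+-* den l (m * l)) ⟨
    den ^ (l + m * l) * S (λ _ → 1) ∎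
    where
    open ≤-Reasoning
    l = length js
    F : Mat n → ℕ
    F M = agreeAll p js ps (adj M)
    X = S (λ M → agree p js u v (adj M) * F M)
    u≢v : u ≢ v
    u≢v = eqFin-≢ (not-true (proj₁ (∧-true (proj₁ (∧-true ind-ps)))))
    u∉ps : memB u ps ≡ false
    u∉ps = not-true (proj₂ (∧-true {not (eqFin u v)} (proj₁ (∧-true ind-ps))))
    Tu : T u ≡ false
    Tu = Tps u (∨-introˡ (∨-introˡ (eqFin-refl u)))
    Tv : T v ≡ false
    Tv = Tps v (∨-introˡ (∨-introʳ (eqFin v u) (eqFin-refl v)))
    T≢ : ∀ {x y} → T x ≡ true → T y ≡ false → y ≢ x
    T≢ tx ty refl = true≢false (trans (sym tx) ty)
    invAll : ∀ {x} → T x ≡ true → ∀ {r} (qs : Pairs n r) →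
             (∀ y → memB y qs ≡ true → T y ≡ false) → memB u qs ≡ false →
             ∀ M → agreeAll p js qs (adj (flipE u x M)) ≡ agreeAll p js qs (adj M)
    invAll tx [] Tqs u∉qs M = refl
    invAll tx ((y , z) ∷ qs) Tqs u∉qs M =
      cong₂ _*_
        (agree-other p (T≢ tx Tu)
          (λ e → eqFin-≢ (∨-falseˡ (∨-falseˡ u∉qs)) (sym e))
          (T≢ tx (Tqs y (∨-introˡ (∨-introˡ (eqFin-refl y)))))
          (λ e → eqFin-≢ (∨-falseʳ {eqFin u y} (∨-falseˡ u∉qs)) (sym e))
          (T≢ tx (Tqs z (∨-introˡ (∨-introʳ (eqFin z y) (eqFin-refl z))))) M js)
        (invAll tx qs (λ x h → Tqs x (∨-introʳ (eqFin x y ∨ eqFin x z) h)) (∨-falseʳ {eqFin u y ∨ eqFin u z} u∉qs) M)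
    inv : ∀ {x} → T x ≡ true → ∀ M → F (flipE u x M) ≡ F M
    inv tx M = invAll tx ps (λ x h → Tps x (∨-introʳ (eqFin x u ∨ eqFin x v) h)) u∉ps M

-- Anticoncentration of a sum of independent bits

argmax : (f : ℕ → ℕ) (m : ℕ) → ∃ λ t → t ≤ m × (∀ s → s ≤ m → f s ≤ f t)
argmax f zero = 0 , z≤n , λ { zero z≤n → ≤-refl }
argmax f (suc m) with argmax f m
... | t , t≤m , h with ≤-total (f t) (f (suc m))
... | inj₁ le = suc m , ≤-refl , λ s s≤ → case (m≤n⇒m<n∨m≡n s≤)
  where
  case : ∀ {s} → s < suc m ⊎ s ≡ suc m → f s ≤ f (suc m)
  case (inj₁ (s≤s lt)) = ≤-trans (h _ lt) le
  case (inj₂ refl) = ≤-refl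
... | inj₂ ge = t , m≤n⇒m≤1+n t≤m , λ s s≤ → case (m≤n⇒m<n∨m≡n s≤)
  where
  case : ∀ {s} → s < suc m ⊎ s ≡ suc m → f s ≤ f t
  case (inj₁ (s≤s lt)) = h _ lt
  case (inj₂ refl) = ge

∑< : ℕ → (ℕ → ℕ) → ℕ
∑< zero f = 0
∑< (suc m) f = f 0 + ∑< m (f ∘ suc)

∑<-mono : ∀ m {f g} → (∀ i → i < m → f i ≤ g i) → ∑< m f ≤ ∑< m g
∑<-mono zero h = z≤n
∑<-mono (suc m) h = +-mono-≤ (h 0 (s≤s z≤n)) (∑<-mono m λ i lt → h (suc i) (s≤s lt))

∑<-const : ∀ m c → ∑< m (λ _ → c) ≡ m * c
∑<-const zero c = refl
∑<-const (suc m) c = cong (c +_) (∑<-const m c)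

∑<-shift : ∀ s m f → ∑< m (λ i → f (s + i)) ≤ ∑< (s + m) f
∑<-shift zero m f = ≤-refl
∑<-shift (suc s) m f = ≤-trans (∑<-shift s m (f ∘ suc)) (m≤n+m _ (f 0))

∑<-linear : ∀ m c d f g → ∑< m (λ i → c * f i + d * g i) ≡ c * ∑< m f + d * ∑< m g
∑<-linear zero c d f g = sym (cong₂ _+_ (*-zeroʳ c) (*-zeroʳ d))
∑<-linear (suc m) c d f g rewrite ∑<-linear m c d (f ∘ suc) (g ∘ suc) =
  shuffle c d (f 0) (g 0) (∑< m (f ∘ suc)) (∑< m (g ∘ suc))
  where
  shuffle : ∀ c d x y z w → c * x + d * y + (c * z + d * w) ≡ c * (x + z) + d * (y + w)
  shuffle = solve-∀

module Binomial (a b : ℕ) where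

  -- The binomial weight (m choose t) a^t b^(m - t), obtained without binomial coefficients.
  β : ℕ → ℕ → ℕ
  β m t = 𝔼 a b m (λ j → ind (j ≡ᵇ t))

  𝔼-0 : ∀ m → 𝔼 a b m (λ _ → 0) ≡ 0
  𝔼-0 zero = refl
  𝔼-0 (suc m) rewrite 𝔼-0 m | *-zeroʳ a | *-zeroʳ b = refl

  β-zero : ∀ m → β (suc m) 0 ≡ b * β m 0
  β-zero m = cong (_+ b * β m 0) (trans (cong (a *_) (𝔼-0 m)) (*-zeroʳ a))

  -- The ratio of consecutive binomial weights, (t + 1) b β(t + 1) = (m - t) a β(t), with the
  -- subtraction moved across. It follows by induction on m from Pascal's rule; t = 0 is separate
  -- because one of the two terms of that rule vanishes there.
  β-ratio-0 : ∀ m → 1 * b * β m 1 ≡ m * a * β m 0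
  β-ratio : ∀ m t → suc (suc t) * b * β m (suc (suc t)) + suc t * a * β m (suc t) ≡ m * a * β m (suc t)
  β-ratio-0 zero = *-zeroʳ (1 * b)
  β-ratio-0 (suc m) = begin
    1 * b * (a * β m 0 + b * β m 1) ≡⟨ s₁ a b (β m 0) (β m 1) ⟩
    a * b * β m 0 + b * (1 * b * β m 1) ≡⟨ cong (λ z → a * b * β m 0 + b * z) (β-ratio-0 m) ⟩
    a * b * β m 0 + b * (m * a * β m 0) ≡⟨ s₂ a b m (β m 0) ⟩
    suc m * a * (b * β m 0) ≡⟨ cong (suc m * a *_) (β-zero m) ⟨
    suc m * a * β (suc m) 0 ∎
    where
    open ≡-Reasoning
    s₁ : ∀ a b x y → 1 * b * (a * x + b * y) ≡ a * b * x + b * (1 * b * y)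
    s₁ = solve-∀
    s₂ : ∀ a b m x → a * b * x + b * (m * a * x) ≡ (1 + m) * a * (b * x)
    s₂ = solve-∀
  β-ratio zero t rewrite *-zeroʳ (suc (suc t) * b) | *-zeroʳ (suc t * a) = refl
  β-ratio (suc m) t = begin
    suc (suc t) * b * (a * x₁ + b * x₂) + suc t * a * β (suc m) (suc t)
      ≡⟨ s₁ a b t x₀ x₁ x₂ ⟩
    b * (suc (suc t) * b * x₂ + suc t * a * x₁) + a * (b * x₁) + a * (suc t * b * x₁ + t * a * x₀ + a * x₀)
      ≡⟨ cong₂ (λ y z → b * y + a * (b * x₁) + a * (z + a * x₀)) (β-ratio m t) (prev t) ⟩
    b * (m * a * x₁) + a * (b * x₁) + a * (m * a * x₀ + a * x₀)
      ≡⟨ s₂ a b m x₀ x₁ ⟩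
    suc m * a * β (suc m) (suc t) ∎
    where
    open ≡-Reasoning
    x₀ = β m t
    x₁ = β m (suc t)
    x₂ = β m (suc (suc t))
    prev : ∀ t → suc t * b * β m (suc t) + t * a * β m t ≡ m * a * β m t
    prev zero = trans (+-identityʳ _) (β-ratio-0 m)
    prev (suc t) = β-ratio m t
    s₁ : ∀ a b t x y z →
         (2 + t) * b * (a * y + b * z) + (1 + t) * a * (a * x + b * y)
         ≡ b * ((2 + t) * b * z + (1 + t) * a * y) + a * (b * y) + a * ((1 + t) * b * y + t * a * x + a * x)
    s₁ = solve-∀
    s₂ : ∀ a b m x y → b * (m * a * y) + a * (b * y) + a * (m * a * x + a * x)
         ≡ (1 + m) * a * (a * x + b * y)
    s₂ = solve-∀

  β-step : ∀ m t → suc t * b * β m (suc t) + t * a * β m t ≡ m * a * β m t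
  β-step m zero = trans (+-identityʳ _) (β-ratio-0 m)
  β-step m (suc t) = β-ratio m t

  β-above : ∀ m t → m < t → β m t ≡ 0
  β-above zero (suc t) h = refl
  β-above (suc m) (suc t) (s≤s h)
    rewrite β-above m t h | β-above m (suc t) (m≤n⇒m≤1+n h) | *-zeroʳ a | *-zeroʳ b = refl

  ∑β : ∀ m K → ∑< K (β m) ≤ (a + b) ^ m
  ∑β zero zero = z≤n
  ∑β zero (suc K) = ≤-reflexive (cong suc (trans (zeros K) refl))
    where
    zeros : ∀ K → ∑< K (λ i → β 0 (suc i)) ≡ 0
    zeros K = trans (∑<-const K 0) (*-zeroʳ K)
  ∑β (suc m) zero = z≤n
  ∑β (suc m) (suc K) = begin
    β (suc m) 0 + ∑< K (λ i → a * β m i + b * β m (suc i))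
      ≡⟨ cong₂ _+_ (β-zero m) (∑<-linear K a b (β m) (β m ∘ suc)) ⟩
    b * β m 0 + (a * ∑< K (β m) + b * ∑< K (β m ∘ suc))
      ≡⟨ shuffle a b (β m 0) (∑< K (β m)) (∑< K (β m ∘ suc)) ⟩
    a * ∑< K (β m) + b * (β m 0 + ∑< K (β m ∘ suc))
      ≤⟨ +-mono-≤ (*-monoʳ-≤ a (∑β m K)) (*-monoʳ-≤ b (∑β m (suc K))) ⟩
    a * (a + b) ^ m + b * (a + b) ^ m ≡⟨ *-distribʳ-+ ((a + b) ^ m) a b ⟨
    (a + b) ^ suc m ∎
    where
    open ≤-Reasoning
    shuffle : ∀ a b x y z → b * x + (a * y + b * z) ≡ a * y + b * (x + z)
    shuffle = solve-∀

  -- For t below r no j satisfies the equation, so replacing it by equality with the truncated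
  -- `t ∸ r` can only enlarge the event.
  β-bound⇒ : ∀ m num den → (∀ t → β m t * num ≤ den * (a + b) ^ m) →
             ∀ r t → 𝔼 a b m (λ j → ind (j + r ≡ᵇ t)) * num ≤ den * (a + b) ^ m
  β-bound⇒ m num den h r t =
    ≤-trans (*-monoˡ-≤ num (𝔼-mono a b m λ j → ind-mono {j + r ≡ᵇ t} λ e →
      ≡ᵇ-intro (trans (sym (m+n∸n≡m j r)) (cong (_∸ r) (≡ᵇ-true e))))) (h (t ∸ r))

  β-0-pos : 0 < b → ∀ m → 0 < β m 0
  β-0-pos b>0 zero = s≤s z≤n
  β-0-pos b>0 (suc m) = ≤-trans (*-mono-≤ b>0 (β-0-pos b>0 m)) (≤-reflexive (sym (β-zero m)))

  -- Right of the mode t the ratio β (s + 1) / β s = (m ∸ s) a / ((s + 1) b) stays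
  -- above 1 - 1 / 2L for L steps, so L values are at least half the maximum.
  anticoncentration : ∀ m L → 0 < L → 0 < b →
    (∀ s → s * (a + b) ≤ suc m * a + L * (a + b) →
           s * a + 2 * L * L * (a + b) ≤ m * a) →
    ∀ t → β m t * L ≤ 2 * (a + b) ^ m
  anticoncentration m L L>0 b>0 room t with argmax (β m) m
  ... | t₀ , t₀≤m , mx = ≤-trans (*-monoˡ-≤ L (top t)) main
    where
    Q = a + b
    top : ∀ s → β m s ≤ β m t₀
    top s with ≤-total s m
    ... | inj₁ le = mx s le
    ... | inj₂ ge with m≤n⇒m<n∨m≡n ge
    ...   | inj₁ lt = ≤-trans (≤-reflexive (β-above m s lt)) z≤n
    ...   | inj₂ refl = mx m ≤-refl
    β>0 : 0 < β m t₀
    β>0 = ≤-trans (β-0-pos b>0 m) (top 0)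
    -- The weight does not decrease on the step into the mode, and the ratio identity turns this
    -- into an upper bound on the position of the mode.
    mode : t₀ * Q ≤ suc m * a
    mode = lemma t₀ t₀≤m top β>0
      where
      lemma : ∀ s → s ≤ m → (∀ r → β m r ≤ β m s) → 0 < β m s → s * Q ≤ suc m * a
      lemma zero _ _ _ = z≤n
      lemma (suc s) s<m tp pos = *-cancelʳ-≤ _ _ (β m (suc s)) {{>-nonZero pos}} (begin
        suc s * (a + b) * y ≡⟨ s₁ a b s y ⟩
        suc s * b * y + (suc s * a * y) ≤⟨ +-monoˡ-≤ (suc s * a * y) key ⟩
        (m ∸ s) * a * y + suc s * a * y ≡⟨ s₂ (m ∸ s) a y s ⟩
        suc (m ∸ s + s) * a * y ≡⟨ cong (λ z → suc z * a * y) (m∸n+n≡m (<⇒≤ s<m)) ⟩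
        suc m * a * y ∎)
        where
        open ≤-Reasoning
        y = β m (suc s)
        x = β m s
        s₁ : ∀ a b s y → (1 + s) * (a + b) * y ≡ (1 + s) * b * y + (1 + s) * a * y
        s₁ = solve-∀
        s₂ : ∀ r a y s → r * a * y + (1 + s) * a * y ≡ (1 + (r + s)) * a * y
        s₂ = solve-∀
        s₃ : ∀ r a x s → (r + s) * a * x ≡ r * a * x + s * a * x
        s₃ = solve-∀
        key : suc s * b * y ≤ (m ∸ s) * a * y
        key = ≤-trans (≤-reflexive (+-cancelʳ-≡ (s * a * x) _ _ (trans (β-step m s)
                (trans (cong (λ z → z * a * x) (sym (m∸n+n≡m (<⇒≤ s<m)))) (s₃ (m ∸ s) a x s)))))
              (*-monoʳ-≤ ((m ∸ s) * a) (tp s))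
    β₀ = β m t₀
    step : ∀ i → i < L → 2 * L * β m (t₀ + i) ≤ 2 * L * β m (t₀ + suc i) + β m (t₀ + i)
    step i i<L rewrite +-suc t₀ i = *-cancelʳ-≤ _ _ Y {{Y≢0}} (begin
        2 * L * x * Y ≡⟨ s₁ (2 * L) x Y ⟩
        2 * L * Y * x ≤⟨ *-monoˡ-≤ x (cases (≤-total Y X)) ⟩
        (2 * L * X + Y) * x ≡⟨ s₂ (2 * L) X Y x ⟩
        2 * L * (X * x) + x * Y ≡⟨ cong (λ z → 2 * L * z + x * Y) Xx ⟨
        2 * L * (Y * y) + x * Y ≡⟨ s₃ (2 * L) Y y x ⟩
        (2 * L * y + x) * Y ∎)
      where
      open ≤-Reasoning
      s = t₀ + i
      x = β m s
      y = β m (suc s)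
      X = m * a ∸ s * a
      Y = suc s * b
      Y≢0 : NonZero Y
      Y≢0 = >-nonZero (*-mono-≤ {1} {suc s} (s≤s z≤n) b>0)
      s₁ : ∀ l x y → l * x * y ≡ l * y * x
      s₁ = solve-∀
      s₂ : ∀ l u v x → (l * u + v) * x ≡ l * (u * x) + x * v
      s₂ = solve-∀
      s₃ : ∀ l v y x → l * (v * y) + x * v ≡ (l * y + x) * v
      s₃ = solve-∀
      s₄ : ∀ s a b → (1 + s) * b + s * a + a ≡ (1 + s) * (a + b)
      s₄ = solve-∀
      s₅ : ∀ m a l → (1 + m) * a + l ≡ l + m * a + a
      s₅ = solve-∀
      s+ : suc s * Q ≤ suc m * a + L * Q
      s+ = begin
        suc (t₀ + i) * Q ≡⟨ cong (_* Q) (+-suc t₀ i) ⟨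
        (t₀ + suc i) * Q ≡⟨ *-distribʳ-+ Q t₀ (suc i) ⟩
        t₀ * Q + suc i * Q ≤⟨ +-mono-≤ mode (*-monoˡ-≤ Q i<L) ⟩
        suc m * a + L * Q ∎
      gap : s * a + 2 * L * L * Q ≤ m * a
      gap = room s (≤-trans (*-monoˡ-≤ Q (n≤1+n s)) s+)
      sa≤ : s * a ≤ m * a
      sa≤ = ≤-trans (m≤m+n _ _) gap
      X+ : X + s * a ≡ m * a
      X+ = m∸n+n≡m sa≤
      Xx : Y * y ≡ X * x
      Xx = +-cancelʳ-≡ (s * a * x) _ _ (trans (β-step m s)
             (trans (cong (_* x) (sym X+)) (*-distribʳ-+ x X (s * a))))
      X≥ : 2 * L * L * Q ≤ X
      X≥ = +-cancelʳ-≤ (s * a) _ _ (≤-trans (≤-reflexive (+-comm _ (s * a))) (≤-trans gap (≤-reflexive (sym X+))))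
      Y≤ : Y ≤ L * Q + X
      Y≤ = +-cancelʳ-≤ (s * a + a) _ _ (begin
        Y + (s * a + a) ≡⟨ +-assoc Y (s * a) a ⟨
        Y + s * a + a ≡⟨ s₄ s a b ⟩
        suc s * Q ≤⟨ s+ ⟩
        suc m * a + L * Q ≡⟨ s₅ m a (L * Q) ⟩
        L * Q + m * a + a ≡⟨ cong (λ z → L * Q + z + a) X+ ⟨
        L * Q + (X + s * a) + a ≡⟨ s₆ (L * Q) X (s * a) a ⟩
        L * Q + X + (s * a + a) ∎)
        where
        s₆ : ∀ l x s a → l + (x + s) + a ≡ l + x + (s + a)
        s₆ = solve-∀
      -- When the weight falls, Y exceeds X by at most L Q, while Y ≥ X ≥ 2 L L Q; the relative loss
      -- is therefore at most 1 / 2L.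
      cases : Y ≤ X ⊎ X ≤ Y → 2 * L * Y ≤ 2 * L * X + Y
      cases (inj₁ h) = ≤-trans (*-monoʳ-≤ (2 * L) h) (m≤m+n _ _)
      cases (inj₂ h) = begin
        2 * L * Y ≤⟨ *-monoʳ-≤ (2 * L) Y≤ ⟩
        2 * L * (L * Q + X) ≡⟨ s₇ L Q X ⟩
        2 * L * X + 2 * L * L * Q ≤⟨ +-monoʳ-≤ (2 * L * X) (≤-trans X≥ h) ⟩
        2 * L * X + Y ∎
        where
        s₇ : ∀ l q x → 2 * l * (l * q + x) ≡ 2 * l * x + 2 * l * l * q
        s₇ = solve-∀
    steps : ∀ i → i ≤ L → 2 * L * β₀ ≤ 2 * L * β m (t₀ + i) + i * β₀
    steps zero _ = ≤-trans (≤-reflexive (cong (λ z → 2 * L * β m z) (sym (+-identityʳ t₀)))) (m≤m+n _ _)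
    steps (suc i) i<L = begin
      2 * L * β₀ ≤⟨ steps i (<⇒≤ i<L) ⟩
      2 * L * β m (t₀ + i) + i * β₀ ≤⟨ +-monoˡ-≤ (i * β₀) (step i i<L) ⟩
      2 * L * β m (t₀ + suc i) + β m (t₀ + i) + i * β₀
        ≤⟨ +-monoˡ-≤ (i * β₀) (+-monoʳ-≤ (2 * L * β m (t₀ + suc i)) (top (t₀ + i))) ⟩
      2 * L * β m (t₀ + suc i) + β₀ + i * β₀ ≡⟨ +-assoc _ β₀ (i * β₀) ⟩
      2 * L * β m (t₀ + suc i) + suc i * β₀ ∎
      where open ≤-Reasoning
    half : ∀ i → i < L → β₀ ≤ 2 * β m (t₀ + i)
    half i i<L = *-cancelˡ-≤ L {{>-nonZero L>0}} (+-cancelʳ-≤ (L * β₀) _ _ (begin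
      L * β₀ + L * β₀ ≡⟨ s₁ L β₀ ⟩
      2 * L * β₀ ≤⟨ steps i (<⇒≤ i<L) ⟩
      2 * L * β m (t₀ + i) + i * β₀ ≤⟨ +-monoʳ-≤ (2 * L * β m (t₀ + i)) (*-monoˡ-≤ β₀ (<⇒≤ i<L)) ⟩
      2 * L * β m (t₀ + i) + L * β₀ ≡⟨ cong (_+ L * β₀) (s₂ L (β m (t₀ + i))) ⟩
      L * (2 * β m (t₀ + i)) + L * β₀ ∎))
      where
      open ≤-Reasoning
      s₁ : ∀ l x → l * x + l * x ≡ 2 * l * x
      s₁ = solve-∀
      s₂ : ∀ l x → 2 * l * x ≡ l * (2 * x)
      s₂ = solve-∀
    main : β₀ * L ≤ 2 * Q ^ m
    main = begin
      β₀ * L ≡⟨ *-comm β₀ L ⟩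
      L * β₀ ≡⟨ ∑<-const L β₀ ⟨
      ∑< L (λ _ → β₀) ≤⟨ ∑<-mono L half ⟩
      ∑< L (λ i → 2 * β m (t₀ + i))
        ≤⟨ ∑<-mono L (λ i _ → ≤-reflexive (sym (+-identityʳ _))) ⟩
      ∑< L (λ i → 2 * β m (t₀ + i) + 0 * 0)
        ≡⟨ ∑<-linear L 2 0 (λ i → β m (t₀ + i)) (λ _ → 0) ⟩
      2 * ∑< L (λ i → β m (t₀ + i)) + 0
        ≡⟨ +-identityʳ _ ⟩
      2 * ∑< L (λ i → β m (t₀ + i))
        ≤⟨ *-monoʳ-≤ 2 (≤-trans (∑<-shift t₀ L (β m)) (∑β m (t₀ + L))) ⟩
      2 * Q ^ m ∎
      where open ≤-Reasoning

-- Switchings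

-- Applied when x is adjacent to i and not to j: the edge at x is moved from i to j, which leaves
-- the degree of x unchanged.
swap : Fin n → Fin n → Fin n → Mat n → Mat n
swap i j x M = flipE i x (flipE j x M)

-- A swap permutes the list of all matrices, so a pointwise comparison along it compares the sums.
-- This replaces an injectivity argument on the graphs concerned.
∑-shift : (i j x : Fin n) {F G : Mat n → ℕ} → (∀ M → F M ≤ G (swap i j x M)) →
          ∑ (mats n) F ≤ ∑ (mats n) G
∑-shift {n} i j x {F} {G} h = ≤-trans (∑-mono (mats n) h)
  (≤-reflexive (trans (∑-flipE j x (G ∘ flipE i x)) (∑-flipE i x G)))

module Swap {n} {i j x : Fin n} (i≢j : i ≢ j) (x≢i : x ≢ i) (x≢j : x ≢ j) (M : Mat n) where
  private
    A = adj M
    A₁ = adj (flipE j x M)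
    A₂ = adj (swap i j x M)
    f₁ : Flip j x A A₁
    f₁ = adj-flipE (x≢j ∘ sym) M
    f₂ : Flip i x A₁ A₂
    f₂ = adj-flipE (x≢i ∘ sym) (flipE j x M)

  swap-simple : isSimpleGraph A₂ ≡ isSimpleGraph A
  swap-simple = trans (simple-flipE (x≢i ∘ sym) (flipE j x M)) (simple-flipE (x≢j ∘ sym) M)

  swap-other : ∀ {u} → u ≢ i → u ≢ j → u ≢ x → ∀ y → A₂ u y ≡ A u y
  swap-other {u} u≢i u≢j u≢x y rewrite f₂ u y | f₁ u y | eqE-other u≢i u≢x y | eqE-other u≢j u≢x y = refl

  private
    i≢x : i ≢ x
    i≢x = x≢i ∘ sym
    j≢x : j ≢ x
    j≢x = x≢j ∘ sym
    j≢i : j ≢ i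
    j≢i = i≢j ∘ sym

  swap-from : ∀ y → A₂ i y ≡ eqFin y x xor A i y
  swap-from y rewrite f₂ i y | f₁ i y | eqE-left i≢x y | eqE-other i≢j i≢x y = refl

  swap-to : ∀ y → A₂ j y ≡ eqFin y x xor A j y
  swap-to y rewrite f₂ j y | f₁ j y | eqE-other j≢i j≢x y | eqE-left j≢x y = refl

  swap-deg : Simple A → A i x ≡ true → A j x ≡ false →
             ∀ u → deg A₂ u + ind (eqFin u i) ≡ deg A u + ind (eqFin u j)
  swap-deg s Aix Ajx u = +-cancelʳ-≡ X _ _ (begin
    deg A₂ u + ind (eqFin u i) + X ≡⟨ +-assoc (deg A₂ u) _ X ⟩
    deg A₂ u + (ind (eqFin u i) + X)
      ≡⟨ deg-Flip⁻ {A = A₁} {A₂} (x≢i ∘ sym) f₂ s₁ A₁ix u ⟨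
    deg A₁ u ≡⟨ deg-Flip {A = A} {A₁} (x≢j ∘ sym) f₁ s Ajx u ⟩
    deg A u + (ind (eqFin u j) + X) ≡⟨ +-assoc (deg A u) _ X ⟨
    deg A u + ind (eqFin u j) + X ∎)
    where
    open ≡-Reasoning
    X = ind (eqFin u x)
    s₁ : Simple A₁
    s₁ = Simple-Flip {A = A} {A₁} (x≢j ∘ sym) f₁ s
    A₁ix : A₁ i x ≡ true
    A₁ix rewrite f₁ i x | eqE-other i≢j i≢x x = Aix

-- Popularity of the regular degree sequence

degree≡deg : (A : Adj n) (u : Fin n) → degree A u ≡ deg A u
degree≡deg {n} A u = countB≡∑ [ n ] (A u)

degB : (Fin n → ℕ) → Adj n → Bool
degB {n} s A = allB [ n ] (λ v → degree A v ≡ᵇ s v)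

degB-sound : {s : Fin n → ℕ} {A : Adj n} → degB s A ≡ true → ∀ u → deg A u ≡ s u
degB-sound {A = A} h u = trans (sym (degree≡deg A u)) (≡ᵇ-true (allFin-true h u))

degB-complete : {s : Fin n → ℕ} {A : Adj n} → (∀ u → deg A u ≡ s u) → degB s A ≡ true
degB-complete {n} {A = A} h = allB-intro [ n ] λ u → ≡ᵇ-intro (trans (degree≡deg A u) (h u))

realB : (Fin n → ℕ) → Adj n → Bool
realB s A = isSimpleGraph A ∧ degB s A

#real : (Fin n → ℕ) → ℕ
#real {n} s = ∑ (mats n) (λ M → ind (realB s (adj M)))

-- The case x = j has to be excluded from the moves: the switch would create a loop at j.
closedB : Adj n → Fin n → Fin n → Bool
closedB A j x = A j x ∨ eqFin x j

common : Fin n → Fin n → Adj n → ℕ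
common {n} i j A = ∑ [ n ] (λ x → ind (A i x ∧ closedB A j x))

only : Fin n → Fin n → Adj n → ℕ
only {n} i j A = ∑ [ n ] (λ x → ind (A i x ∧ not (closedB A j x)))

common+only : (i j : Fin n) (A : Adj n) → common i j A + only i j A ≡ deg A i
common+only {n} i j A = trans (sym (∑-+ [ n ] _ _))
  (∑-cong [ n ] λ x → ind-split (A i x) (closedB A j x))

-- The asymmetry of `common` is confined to the term x = j, which records whether ij is an edge.
common-sym : {A : Adj n} → Simple A → ∀ i j → common i j A ≡ common j i A
common-sym {n} {A} s i j = begin
  common i j A ≡⟨ half i j ⟩
  ∑ [ n ] (λ x → ind (A i x ∧ A j x)) + ind (A i j)
    ≡⟨ cong₂ _+_ (∑-cong [ n ] λ x → cong ind (∧-comm (A i x) (A j x))) (cong ind (symm s i j)) ⟩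
  ∑ [ n ] (λ x → ind (A j x ∧ A i x)) + ind (A j i) ≡⟨ half j i ⟨
  common j i A ∎
  where
  open ≡-Reasoning
  half : ∀ i j → common i j A ≡ ∑ [ n ] (λ x → ind (A i x ∧ A j x)) + ind (A i j)
  half i j = trans (∑-cong [ n ] eq)
    (trans (∑-+ [ n ] _ _) (cong (∑ [ n ] (λ x → ind (A i x ∧ A j x)) +_) (∑-δ j (λ x → ind (A i x)))))
    where
    eq : ∀ x → ind (A i x ∧ closedB A j x) ≡ ind (A i x ∧ A j x) + ind (eqFin x j) * ind (A i x)
    eq x with eqFin x j in e
    ... | true rewrite eqFin-true {u = x} e | irrefl s j with A i j
    ...   | true = refl
    ...   | false = refl
    eq x | false with A i x | A j x
    ... | true | true = refl
    ... | true | false = refl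
    ... | false | true = refl
    ... | false | false = refl

common≤n : (i j : Fin n) (A : Adj n) → common i j A ≤ n
common≤n i j A = ≤-trans (m≤m+n _ _) (≤-trans (≤-reflexive (common+only i j A)) (deg≤n A i))

-- The moves preserve `common`.  On the graphs where it equals c, every graph with
-- degrees s has s i ∸ c moves, and every graph with degrees s′ is reached by s′ j ∸ c.
module Balance {n} (s s′ : Fin n → ℕ) (i j : Fin n) (gap : s j + 2 ≤ s i)
               (move : ∀ u → s′ u + ind (eqFin u i) ≡ s u + ind (eqFin u j)) where

  i≢j : i ≢ j
  i≢j refl = m+1+n≰m (s i) gap

  s′j : s′ j ≡ s j + 1
  s′j = trans (sym (+-identityʳ _)) (trans (cong (λ β → s′ j + ind β) (sym (eqFin-false (i≢j ∘ sym))))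
          (trans (move j) (cong (λ β → s j + ind β) (eqFin-refl j))))

  term term′ : ℕ → Mat n → ℕ
  term c M = ind (realB s (adj M)) * ind (c ≡ᵇ common i j (adj M))
  term′ c M = ind (realB s′ (adj M)) * ind (c ≡ᵇ common i j (adj M))

  shift : ∀ c x → ∑ (mats n) (λ M → term c M * ind (adj M i x ∧ not (closedB (adj M) j x)))
                ≤ ∑ (mats n) (λ M → term′ c M * ind (adj M j x ∧ not (closedB (adj M) i x)))
  shift c x = ∑-shift i j x pointwise
    where
    pointwise : ∀ M → term c M * ind (adj M i x ∧ not (closedB (adj M) j x))
              ≤ term′ c (swap i j x M) *
                ind (adj (swap i j x M) j x ∧ not (closedB (adj (swap i j x M)) i x))
    pointwise M with realB s (adj M) in real
    ... | false = z≤n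
    ... | true with adj M i x ∧ not (closedB (adj M) j x) in valid
    ...   | false = ≤-trans (≤-reflexive (*-zeroʳ (ind (c ≡ᵇ common i j (adj M)) + 0))) z≤n
    ...   | true = ≤-reflexive (sym (begin
      ind (realB s′ A₂) * ind (c ≡ᵇ common i j A₂) * ind (A₂ j x ∧ not (closedB A₂ i x))
        ≡⟨ cong (_* ind (A₂ j x ∧ not (closedB A₂ i x))) (cong₂ _*_ (cong ind real′) (cong (λ z → ind (c ≡ᵇ z)) common′)) ⟩
      1 * ind (c ≡ᵇ common i j A) * ind (A₂ j x ∧ not (closedB A₂ i x))
        ≡⟨ cong (1 * ind (c ≡ᵇ common i j A) *_) (cong ind valid′) ⟩
      1 * ind (c ≡ᵇ common i j A) * 1 ∎))
      where
      open ≡-Reasoning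
      A = adj M
      A₂ = adj (swap i j x M)
      simp : isSimpleGraph A ≡ true
      simp = proj₁ (∧-true real)
      sA : Simple A
      sA = simple-sound simp
      Aix : A i x ≡ true
      Aix = proj₁ (∧-true valid)
      notclosed : closedB A j x ≡ false
      notclosed = not-true (proj₂ (∧-true {A i x} valid))
      Ajx : A j x ≡ false
      Ajx = ∨-falseˡ notclosed
      x≢j : x ≢ j
      x≢j = eqFin-≢ (∨-falseʳ {A j x} notclosed)
      x≢i : x ≢ i
      x≢i refl = true≢false (trans (sym Aix) (irrefl sA i))
      open Swap i≢j x≢i x≢j M
      real′ : realB s′ A₂ ≡ true
      real′ = ∧-intro (trans swap-simple simp) (degB-complete λ u →
        +-cancelʳ-≡ (ind (eqFin u i)) _ _ (trans (swap-deg sA Aix Ajx u)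
          (trans (cong (_+ ind (eqFin u j)) (degB-sound {A = A} (proj₂ (∧-true {isSimpleGraph A} real)) u)) (sym (move u)))))
      valid′ : (A₂ j x ∧ not (closedB A₂ i x)) ≡ true
      valid′ rewrite swap-to x | swap-from x | eqFin-refl x | Ajx | Aix | eqFin-false x≢i = refl
      common′ : common i j A₂ ≡ common i j A
      common′ = ∑-cong [ n ] eq
        where
        eq : ∀ y → ind (A₂ i y ∧ closedB A₂ j y) ≡ ind (A i y ∧ closedB A j y)
        eq y rewrite swap-to y | swap-from y with eqFin y x in e
        ... | false = refl
        ... | true rewrite eqFin-true {u = y} e | Aix | Ajx | eqFin-false x≢j = refl

  ∑term : ∀ c → ∑ (mats n) (term c) * (s i ∸ c) ≤ ∑ (mats n) (term′ c) * (s′ j ∸ c)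
  ∑term c = begin
    ∑ (mats n) (term c) * (s i ∸ c)
      ≡⟨ ∑-*ʳ (mats n) (s i ∸ c) (term c) ⟨
    ∑ (mats n) (λ M → term c M * (s i ∸ c))
      ≡⟨ ∑-cong (mats n) left ⟩
    ∑ (mats n) (λ M → term c M * only i j (adj M))
      ≡⟨ ∑-cong (mats n) (λ M → ∑-*ˡ [ n ] (term c M) _) ⟨
    ∑ (mats n) (λ M → ∑ [ n ] λ x → term c M * ind (adj M i x ∧ not (closedB (adj M) j x)))
      ≡⟨ ∑-swap (mats n) [ n ] _ ⟩
    ∑ [ n ] (λ x → ∑ (mats n) λ M → term c M * ind (adj M i x ∧ not (closedB (adj M) j x)))
      ≤⟨ ∑-mono [ n ] (shift c) ⟩
    ∑ [ n ] (λ x → ∑ (mats n) λ M → term′ c M * ind (adj M j x ∧ not (closedB (adj M) i x)))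
      ≡⟨ ∑-swap (mats n) [ n ] _ ⟨
    ∑ (mats n) (λ M → ∑ [ n ] λ x → term′ c M * ind (adj M j x ∧ not (closedB (adj M) i x)))
      ≡⟨ ∑-cong (mats n) (λ M → ∑-*ˡ [ n ] (term′ c M) _) ⟩
    ∑ (mats n) (λ M → term′ c M * only j i (adj M))
      ≡⟨ ∑-cong (mats n) right ⟩
    ∑ (mats n) (λ M → term′ c M * (s′ j ∸ c))
      ≡⟨ ∑-*ʳ (mats n) (s′ j ∸ c) (term′ c) ⟩
    ∑ (mats n) (term′ c) * (s′ j ∸ c) ∎
    where
    open ≤-Reasoning
    left : ∀ M → term c M * (s i ∸ c) ≡ term c M * only i j (adj M)
    left M with realB s (adj M) in real | c ≡ᵇ common i j (adj M) in e
    ... | false | _ = refl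
    ... | true | false = refl
    ... | true | true = cong (_+ 0) (trans (cong₂ _∸_
            (trans (sym (degB-sound {A = adj M} (proj₂ (∧-true {isSimpleGraph (adj M)} real)) i)) (sym (common+only i j (adj M))))
            (≡ᵇ-true {c} e))
          (m+n∸m≡n (common i j (adj M)) _))
    right : ∀ M → term′ c M * only j i (adj M) ≡ term′ c M * (s′ j ∸ c)
    right M with realB s′ (adj M) in real | c ≡ᵇ common i j (adj M) in e
    ... | false | _ = refl
    ... | true | false = refl
    ... | true | true = cong (_+ 0) (sym (trans (cong₂ _∸_
            (trans (sym (degB-sound {A = adj M} (proj₂ (∧-true {isSimpleGraph (adj M)} real)) j)) (sym (common+only j i (adj M))))
            (trans (≡ᵇ-true {c} e) (common-sym (simple-sound {A = adj M} (proj₁ (∧-true real))) i j)))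
          (m+n∸m≡n (common j i (adj M)) _)))

  -- Since s′ j = s j + 1 ≤ s i, each graph with degrees s has at least as many moves out as a graph
  -- with degrees s′ has moves in. The number of moves in is positive for c ≤ s j, and for larger c
  -- the left side is empty: j has at most s j common neighbours with i.
  ∑term≤ : ∀ c → ∑ (mats n) (term c) ≤ ∑ (mats n) (term′ c)
  ∑term≤ c with c ≤? s j
  ... | yes c≤ = *-cancelʳ-≤ _ _ (s′ j ∸ c) {{>-nonZero (m<n⇒0<n∸m (≤-trans (s≤s c≤) (≤-reflexive (trans (+-comm 1 (s j)) (sym s′j)))))}}
    (≤-trans (*-monoʳ-≤ (∑ (mats n) (term c))
      (∸-monoˡ-≤ c (≤-trans (≤-reflexive s′j) (≤-trans (+-monoʳ-≤ (s j) (s≤s z≤n)) gap)))) (∑term c))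
  ... | no c≰ = ≤-trans (≤-reflexive (trans (∑-cong (mats n) none) (∑-zero (mats n)))) z≤n
    where
    none : ∀ M → term c M ≡ 0
    none M with realB s (adj M) in real | c ≡ᵇ common i j (adj M) in e
    ... | false | _ = refl
    ... | true | false = refl
    ... | true | true = ⊥-elim (c≰ (begin
      c ≡⟨ trans (≡ᵇ-true {c} e) (common-sym (simple-sound {A = adj M} (proj₁ (∧-true real))) i j) ⟩
      common j i (adj M) ≤⟨ m≤m+n _ _ ⟩
      common j i (adj M) + only j i (adj M) ≡⟨ common+only j i (adj M) ⟩
      deg (adj M) j ≡⟨ degB-sound {A = adj M} (proj₂ (∧-true {isSimpleGraph (adj M)} real)) j ⟩
      s j ∎))
      where open ≤-Reasoning

  classes : ∀ (g : Mat n → ℕ) → ∑ (mats n) g ≡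
            ∑ [ suc n ] (λ c → ∑ (mats n) (λ M → g M * ind (toℕ c ≡ᵇ common i j (adj M))))
  classes g = trans (∑-cong (mats n) eq) (∑-swap (mats n) [ suc n ] _)
    where
    eq : ∀ M → g M ≡ ∑ [ suc n ] (λ c → g M * ind (toℕ c ≡ᵇ common i j (adj M)))
    eq M = sym (trans (∑-*ˡ [ suc n ] (g M) _) (trans (cong (g M *_)
      (trans (∑-cong [ suc n ] λ c → cong (λ z → ind (toℕ c ≡ᵇ z)) (sym (Fin.toℕ-fromℕ< (s≤s (common≤n i j (adj M))))))
        (∑-δ₁ (fromℕ< (s≤s (common≤n i j (adj M)))))))
      (*-identityʳ (g M))))

  #real-balance : #real s ≤ #real s′
  #real-balance = ≤-trans (≤-reflexive (classes _))
    (≤-trans (∑-mono [ suc n ] λ c → ∑term≤ (toℕ c)) (≤-reflexive (sym (classes _))))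

∑-≤-≡ : {f g : Fin n → ℕ} → (∀ x → f x ≤ g x) → ∑ [ n ] f ≡ ∑ [ n ] g → ∀ x → f x ≡ g x
∑-≤-≡ {n} {f} {g} le eq x with m≤n⇒m<n∨m≡n (le x)
... | inj₂ e = e
... | inj₁ lt = ⊥-elim (1+n≰n (begin
  suc (∑ [ n ] g) ≡⟨ cong suc eq ⟨
  1 + ∑ [ n ] f ≡⟨ cong (_+ ∑ [ n ] f) (∑-δ₁ x) ⟨
  ∑ [ n ] (λ y → ind (eqFin y x)) + ∑ [ n ] f ≡⟨ ∑-+ [ n ] _ f ⟨
  ∑ [ n ] (λ y → ind (eqFin y x) + f y) ≤⟨ ∑-mono [ n ] pt ⟩
  ∑ [ n ] g ∎))
  where
  open ≤-Reasoning
  pt : ∀ y → ind (eqFin y x) + f y ≤ g y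
  pt y with eqFin y x in e
  ... | true rewrite eqFin-true {u = y} e = lt
  ... | false = le y

-- Induction on the total excess above d. As the average is d, an irregular sequence has an entry
-- above d and one below, and moving one unit between them lowers the excess by exactly one.
#real-regular : ∀ d E (s : Fin n → ℕ) → ∑ [ n ] s ≡ n * d → ∑ [ n ] (λ u → s u ∸ d) ≡ E →
                #real s ≤ #real {n} (λ _ → d)
#real-regular {n} d zero s total excess = ∑-mono (mats n) λ M → ind-mono λ h →
  ∧-intro (proj₁ (∧-true h)) (degB-complete λ u →
    trans (degB-sound {A = adj M} (proj₂ (∧-true {isSimpleGraph (adj M)} h)) u) (flat u))
  where
  flat : ∀ u → s u ≡ d
  flat = ∑-≤-≡ (λ u → m∸n≡0⇒m≤n (∑≡0 (λ u → s u ∸ d) excess (∈-allFin u)))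
               (trans total (sym (∑-allFin-const n d)))
#real-regular {n} d (suc E) s total excess
  with allB [ n ] (λ u → s u ≤ᵇ d) in hi | allB [ n ] (λ u → d ≤ᵇ s u) in lo
... | true | _ = ⊥-elim (0≢1+n (trans (sym (trans (∑-cong [ n ] λ u → m≤n⇒m∸n≡0 (≤ᵇ-true {s u} (allFin-true hi u))) (∑-zero [ n ]))) excess))
... | false | true with allB-false [ n ] hi
...   | i , _ , si = ⊥-elim (<⇒≢ (≤ᵇ-false {s i} si)
          (∑-≤-≡ (λ u → ≤ᵇ-true {d} (allFin-true lo u)) (trans (∑-allFin-const n d) (sym total)) i))
#real-regular {n} d (suc E) s total excess | false | false
  with allB-false [ n ] hi | allB-false [ n ] lo
... | i , _ , hi′ | j , _ , lo′ =
  ≤-trans (Balance.#real-balance s s′ i j gap move) (#real-regular d E s′ total′ excess′)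
  where
  si : d < s i
  si = ≤ᵇ-false hi′
  sj : s j < d
  sj = ≤ᵇ-false lo′
  gap : s j + 2 ≤ s i
  gap = ≤-trans (≤-reflexive (+-comm (s j) 2)) (≤-trans (s≤s sj) si)
  i≢j : i ≢ j
  i≢j refl = <-asym si sj
  s′ : Fin n → ℕ
  s′ u = s u + ind (eqFin u j) ∸ ind (eqFin u i)
  pos : ∀ u → ind (eqFin u i) ≤ s u
  pos u with eqFin u i in e
  ... | false = z≤n
  ... | true rewrite eqFin-true {u = u} e = ≤-trans (s≤s z≤n) si
  move : ∀ u → s′ u + ind (eqFin u i) ≡ s u + ind (eqFin u j)
  move u = m∸n+n≡m (≤-trans (pos u) (m≤m+n _ _))
  total′ : ∑ [ n ] s′ ≡ n * d
  total′ = +-cancelʳ-≡ 1 _ _ (begin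
    ∑ [ n ] s′ + 1 ≡⟨ cong (∑ [ n ] s′ +_) (∑-δ₁ i) ⟨
    ∑ [ n ] s′ + ∑ [ n ] (λ u → ind (eqFin u i)) ≡⟨ ∑-+ [ n ] s′ _ ⟨
    ∑ [ n ] (λ u → s′ u + ind (eqFin u i)) ≡⟨ ∑-cong [ n ] move ⟩
    ∑ [ n ] (λ u → s u + ind (eqFin u j)) ≡⟨ ∑-+ [ n ] s _ ⟩
    ∑ [ n ] s + ∑ [ n ] (λ u → ind (eqFin u j)) ≡⟨ cong₂ _+_ total (∑-δ₁ j) ⟩
    n * d + 1 ∎)
    where open ≡-Reasoning
  drop : ∀ u → (s′ u ∸ d) + ind (eqFin u i) ≡ s u ∸ d
  drop u with eqFin u i in e
  ... | true rewrite eqFin-true {u = u} e | eqFin-false i≢j | +-identityʳ (s i) = begin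
    s i ∸ 1 ∸ d + 1 ≡⟨ cong (_+ 1) (∸-+-assoc (s i) 1 d) ⟩
    s i ∸ suc d + 1 ≡⟨ +-comm _ 1 ⟩
    1 + (s i ∸ suc d) ≡⟨ +-∸-assoc 1 si ⟨
    s i ∸ d ∎
    where open ≡-Reasoning
  ... | false with eqFin u j in e′
  ...   | true rewrite eqFin-true {u = u} e′ | +-comm (s j) 1 =
          trans (+-identityʳ _) (trans (m≤n⇒m∸n≡0 sj) (sym (m≤n⇒m∸n≡0 (<⇒≤ sj))))
  ...   | false = trans (+-identityʳ _) (cong (_∸ d) (+-identityʳ (s u)))
  excess′ : ∑ [ n ] (λ u → s′ u ∸ d) ≡ E
  excess′ = +-cancelʳ-≡ 1 _ _ (begin
    ∑ [ n ] (λ u → s′ u ∸ d) + 1 ≡⟨ cong (∑ [ n ] (λ u → s′ u ∸ d) +_) (∑-δ₁ i) ⟨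
    ∑ [ n ] (λ u → s′ u ∸ d) + ∑ [ n ] (λ u → ind (eqFin u i)) ≡⟨ ∑-+ [ n ] _ _ ⟨
    ∑ [ n ] (λ u → s′ u ∸ d + ind (eqFin u i)) ≡⟨ ∑-cong [ n ] drop ⟩
    ∑ [ n ] (λ u → s u ∸ d) ≡⟨ excess ⟩
    suc E ≡⟨ +-comm 1 E ⟩
    E + 1 ∎)
    where open ≡-Reasoning

-- The most likely number of edges

totalCount≡#real : ∀ n d → totalCount n d ≡ #real {n} (λ _ → d)
totalCount≡#real n d = trans (countB≡∑ (allAdj n) _) (∑-allAdj {n} _)

edgesB nonedgesB : Adj n → ℕ
edgesB {n} A = ∑ [ n ] λ x → ∑ [ n ] λ y → ind (not (eqFin y x) ∧ A x y)
nonedgesB {n} A = ∑ [ n ] λ x → ∑ [ n ] λ y → ind (not (eqFin y x) ∧ not (A x y))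

edgesB≡e₂ : {A : Adj n} → Simple A → edgesB A ≡ e₂ A
edgesB≡e₂ {n} {A} s = ∑-cong [ n ] λ x → ∑-cong [ n ] λ y → eq x y
  where
  eq : ∀ x y → ind (not (eqFin y x) ∧ A x y) ≡ ind (A x y)
  eq x y with eqFin y x in e
  ... | false = refl
  ... | true rewrite eqFin-true {u = y} e | irrefl s x = refl

nonedgesB+e₂ : {A : Adj n} → Simple A → nonedgesB A + (e₂ A + n) ≡ n * n
nonedgesB+e₂ {n} {A} s = begin
  nonedgesB A + (e₂ A + n)
    ≡⟨ cong (λ z → nonedgesB A + (e₂ A + z)) (trans (sym (*-identityʳ n)) (sym (∑-allFin-const n 1))) ⟩
  nonedgesB A + (e₂ A + ∑ [ n ] (λ _ → 1))
    ≡⟨ cong (nonedgesB A +_) (∑-+ [ n ] (deg A) _) ⟨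
  nonedgesB A + ∑ [ n ] (λ x → deg A x + 1)
    ≡⟨ ∑-+ [ n ] _ _ ⟨
  ∑ [ n ] (λ x → ∑ [ n ] (λ y → ind (not (eqFin y x) ∧ not (A x y))) + (deg A x + 1))
    ≡⟨ ∑-cong [ n ] row ⟩
  ∑ [ n ] (λ _ → n)
    ≡⟨ ∑-allFin-const n n ⟩
  n * n ∎
  where
  open ≡-Reasoning
  pt : ∀ x y → ind (not (eqFin y x) ∧ not (A x y)) + (ind (A x y) + ind (eqFin y x)) ≡ 1
  pt x y with eqFin y x in e
  ... | true rewrite eqFin-true {u = y} e | irrefl s x = refl
  ... | false with A x y
  ...   | true = refl
  ...   | false = refl
  row : ∀ x → ∑ [ n ] (λ y → ind (not (eqFin y x) ∧ not (A x y))) + (deg A x + 1) ≡ n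
  row x = begin
    _ ≡⟨ cong (λ z → ∑ [ n ] (λ y → ind (not (eqFin y x) ∧ not (A x y))) + (deg A x + z)) (∑-δ₁ x) ⟨
    _ ≡⟨ cong (∑ [ n ] (λ y → ind (not (eqFin y x) ∧ not (A x y))) +_) (∑-+ [ n ] _ _) ⟨
    _ ≡⟨ ∑-+ [ n ] _ _ ⟨
    _ ≡⟨ ∑-cong [ n ] (pt x) ⟩
    _ ≡⟨ trans (∑-allFin-const n 1) (*-identityʳ n) ⟩
    n ∎

module Levels (n d b : ℕ) (n≡ : n ≡ suc (d + b)) (d>0 : 0 < d) (b>0 : 0 < b)
              (H : ℕ) (2H≡ : 2 * H ≡ n * d) where
  open Weighted n d b

  level : ℕ → Mat n → ℕ
  level h M = ind (e₂ (adj M) ≡ᵇ 2 * h)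

  W : ℕ → ℕ
  W h = S (level h)

  flow : ∀ h x y →
    ∑ (mats n) (λ M → w M * level h M * ind (not (eqFin y x) ∧ not (adj M x y)) * d) ≡
    ∑ (mats n) (λ M → w M * level (suc h) M * ind (not (eqFin y x) ∧ adj M x y) * b)
  flow h x y with eqFin y x in e
  ... | true = ∑-cong (mats n) λ M →
    trans (cong (_* d) (*-zeroʳ (w M * level h M))) (sym (cong (_* b) (*-zeroʳ (w M * level (suc h) M))))
  ... | false = sym (trans (sym (∑-flipE x y _)) (∑-cong (mats n) eq))
    where
    x≢y : x ≢ y
    x≢y p = eqFin-≢ e (sym p)
    shuffle : ∀ w i f c → w * i * f * c ≡ w * f * c * i
    shuffle = solve-∀
    eq : ∀ M → w (flipE x y M) * level (suc h) (flipE x y M) * ind (adj (flipE x y M) x y) * b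
             ≡ w M * level h M * ind (not (adj M x y)) * d
    eq M = begin
      w M′ * level (suc h) M′ * ind (adj M′ x y) * b
        ≡⟨ shuffle (w M′) (level (suc h) M′) _ b ⟩
      w M′ * ind (adj M′ x y) * b * level (suc h) M′
        ≡⟨ cong (_* level (suc h) M′) (w-flip x≢y M) ⟩
      w M * ind (not (adj M x y)) * d * level (suc h) M′
        ≡⟨ same ⟩
      w M * ind (not (adj M x y)) * d * level h M
        ≡⟨ shuffle (w M) (level h M) _ d ⟨
      w M * level h M * ind (not (adj M x y)) * d ∎
      where
      open ≡-Reasoning
      M′ = flipE x y M
      same : w M * ind (not (adj M x y)) * d * level (suc h) M′ ≡ w M * ind (not (adj M x y)) * d * level h M
      same with isSimpleGraph (adj M) in s | adj M x y in Axy
      ... | false | _ = refl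
      ... | true | true rewrite *-zeroʳ (wt n d b (e₂ (adj M)) + 0) = refl
      ... | true | false = cong (λ β → (wt n d b (e₂ (adj M)) + 0) * 1 * d * ind β) lev
        where
        step : e₂ (adj M′) ≡ e₂ (adj M) + 2
        step = e₂-Flip x≢y (adj-flipE x≢y M) (simple-sound s) Axy
        dbl : ∀ h → 2 * suc h ≡ 2 * h + 2
        dbl = solve-∀
        lev : (e₂ (adj M′) ≡ᵇ 2 * suc h) ≡ (e₂ (adj M) ≡ᵇ 2 * h)
        lev rewrite step = bool-ext
          (λ q → ≡ᵇ-intro {e₂ (adj M)} (+-cancelʳ-≡ 2 _ _ (trans (≡ᵇ-true {e₂ (adj M) + 2} q) (dbl h))))
          (λ q → ≡ᵇ-intro {e₂ (adj M) + 2} (trans (cong (_+ 2) (≡ᵇ-true {e₂ (adj M)} q)) (sym (dbl h))))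

  collect : ∀ (g : Mat n → ℕ) (B : Mat n → Fin n → Fin n → Bool) c →
    ∑ [ n ] (λ x → ∑ [ n ] λ y → ∑ (mats n) (λ M → g M * ind (B M x y) * c)) ≡
    ∑ (mats n) (λ M → g M * (∑ [ n ] λ x → ∑ [ n ] λ y → ind (B M x y))) * c
  collect g B c = begin
    _ ≡⟨ ∑-cong [ n ] (λ x → ∑-swap [ n ] (mats n) _) ⟩
    _ ≡⟨ ∑-swap [ n ] (mats n) _ ⟩
    _ ≡⟨ ∑-cong (mats n) (λ M → ∑-cong [ n ] λ x →
           trans (∑-*ʳ [ n ] c (λ y → g M * ind (B M x y))) (cong (_* c) (∑-*ˡ [ n ] (g M) _))) ⟩
    _ ≡⟨ ∑-cong (mats n) (λ M → trans (∑-*ʳ [ n ] c _) (cong (_* c) (∑-*ˡ [ n ] (g M) _))) ⟩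
    _ ≡⟨ ∑-*ʳ (mats n) c _ ⟩
    _ ∎
    where open ≡-Reasoning

  -- Adding an edge matches pairs (graph with h edges, ordered non-edge) with pairs (graph with h +
  -- 1 edges, ordered edge). This is the ratio of consecutive binomial weights, found without
  -- counting the graphs of a level.
  ratio : ∀ h → W h * (n * n ∸ (2 * h + n)) * d ≡ W (suc h) * (2 * suc h) * b
  ratio h = begin
    W h * (n * n ∸ (2 * h + n)) * d
      ≡⟨ cong (_* d) (trans (sym (∑-*ʳ (mats n) _ _)) (∑-cong (mats n) left)) ⟩
    ∑ (mats n) (λ M → w M * level h M * nonedgesB (adj M)) * d
      ≡⟨ collect (λ M → w M * level h M) _ d ⟨
    ∑ [ n ] (λ x → ∑ [ n ] λ y → ∑ (mats n) (λ M → w M * level h M * ind (not (eqFin y x) ∧ not (adj M x y)) * d))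
      ≡⟨ ∑-cong [ n ] (λ x → ∑-cong [ n ] λ y → flow h x y) ⟩
    ∑ [ n ] (λ x → ∑ [ n ] λ y → ∑ (mats n) (λ M → w M * level (suc h) M * ind (not (eqFin y x) ∧ adj M x y) * b))
      ≡⟨ collect (λ M → w M * level (suc h) M) _ b ⟩
    ∑ (mats n) (λ M → w M * level (suc h) M * edgesB (adj M)) * b
      ≡⟨ cong (_* b) (trans (∑-cong (mats n) right) (∑-*ʳ (mats n) _ _)) ⟩
    W (suc h) * (2 * suc h) * b ∎
    where
    open ≡-Reasoning
    left : ∀ M → w M * level h M * (n * n ∸ (2 * h + n)) ≡ w M * level h M * nonedgesB (adj M)
    left M with isSimpleGraph (adj M) in s | e₂ (adj M) ≡ᵇ 2 * h in e
    ... | false | _ = refl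
    ... | true | false rewrite *-zeroʳ (wt n d b (e₂ (adj M)) + 0) = refl
    ... | true | true = cong ((wt n d b (e₂ (adj M)) + 0) * 1 *_)
      (trans (cong (_∸ (2 * h + n)) (trans (sym (nonedgesB+e₂ (simple-sound {A = adj M} s)))
                (cong (λ z → nonedgesB (adj M) + (z + n)) (≡ᵇ-true {e₂ (adj M)} e))))
             (m+n∸n≡m _ (2 * h + n)))
    right : ∀ M → w M * level (suc h) M * edgesB (adj M) ≡ w M * level (suc h) M * (2 * suc h)
    right M with isSimpleGraph (adj M) in s | e₂ (adj M) ≡ᵇ 2 * suc h in e
    ... | false | _ = refl
    ... | true | false rewrite *-zeroʳ (wt n d b (e₂ (adj M)) + 0) = refl
    ... | true | true = cong ((wt n d b (e₂ (adj M)) + 0) * 1 *_)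
      (trans (edgesB≡e₂ (simple-sound {A = adj M} s)) (≡ᵇ-true {e₂ (adj M)} e))

  private
    n²≡ : n * n ≡ n * b + (n * d + n)
    n²≡ = trans (cong (n *_) n≡) (expand n d b)
      where
      expand : ∀ n d b → n * (1 + (d + b)) ≡ n * b + (n * d + n)
      expand = solve-∀

  -- The odds d : b are chosen so that the ratio crosses one at H: with nd ordered edges there are
  -- nb ordered non-edges, and (nd) b = (nb) d.
  W-up : ∀ h → suc h ≤ H → W h ≤ W (suc h)
  W-up h h<H = *-cancelʳ-≤ _ _ (2 * suc h * b) {{m*n≢0 (2 * suc h) b {{_}} {{>-nonZero b>0}}}} (begin
    W h * (2 * suc h * b) ≤⟨ *-monoʳ-≤ (W h) le ⟩
    W h * ((n * n ∸ (2 * h + n)) * d) ≡⟨ *-assoc (W h) _ d ⟨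
    W h * (n * n ∸ (2 * h + n)) * d ≡⟨ ratio h ⟩
    W (suc h) * (2 * suc h) * b ≡⟨ *-assoc (W (suc h)) _ b ⟩
    W (suc h) * (2 * suc h * b) ∎)
    where
    open ≤-Reasoning
    comm₃ : ∀ n d b → n * d * b ≡ n * b * d
    comm₃ = solve-∀
    le : 2 * suc h * b ≤ (n * n ∸ (2 * h + n)) * d
    le = begin
      2 * suc h * b ≤⟨ *-monoˡ-≤ b (≤-trans (*-monoʳ-≤ 2 h<H) (≤-reflexive 2H≡)) ⟩
      n * d * b ≡⟨ comm₃ n d b ⟩
      n * b * d ≡⟨ cong (_* d) (m+n∸n≡m (n * b) (n * d + n)) ⟨
      (n * b + (n * d + n) ∸ (n * d + n)) * d ≡⟨ cong (λ z → (z ∸ (n * d + n)) * d) n²≡ ⟨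
      (n * n ∸ (n * d + n)) * d
        ≤⟨ *-monoˡ-≤ d (∸-monoʳ-≤ (n * n) (+-monoˡ-≤ n (≤-trans (*-monoʳ-≤ 2 (<⇒≤ h<H)) (≤-reflexive 2H≡)))) ⟩
      (n * n ∸ (2 * h + n)) * d ∎

  W-down : ∀ h → H ≤ h → W (suc h) ≤ W h
  W-down h H≤h = *-cancelʳ-≤ _ _ (2 * suc h * b) {{m*n≢0 (2 * suc h) b {{_}} {{>-nonZero b>0}}}} (begin
    W (suc h) * (2 * suc h * b) ≡⟨ *-assoc (W (suc h)) _ b ⟨
    W (suc h) * (2 * suc h) * b ≡⟨ ratio h ⟨
    W h * (n * n ∸ (2 * h + n)) * d ≡⟨ *-assoc (W h) _ d ⟩
    W h * ((n * n ∸ (2 * h + n)) * d) ≤⟨ *-monoʳ-≤ (W h) le ⟩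
    W h * (2 * suc h * b) ∎)
    where
    open ≤-Reasoning
    comm₃ : ∀ n d b → n * b * d ≡ n * d * b
    comm₃ = solve-∀
    nd≤ : n * d ≤ 2 * h
    nd≤ = ≤-trans (≤-reflexive (sym 2H≡)) (*-monoʳ-≤ 2 H≤h)
    le : (n * n ∸ (2 * h + n)) * d ≤ 2 * suc h * b
    le = begin
      (n * n ∸ (2 * h + n)) * d ≤⟨ *-monoˡ-≤ d (∸-monoʳ-≤ (n * n) (+-monoˡ-≤ n nd≤)) ⟩
      (n * n ∸ (n * d + n)) * d ≡⟨ cong (λ z → (z ∸ (n * d + n)) * d) n²≡ ⟩
      (n * b + (n * d + n) ∸ (n * d + n)) * d ≡⟨ cong (_* d) (m+n∸n≡m (n * b) (n * d + n)) ⟩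
      n * b * d ≡⟨ comm₃ n d b ⟩
      n * d * b ≤⟨ *-monoˡ-≤ b (≤-trans nd≤ (*-monoʳ-≤ 2 (n≤1+n h))) ⟩
      2 * suc h * b ∎

  W-mode : ∀ h → W h ≤ W H
  W-mode h with ≤-total h H
  ... | inj₁ le = up (H ∸ h) h (m∸n+n≡m le)
    where
    up : ∀ i h → i + h ≡ H → W h ≤ W H
    up zero h refl = ≤-refl
    up (suc i) h refl = ≤-trans (W-up h (s≤s (m≤n+m h i))) (up i (suc h) (+-suc i h))
  ... | inj₂ ge = ≤-trans (≤-reflexive (cong W (sym (m∸n+n≡m ge)))) (down (h ∸ H))
    where
    down : ∀ i → W (i + H) ≤ W H
    down zero = ≤-refl
    down (suc i) = ≤-trans (W-down (i + H) (m≤n+m H i)) (down i)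

  -- By the handshake lemma every simple graph lies on some level, and level H is the heaviest.
  S₁≤ : S (λ _ → 1) ≤ suc (n * n) * W H
  S₁≤ = begin
    S (λ _ → 1) ≤⟨ ∑-mono (mats n) pt ⟩
    S (λ M → ∑ (allFin (suc (n * n))) (λ h → level (toℕ h) M))
      ≡⟨ S-∑ (allFin (suc (n * n))) (λ h → level (toℕ h)) ⟩
    ∑ (allFin (suc (n * n))) (λ h → W (toℕ h))
      ≤⟨ ∑-mono (allFin (suc (n * n))) (λ h → W-mode (toℕ h)) ⟩
    ∑ (allFin (suc (n * n))) (λ _ → W H)
      ≡⟨ ∑-allFin-const (suc (n * n)) (W H) ⟩
    suc (n * n) * W H ∎
    where
    open ≤-Reasoning
    pt : ∀ M → w M * 1 ≤ w M * ∑ (allFin (suc (n * n))) (λ h → level (toℕ h) M)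
    pt M with isSimpleGraph (adj M) in s
    ... | false = z≤n
    ... | true with e₂-even (simple-sound {A = adj M} s)
    ...   | h , e = *-monoʳ-≤ (wt n d b (e₂ (adj M)) + 0) (begin
      1 ≡⟨ cong ind (≡ᵇ-intro {e₂ (adj M)} (trans e (cong (2 *_) (sym (Fin.toℕ-fromℕ< h<))))) ⟨
      level (toℕ (fromℕ< h<)) M
        ≤⟨ ∑-∈ (λ h → level (toℕ h) M) (∈-allFin (fromℕ< h<)) ⟩
      ∑ (allFin (suc (n * n))) (λ h → level (toℕ h) M) ∎)
      where
      h< : h < suc (n * n)
      h< = s≤s (≤-trans (m≤m+n h (h + 0)) (≤-trans (≤-reflexive (sym e)) (e₂≤n² (adj M))))

  -- On level H all graphs have the same weight. Sorted by degree sequence they fall into at most (n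
  -- + 1)^n classes, none larger than that of the regular sequence.
  W-H : W H ≤ wt n d b (n * d) * (suc n ^ n * totalCount n d)
  W-H = begin
    W H ≡⟨ ∑-cong (mats n) pt ⟩
    ∑ (mats n) (λ M → c * ind (isSimpleGraph (adj M) ∧ (e₂ (adj M) ≡ᵇ n * d)))
      ≡⟨ ∑-*ˡ (mats n) c _ ⟩
    c * ∑ (mats n) (λ M → ind (isSimpleGraph (adj M) ∧ (e₂ (adj M) ≡ᵇ n * d)))
      ≤⟨ *-monoʳ-≤ c (∑-mono (mats n) cover) ⟩
    c * ∑ (mats n) (λ M → ∑ seqs (λ v → ind (total v ≡ᵇ n * d) * ind (realB (val v) (adj M))))
      ≡⟨ cong (c *_) (∑-swap (mats n) seqs _) ⟩
    c * ∑ seqs (λ v → ∑ (mats n) (λ M → ind (total v ≡ᵇ n * d) * ind (realB (val v) (adj M))))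
      ≤⟨ *-monoʳ-≤ c (∑-≤const seqs (totalCount n d) each) ⟩
    c * (length seqs * totalCount n d)
      ≡⟨ cong (λ z → c * (z * totalCount n d)) (trans (length-allVec n [ suc n ]) (cong (_^ n) (length-allFin (suc n)))) ⟩
    c * (suc n ^ n * totalCount n d) ∎
    where
    open ≤-Reasoning
    c = wt n d b (n * d)
    seqs : List (Vec (Fin (suc n)) n)
    seqs = allVec n [ suc n ]
    val : Vec (Fin (suc n)) n → Fin n → ℕ
    val v u = toℕ (lookup v u)
    total : Vec (Fin (suc n)) n → ℕ
    total v = ∑ [ n ] (val v)
    pt : ∀ M → w M * level H M ≡ c * ind (isSimpleGraph (adj M) ∧ (e₂ (adj M) ≡ᵇ n * d))
    pt M rewrite 2H≡ with isSimpleGraph (adj M) | e₂ (adj M) ≡ᵇ n * d in e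
    ... | false | _ = sym (*-zeroʳ c)
    ... | true | false = trans (*-zeroʳ (wt n d b (e₂ (adj M)) + 0)) (sym (*-zeroʳ c))
    ... | true | true = cong (_* 1) (trans (+-identityʳ _) (cong (wt n d b) (≡ᵇ-true {e₂ (adj M)} e)))
    cover : ∀ M → ind (isSimpleGraph (adj M) ∧ (e₂ (adj M) ≡ᵇ n * d)) ≤
            ∑ seqs (λ v → ind (total v ≡ᵇ n * d) * ind (realB (val v) (adj M)))
    cover M with isSimpleGraph (adj M) in s | e₂ (adj M) ≡ᵇ n * d in e
    ... | false | _ = z≤n
    ... | true | false = z≤n
    ... | true | true = begin
      1 ≡⟨ cong₂ (λ β γ → ind β * ind γ)
             (≡ᵇ-intro {total v} (trans (∑-cong [ n ] val-v) (≡ᵇ-true {e₂ (adj M)} e)))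
             (degB-complete {s = val v} {adj M} (λ u → sym (val-v u))) ⟨
      ind (total v ≡ᵇ n * d) * ind (degB (val v) (adj M))
        ≤⟨ ∑-∈ (λ v → ind (total v ≡ᵇ n * d) * ind (degB (val v) (adj M))) (∈-allVec v (λ i → ∈-allFin (lookup v i))) ⟩
      _ ∎
      where
      v : Vec (Fin (suc n)) n
      v = Vec.tabulate (λ u → fromℕ< (s≤s (deg≤n (adj M) u)))
      val-v : ∀ u → val v u ≡ deg (adj M) u
      val-v u = trans (cong toℕ (Vec.lookup∘tabulate _ u)) (Fin.toℕ-fromℕ< _)
    each : ∀ v → ∑ (mats n) (λ M → ind (total v ≡ᵇ n * d) * ind (realB (val v) (adj M))) ≤ totalCount n d
    each v with total v ≡ᵇ n * d in e
    ... | false = ≤-trans (≤-reflexive (∑-zero (mats n))) z≤n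
    ... | true = ≤-trans (≤-reflexive (∑-cong (mats n) λ M → +-identityʳ _))
      (≤-trans (#real-regular d _ (val v) (≡ᵇ-true {total v} e) refl)
               (≤-reflexive (sym (totalCount≡#real n d))))

  S₁≤total : S (λ _ → 1) ≤ suc (n * n) * (suc n ^ n) * totalCount n d * wt n d b (n * d)
  S₁≤total = begin
    S (λ _ → 1) ≤⟨ S₁≤ ⟩
    suc (n * n) * W H ≤⟨ *-monoʳ-≤ (suc (n * n)) W-H ⟩
    suc (n * n) * (c * (suc n ^ n * totalCount n d)) ≡⟨ shuffle (suc (n * n)) c (suc n ^ n) (totalCount n d) ⟩
    suc (n * n) * (suc n ^ n) * totalCount n d * c ∎
    where
    open ≤-Reasoning
    c = wt n d b (n * d)
    shuffle : ∀ x c y z → x * (c * (y * z)) ≡ x * y * z * c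
    shuffle = solve-∀

-- Codegrees of random regular graphs

diff : Fin n → Fin n → Adj n → ℕ
diff {n} u v A = ∑ [ n ] (λ y → ind (A u y ∧ not (A v y)))

inter : Fin n → Fin n → Adj n → ℕ
inter {n} u v A = ∑ [ n ] (λ y → ind (A u y ∧ A v y))

inter+diff : (u v : Fin n) (A : Adj n) → inter u v A + diff u v A ≡ deg A u
inter+diff {n} u v A = trans (sym (∑-+ [ n ] _ _)) (∑-cong [ n ] λ y → ind-split (A u y) (A v y))

inter-sym : (u v : Fin n) (A : Adj n) → inter u v A ≡ inter v u A
inter-sym {n} u v A = ∑-cong [ n ] λ y → cong ind (∧-comm (A u y) (A v y))

diff-sym : (u v : Fin n) (A : Adj n) → deg A u ≡ deg A v → diff u v A ≡ diff v u A
diff-sym u v A e = +-cancelˡ-≡ (inter u v A) _ _ (trans (inter+diff u v A) (trans e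
  (trans (sym (inter+diff v u A)) (cong (_+ diff v u A) (inter-sym v u A)))))

reg₁ : ℕ → Mat n → ℕ
reg₁ d M = ind (isRegGraph d (adj M))

isRegGraph-simple : ∀ {d} {A : Adj n} → isRegGraph d A ≡ true → Simple A
isRegGraph-simple h = simple-sound (proj₁ (∧-true h))

isRegGraph-deg : ∀ {d} {A : Adj n} → isRegGraph d A ≡ true → ∀ u → deg A u ≡ d
isRegGraph-deg {A = A} h = degB-sound {A = A} (proj₂ (∧-true {isSimpleGraph A} h))

-- v gives a neighbour y to z and receives x from z, where y lies in N(u) and x does
-- not; this raises |N(u) ∖ N(v)| by one and preserves |N(v) ∖ N(z)|.
module Codegree {n} (d m₀ : ℕ) {u v z : Fin n} (u≢v : u ≢ v) (u≢z : u ≢ z) (v≢z : v ≢ z) where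

  class : ℕ → Mat n → ℕ
  class j M = reg₁ d M * ind (diff u v (adj M) ≡ᵇ j) * ind (m₀ ≤ᵇ diff v z (adj M))

  class-cases : ∀ j M → class j M ≡ 0 ⊎
    (isRegGraph d (adj M) ≡ true × diff u v (adj M) ≡ j × m₀ ≤ diff v z (adj M) × class j M ≡ 1)
  class-cases j M with isRegGraph d (adj M) | diff u v (adj M) ≡ᵇ j in e | m₀ ≤ᵇ diff v z (adj M) in f
  ... | false | _ | _ = inj₁ refl
  ... | true | false | _ = inj₁ refl
  ... | true | true | false = inj₁ refl
  ... | true | true | true = inj₂ (refl , ≡ᵇ-true e , ≤ᵇ-true {m₀} f , refl)

  class-intro : ∀ {j} M → isRegGraph d (adj M) ≡ true → diff u v (adj M) ≡ j →
                m₀ ≤ diff v z (adj M) → class j M ≡ 1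
  class-intro M reg e f rewrite reg | ≡ᵇ-intro e | ≤ᵇ-intro f = refl

  -- The exclusions y = z and x = v prevent loops, and x = u is excluded so that the row of u stays
  -- fixed. The primed tests describe y and x after the switching and bound the number of ways to
  -- undo it.
  lossB gainB loss′B gain′B : Adj n → Fin n → Bool
  lossB A y = (A u y ∧ A v y) ∧ not (A z y ∨ eqFin y z)
  gainB A y = (A z y ∧ not (A u y)) ∧ not (A v y ∨ (eqFin y v ∨ eqFin y u))
  loss′B A y = A u y ∧ not (A v y)
  gain′B A y = A v y ∧ not (A u y)

  shift : ∀ j y x →
    ∑ (mats n) (λ M → class j M * (ind (lossB (adj M) y) * ind (gainB (adj M) x))) ≤
    ∑ (mats n) (λ M → class (suc j) M * (ind (loss′B (adj M) y) * ind (gain′B (adj M) x)))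
  -- The switching is a composite of two swaps, each a permutation of the matrices; the second
  -- inequality is a mere change of variables.
  shift j y x = ≤-trans (∑-shift v z y pointwise) (∑-shift z v x λ M → ≤-refl)
    where
    pointwise : ∀ M → class j M * (ind (lossB (adj M) y) * ind (gainB (adj M) x)) ≤
      class (suc j) (swap z v x (swap v z y M)) *
        (ind (loss′B (adj (swap z v x (swap v z y M))) y) * ind (gain′B (adj (swap z v x (swap v z y M))) x))
    pointwise M with class-cases j M
    ... | inj₁ e rewrite e = z≤n
    ... | inj₂ (reg , dj , m₀≤ , e) rewrite e
      with lossB (adj M) y in loss | gainB (adj M) x in gain
    ...   | false | _ = z≤n
    ...   | true | false = z≤n
    ...   | true | true = ≤-reflexive (sym (cong₂ _*_
              (class-intro M₂ reg₂ diff-uv (≤-trans m₀≤ (≤-reflexive (sym diff-vz))))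
              (cong₂ _*_ (cong ind loss₂) (cong ind gain₂))))
      where
      open ≡-Reasoning
      M₁ = swap v z y M
      M₂ = swap z v x M₁
      A = adj M
      A₁ = adj M₁
      A₂ = adj M₂
      sA : Simple A
      sA = isRegGraph-simple reg
      Auy : A u y ≡ true
      Auy = proj₁ (∧-true (proj₁ (∧-true loss)))
      Avy : A v y ≡ true
      Avy = proj₂ (∧-true {A u y} (proj₁ (∧-true loss)))
      not-z : (A z y ∨ eqFin y z) ≡ false
      not-z = not-true (proj₂ (∧-true {A u y ∧ A v y} loss))
      Azy : A z y ≡ false
      Azy = ∨-falseˡ not-z
      y≢z : y ≢ z
      y≢z = eqFin-≢ (∨-falseʳ {A z y} not-z)
      y≢v : y ≢ v
      y≢v refl = true≢false (trans (sym Avy) (irrefl sA v))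
      y≢u : y ≢ u
      y≢u refl = true≢false (trans (sym Auy) (irrefl sA u))
      Azx : A z x ≡ true
      Azx = proj₁ (∧-true (proj₁ (∧-true gain)))
      Aux : A u x ≡ false
      Aux = not-true (proj₂ (∧-true {A z x} (proj₁ (∧-true gain))))
      not-vu : (A v x ∨ (eqFin x v ∨ eqFin x u)) ≡ false
      not-vu = not-true (proj₂ (∧-true {A z x ∧ not (A u x)} gain))
      Avx : A v x ≡ false
      Avx = ∨-falseˡ not-vu
      x≢v : x ≢ v
      x≢v = eqFin-≢ (∨-falseˡ (∨-falseʳ {A v x} not-vu))
      x≢u : x ≢ u
      x≢u = eqFin-≢ (∨-falseʳ {eqFin x v} (∨-falseʳ {A v x} not-vu))
      x≢z : x ≢ z
      x≢z refl = true≢false (trans (sym Azx) (irrefl sA z))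
      x≢y : x ≢ y
      x≢y refl = true≢false (trans (sym Auy) Aux)
      z≢v : z ≢ v
      z≢v = v≢z ∘ sym
      module S₁ = Swap v≢z y≢v y≢z M
      module S₂ = Swap z≢v x≢z x≢v M₁
      A₁zx : A₁ z x ≡ true
      A₁zx rewrite S₁.swap-to x | eqFin-false x≢y = Azx
      A₁vx : A₁ v x ≡ false
      A₁vx rewrite S₁.swap-from x | eqFin-false x≢y = Avx
      simp₁ : isSimpleGraph A₁ ≡ true
      simp₁ = trans S₁.swap-simple (proj₁ (∧-true reg))
      reg₂ : isRegGraph d A₂ ≡ true
      reg₂ = ∧-intro (trans S₂.swap-simple simp₁) (degB-complete {A = A₂} λ t →
        +-cancelʳ-≡ (ind (eqFin t z)) _ _ (begin
          deg A₂ t + ind (eqFin t z) ≡⟨ S₂.swap-deg (simple-sound simp₁) A₁zx A₁vx t ⟩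
          deg A₁ t + ind (eqFin t v) ≡⟨ S₁.swap-deg sA Avy Azy t ⟩
          deg A t + ind (eqFin t z) ≡⟨ cong (_+ ind (eqFin t z)) (isRegGraph-deg {A = A} reg t) ⟩
          d + ind (eqFin t z) ∎))
      row-u : ∀ t → A₂ u t ≡ A u t
      row-u t = trans (S₂.swap-other u≢z u≢v (x≢u ∘ sym) t) (S₁.swap-other u≢v u≢z (y≢u ∘ sym) t)
      row-v : ∀ t → A₂ v t ≡ eqFin t x xor (eqFin t y xor A v t)
      row-v t = trans (S₂.swap-to t) (cong (eqFin t x xor_) (S₁.swap-from t))
      row-z : ∀ t → A₂ z t ≡ eqFin t x xor (eqFin t y xor A z t)
      row-z t = trans (S₂.swap-from t) (cong (eqFin t x xor_) (S₁.swap-to t))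
      loss₂ : loss′B A₂ y ≡ true
      loss₂ rewrite row-u y | row-v y | Auy | Avy | eqFin-refl y | eqFin-false (x≢y ∘ sym) = refl
      gain₂ : gain′B A₂ x ≡ true
      gain₂ rewrite row-u x | row-v x | Aux | Avx | eqFin-refl x | eqFin-false x≢y = refl
      diff-uv : diff u v A₂ ≡ suc j
      diff-uv = begin
        diff u v A₂ ≡⟨ ∑-cong [ n ] pt ⟩
        ∑ [ n ] (λ t → ind (A u t ∧ not (A v t)) + ind (eqFin t y)) ≡⟨ ∑-+ [ n ] _ _ ⟩
        diff u v A + ∑ [ n ] (λ t → ind (eqFin t y)) ≡⟨ cong₂ _+_ dj (∑-δ₁ y) ⟩
        j + 1 ≡⟨ +-comm j 1 ⟩
        suc j ∎
        where
        pt : ∀ t → ind (A₂ u t ∧ not (A₂ v t)) ≡ ind (A u t ∧ not (A v t)) + ind (eqFin t y)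
        pt t rewrite row-u t | row-v t with eqFin t x in ex | eqFin t y in ey
        ... | true | true = ⊥-elim (x≢y (trans (sym (eqFin-true {u = t} ex)) (eqFin-true ey)))
        ... | true | false rewrite eqFin-true {u = t} ex | Aux = refl
        ... | false | true rewrite eqFin-true {u = t} ey | Auy | Avy = refl
        ... | false | false = sym (+-identityʳ _)
      diff-vz : diff v z A₂ ≡ diff v z A
      diff-vz = +-cancelʳ-≡ 1 _ _ (begin
        diff v z A₂ + 1 ≡⟨ cong (diff v z A₂ +_) (∑-δ₁ y) ⟨
        diff v z A₂ + ∑ [ n ] (λ t → ind (eqFin t y)) ≡⟨ ∑-+ [ n ] _ _ ⟨
        ∑ [ n ] (λ t → ind (A₂ v t ∧ not (A₂ z t)) + ind (eqFin t y)) ≡⟨ ∑-cong [ n ] pt ⟩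
        ∑ [ n ] (λ t → ind (A v t ∧ not (A z t)) + ind (eqFin t x)) ≡⟨ ∑-+ [ n ] _ _ ⟩
        diff v z A + ∑ [ n ] (λ t → ind (eqFin t x)) ≡⟨ cong (diff v z A +_) (∑-δ₁ x) ⟩
        diff v z A + 1 ∎)
        where
        pt : ∀ t → ind (A₂ v t ∧ not (A₂ z t)) + ind (eqFin t y) ≡ ind (A v t ∧ not (A z t)) + ind (eqFin t x)
        pt t rewrite row-v t | row-z t with eqFin t x in ex | eqFin t y in ey
        ... | true | true = ⊥-elim (x≢y (trans (sym (eqFin-true {u = t} ex)) (eqFin-true ey)))
        ... | true | false rewrite eqFin-true {u = t} ex | Avx | Azx = refl
        ... | false | true rewrite eqFin-true {u = t} ey | Avy | Azy = refl
        ... | false | false = refl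

  #class : ℕ → ℕ
  #class j = ∑ (mats n) (class j)

  collect : (g : Mat n → ℕ) (B C : Mat n → Fin n → Bool) →
    ∑ [ n ] (λ y → ∑ [ n ] λ x → ∑ (mats n) (λ M → g M * (ind (B M y) * ind (C M x)))) ≡
    ∑ (mats n) (λ M → g M * (∑ [ n ] (λ y → ind (B M y)) * ∑ [ n ] (λ x → ind (C M x))))
  collect g B C = begin
    _ ≡⟨ ∑-cong [ n ] (λ y → ∑-swap [ n ] (mats n) _) ⟩
    _ ≡⟨ ∑-swap [ n ] (mats n) _ ⟩
    _ ≡⟨ ∑-cong (mats n) (λ M → ∑-cong [ n ] λ y →
           trans (∑-*ˡ [ n ] (g M) _) (cong (g M *_) (∑-*ˡ [ n ] (ind (B M y)) _))) ⟩
    _ ≡⟨ ∑-cong (mats n) (λ M → trans (∑-*ˡ [ n ] (g M) _) (cong (g M *_) (∑-*ʳ [ n ] _ _))) ⟩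
    _ ∎
    where open ≡-Reasoning

  -- Among the vertices of N(v) outside N(z), only those outside N(u), j in number by regularity,
  -- and possibly z itself are unusable. The count j + 1 is weakened to j + 2 to match the gains.
  many-losses : ∀ {j} M → isRegGraph d (adj M) ≡ true → diff u v (adj M) ≡ j → m₀ ≤ diff v z (adj M) →
                m₀ ∸ (j + 2) ≤ ∑ [ n ] (λ y → ind (lossB (adj M) y))
  many-losses {j} M reg dj m₀≤ = ≤-trans (∸-monoˡ-≤ (j + 2) (≤-trans m₀≤ le)) (≤-trans (∸-monoʳ-≤ _ (+-monoʳ-≤ j (s≤s z≤n))) (≤-reflexive (m+n∸n≡m _ (j + 1))))
    where
    open ≤-Reasoning
    A = adj M
    pt : ∀ y → ind (A v y ∧ not (A z y)) ≤ ind (lossB A y) + (ind (A v y ∧ not (A u y)) + ind (eqFin y z))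
    pt y with A u y | A v y | A z y | eqFin y z
    ... | _ | false | _ | _ = z≤n
    ... | _ | true | true | _ = z≤n
    ... | true | true | false | true = ≤-refl
    ... | true | true | false | false = ≤-refl
    ... | false | true | false | true = s≤s z≤n
    ... | false | true | false | false = ≤-refl
    le : diff v z A ≤ ∑ [ n ] (λ y → ind (lossB A y)) + (j + 1)
    le = begin
      diff v z A ≤⟨ ∑-mono [ n ] pt ⟩
      ∑ [ n ] (λ y → ind (lossB A y) + (ind (A v y ∧ not (A u y)) + ind (eqFin y z)))
        ≡⟨ trans (∑-+ [ n ] _ _) (cong (∑ [ n ] (λ y → ind (lossB A y)) +_) (∑-+ [ n ] _ _)) ⟩
      ∑ [ n ] (λ y → ind (lossB A y)) + (diff v u A + ∑ [ n ] (λ y → ind (eqFin y z)))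
        ≡⟨ cong (∑ [ n ] (λ y → ind (lossB A y)) +_) (cong₂ _+_
             (trans (diff-sym v u A (trans (isRegGraph-deg {A = A} reg v) (sym (isRegGraph-deg {A = A} reg u)))) dj)
             (∑-δ₁ z)) ⟩
      ∑ [ n ] (λ y → ind (lossB A y)) + (j + 1) ∎

  -- By regularity N(z) has as many vertices outside N(v) as N(v) has outside N(z). Unusable are at
  -- most the j vertices of N(u) outside N(v), and u and v themselves.
  many-gains : ∀ {j} M → isRegGraph d (adj M) ≡ true → diff u v (adj M) ≡ j → m₀ ≤ diff v z (adj M) →
               m₀ ∸ (j + 2) ≤ ∑ [ n ] (λ x → ind (gainB (adj M) x))
  many-gains {j} M reg dj m₀≤ = ≤-trans (∸-monoˡ-≤ (j + 2) (≤-trans m₀≤ le)) (≤-reflexive (m+n∸n≡m _ (j + 2)))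
    where
    open ≤-Reasoning
    A = adj M
    pt : ∀ y → ind (A z y ∧ not (A v y)) ≤
         ind (gainB A y) + (ind (A u y ∧ not (A v y)) + (ind (eqFin y v) + ind (eqFin y u)))
    pt y with A u y | A v y | A z y | eqFin y v | eqFin y u
    ... | _ | _ | false | _ | _ = z≤n
    ... | _ | true | true | _ | _ = z≤n
    ... | true | false | true | _ | _ = s≤s z≤n
    ... | false | false | true | true | _ = s≤s z≤n
    ... | false | false | true | false | true = s≤s z≤n
    ... | false | false | true | false | false = ≤-refl
    le : diff v z A ≤ ∑ [ n ] (λ y → ind (gainB A y)) + (j + 2)
    le = begin
      diff v z A ≡⟨ diff-sym v z A (trans (isRegGraph-deg {A = A} reg v) (sym (isRegGraph-deg {A = A} reg z))) ⟩
      diff z v A ≤⟨ ∑-mono [ n ] pt ⟩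
      ∑ [ n ] (λ y → ind (gainB A y) + (ind (A u y ∧ not (A v y)) + (ind (eqFin y v) + ind (eqFin y u))))
        ≡⟨ trans (∑-+ [ n ] _ _) (cong (∑ [ n ] (λ y → ind (gainB A y)) +_)
             (trans (∑-+ [ n ] _ _) (cong (diff u v A +_) (∑-+ [ n ] _ _)))) ⟩
      ∑ [ n ] (λ y → ind (gainB A y)) +
        (diff u v A + (∑ [ n ] (λ y → ind (eqFin y v)) + ∑ [ n ] (λ y → ind (eqFin y u))))
        ≡⟨ cong (∑ [ n ] (λ y → ind (gainB A y)) +_) (cong₂ _+_ dj (cong₂ _+_ (∑-δ₁ v) (∑-δ₁ u))) ⟩
      ∑ [ n ] (λ y → ind (gainB A y)) + (j + 2) ∎

  -- Double counting of switchings. In the resulting graph y lies in N(u) but not N(v), and x in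
  -- N(v) but not N(u); both differences have size j + 1, so each graph is reached at most (j + 1)²
  -- times.
  #class-ratio : ∀ j → #class j * ((m₀ ∸ (j + 2)) * (m₀ ∸ (j + 2))) ≤ #class (suc j) * (suc j * suc j)
  #class-ratio j = begin
    #class j * (c * c) ≡⟨ ∑-*ʳ (mats n) (c * c) (class j) ⟨
    ∑ (mats n) (λ M → class j M * (c * c)) ≤⟨ ∑-mono (mats n) left ⟩
    ∑ (mats n) (λ M → class j M * (∑ [ n ] (λ y → ind (lossB (adj M) y)) * ∑ [ n ] (λ x → ind (gainB (adj M) x))))
      ≡⟨ collect (class j) (lossB ∘ adj) (gainB ∘ adj) ⟨
    _ ≤⟨ ∑-mono [ n ] (λ y → ∑-mono [ n ] λ x → shift j y x) ⟩
    _ ≡⟨ collect (class (suc j)) (loss′B ∘ adj) (gain′B ∘ adj) ⟩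
    ∑ (mats n) (λ M → class (suc j) M * (diff u v (adj M) * diff v u (adj M)))
      ≡⟨ ∑-cong (mats n) right ⟩
    ∑ (mats n) (λ M → class (suc j) M * (suc j * suc j)) ≡⟨ ∑-*ʳ (mats n) _ (class (suc j)) ⟩
    #class (suc j) * (suc j * suc j) ∎
    where
    open ≤-Reasoning
    c = m₀ ∸ (j + 2)
    left : ∀ M → class j M * (c * c) ≤
      class j M * (∑ [ n ] (λ y → ind (lossB (adj M) y)) * ∑ [ n ] (λ x → ind (gainB (adj M) x)))
    left M with class-cases j M
    ... | inj₁ e rewrite e = z≤n
    ... | inj₂ (reg , dj , m₀≤ , e) = *-monoʳ-≤ (class j M) (*-mono-≤ (many-losses M reg dj m₀≤) (many-gains M reg dj m₀≤))
    right : ∀ M → class (suc j) M * (diff u v (adj M) * diff v u (adj M)) ≡ class (suc j) M * (suc j * suc j)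
    right M with class-cases (suc j) M
    ... | inj₁ e rewrite e = refl
    ... | inj₂ (reg , dj , m₀≤ , e) = cong (class (suc j) M *_) (cong₂ _*_ dj
      (trans (diff-sym v u (adj M) (trans (isRegGraph-deg {A = adj M} reg v) (sym (isRegGraph-deg {A = adj M} reg u)))) dj))

  #class-step : ∀ j → 3 * suc j + 2 ≤ m₀ → #class j * 4 ≤ #class (suc j)
  #class-step j h = *-cancelʳ-≤ _ _ (suc j * suc j) (begin
    #class j * 4 * (suc j * suc j) ≡⟨ s₁ (#class j) (suc j) ⟩
    #class j * (2 * suc j * (2 * suc j)) ≤⟨ *-monoʳ-≤ (#class j) (*-mono-≤ le le) ⟩
    #class j * ((m₀ ∸ (j + 2)) * (m₀ ∸ (j + 2))) ≤⟨ #class-ratio j ⟩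
    #class (suc j) * (suc j * suc j) ∎)
    where
    open ≤-Reasoning
    s₁ : ∀ c x → c * 4 * (x * x) ≡ c * (2 * x * (2 * x))
    s₁ = solve-∀
    s₂ : ∀ j → 3 * (1 + j) + 2 ≡ 2 * (1 + j) + (j + 2) + 1
    s₂ = solve-∀
    le : 2 * suc j ≤ m₀ ∸ (j + 2)
    le = ≤-trans (≤-reflexive (sym (m+n∸n≡m (2 * suc j) (j + 2))))
      (∸-monoˡ-≤ (j + 2) (≤-trans (m≤m+n _ 1) (≤-trans (≤-reflexive (sym (s₂ j))) h)))

  #class≤ : ∀ j → #class j ≤ totalCount n d
  #class≤ j = ≤-trans (∑-mono (mats n) pt) (≤-reflexive (sym (totalCount≡#real n d)))
    where
    pt : ∀ M → class j M ≤ reg₁ d M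
    pt M with class-cases j M
    ... | inj₁ e rewrite e = z≤n
    ... | inj₂ (reg , _ , _ , e) rewrite e | reg = ≤-refl

  -- Each of r successive classes is at least four times as large as the one before, and none
  -- exceeds the number of regular graphs.
  #class-small : ∀ r j → 3 * (j + r) + 2 ≤ m₀ → #class j * 4 ^ r ≤ totalCount n d
  #class-small zero j h = ≤-trans (≤-reflexive (*-identityʳ _)) (#class≤ j)
  #class-small (suc r) j h = begin
    #class j * (4 * 4 ^ r) ≡⟨ *-assoc (#class j) 4 _ ⟨
    #class j * 4 * 4 ^ r ≤⟨ *-monoˡ-≤ (4 ^ r) (#class-step j (≤-trans (+-monoˡ-≤ 2 (*-monoʳ-≤ 3 (≤-trans (m≤m+n (suc j) r) (≤-reflexive (sym (+-suc j r)))))) h)) ⟩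
    #class (suc j) * 4 ^ r ≤⟨ #class-small r (suc j) (subst (λ i → 3 * i + 2 ≤ m₀) (+-suc j r) h) ⟩
    totalCount n d ∎
    where open ≤-Reasoning

-- The codegrees of v sum to d², so one of them is at most d / 2.
far-vertex : ∀ {n d} {A : Adj n} → isRegGraph d A ≡ true → 2 * d ≤ n → (v : Fin n) →
             ∃ λ z → d ≤ 2 * diff v z A
far-vertex {n} {d} {A} reg 2d≤n v with allB [ n ] (λ z → 2 * diff v z A <ᵇ d) in e
... | false with allB-false [ n ] e
...   | z , _ , f = z , ≮⇒≥ λ lt → true≢false (trans (sym (Equivalence.to T-≡ (<⇒<ᵇ lt))) f)
far-vertex {n} {d} {A} reg 2d≤n v | true = ⊥-elim (1+n≰n (begin
  suc (n * d) ≤⟨ +-monoˡ-≤ (n * d) (≤-trans (s≤s z≤n) (Fin.toℕ<n v)) ⟩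
  n + n * d ≡⟨ *-suc n d ⟨
  n * suc d ≡⟨ ∑-allFin-const n (suc d) ⟨
  ∑ [ n ] (λ _ → suc d) ≤⟨ ∑-mono [ n ] big ⟩
  ∑ [ n ] (λ z → 2 * inter v z A) ≡⟨ ∑-*ˡ [ n ] 2 _ ⟩
  2 * ∑ [ n ] (λ z → inter v z A) ≡⟨ cong (2 *_) ∑inter ⟩
  2 * (d * d) ≡⟨ *-assoc 2 d d ⟨
  2 * d * d ≤⟨ *-monoˡ-≤ d 2d≤n ⟩
  n * d ∎))
  where
  open ≤-Reasoning
  s₁ : ∀ x y → 2 * (x + y) ≡ 2 * y + 2 * x
  s₁ = solve-∀
  s₂ : ∀ x → 2 * x ≡ x + x
  s₂ = solve-∀
  big : ∀ z → suc d ≤ 2 * inter v z A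
  big z = +-cancelʳ-≤ d _ _ (begin
    suc d + d ≡⟨ cong suc (s₂ d) ⟨
    suc (2 * d) ≡⟨ cong (λ w → suc (2 * w)) (trans (sym (isRegGraph-deg {A = A} reg v)) (sym (inter+diff v z A))) ⟩
    suc (2 * (inter v z A + diff v z A)) ≡⟨ cong suc (s₁ (inter v z A) _) ⟩
    suc (2 * diff v z A) + 2 * inter v z A
      ≤⟨ +-monoˡ-≤ (2 * inter v z A) (<ᵇ⇒< (2 * diff v z A) d (Equivalence.from T-≡ (allFin-true e z))) ⟩
    d + 2 * inter v z A ≡⟨ +-comm d _ ⟩
    2 * inter v z A + d ∎)
  ∑inter : ∑ [ n ] (λ z → inter v z A) ≡ d * d
  ∑inter = begin-equality
    ∑ [ n ] (λ z → ∑ [ n ] λ y → ind (A v y ∧ A z y))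
      ≡⟨ ∑-swap [ n ] [ n ] _ ⟩
    ∑ [ n ] (λ y → ∑ [ n ] λ z → ind (A v y ∧ A z y))
      ≡⟨ ∑-cong [ n ] (λ y → ∑-cong [ n ] λ z → trans (ind-∧ (A v y) (A z y))
           (cong (λ β → ind (A v y) * ind β) (symm (isRegGraph-simple {A = A} reg) z y))) ⟩
    ∑ [ n ] (λ y → ∑ [ n ] λ z → ind (A v y) * ind (A y z))
      ≡⟨ ∑-cong [ n ] (λ y → trans (∑-*ˡ [ n ] (ind (A v y)) _) (cong (ind (A v y) *_) (isRegGraph-deg {A = A} reg y))) ⟩
    ∑ [ n ] (λ y → ind (A v y) * d)
      ≡⟨ ∑-*ʳ [ n ] d _ ⟩
    deg A v * d ≡⟨ cong (_* d) (isRegGraph-deg {A = A} reg v) ⟩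
    d * d ∎

∑∑-*ˡ : (xs : List 𝒜) (ys : List ℬ) (c : ℕ) (f : 𝒜 → ℬ → ℕ) →
        ∑ xs (λ x → ∑ ys (λ y → c * f x y)) ≡ c * ∑ xs (λ x → ∑ ys (f x))
∑∑-*ˡ xs ys c f = trans (∑-cong xs λ x → ∑-*ˡ ys c (f x)) (∑-*ˡ xs c _)

∑∑-*ʳ : (xs : List 𝒜) (ys : List ℬ) (c : ℕ) (f : 𝒜 → ℬ → ℕ) →
        ∑ xs (λ x → ∑ ys (λ y → f x y * c)) ≡ ∑ xs (λ x → ∑ ys (f x)) * c
∑∑-*ʳ xs ys c f = trans (∑-cong xs λ x → ∑-*ʳ ys c (f x)) (∑-*ʳ xs c _)

closePairs : ℕ → Adj n → ℕ
closePairs {n} s A = ∑ [ n ] λ u → ∑ [ n ] λ v → ind (not (eqFin u v) ∧ (diff u v A ≤ᵇ s))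

-- A union over u, v, the vertex z far from v, and the exact size j ≤ s of the difference.
closePairs-rare : ∀ n d m₀ s r → 2 * d ≤ n → 2 * m₀ ≤ d → 3 * (s + r) + 2 ≤ m₀ →
  ∑ (mats n) (λ M → reg₁ d M * closePairs s (adj M)) * 4 ^ r
    ≤ n * (n * (n * (suc s * totalCount n d)))
closePairs-rare n d m₀ s r 2d≤n 2m₀≤d room = begin
  ∑ (mats n) (λ M → reg₁ d M * closePairs s (adj M)) * 4 ^ r
    ≡⟨ cong (_* 4 ^ r) (trans (∑-cong (mats n) λ M → sym (∑∑-*ˡ [ n ] [ n ] (reg₁ d M) (λ u v → ind (not (eqFin u v) ∧ (diff u v (adj M) ≤ᵇ s)))))
         (trans (∑-swap (mats n) [ n ] _) (∑-cong [ n ] λ u → ∑-swap (mats n) [ n ] _))) ⟩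
  ∑ [ n ] (λ u → ∑ [ n ] λ v → bad u v) * 4 ^ r
    ≡⟨ ∑∑-*ʳ [ n ] [ n ] (4 ^ r) bad ⟨
  ∑ [ n ] (λ u → ∑ [ n ] λ v → bad u v * 4 ^ r)
    ≤⟨ ∑-mono [ n ] (λ u → ∑-mono [ n ] λ v → bad≤ u v) ⟩
  ∑ [ n ] (λ u → ∑ [ n ] λ v → n * (suc s * totalCount n d))
    ≡⟨ trans (∑-cong [ n ] λ u → ∑-allFin-const n _) (∑-allFin-const n _) ⟩
  n * (n * (n * (suc s * totalCount n d))) ∎
  where
  open ≤-Reasoning
  bad : Fin n → Fin n → ℕ
  bad u v = ∑ (mats n) (λ M → reg₁ d M * ind (not (eqFin u v) ∧ (diff u v (adj M) ≤ᵇ s)))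
  m₀>s : s < m₀
  m₀>s = ≤-trans (≤-trans (s≤s (≤-trans (m≤m+n s r) (m≤n*m (s + r) 3))) (≤-reflexive (+-comm 1 _))) (≤-trans (+-monoʳ-≤ (3 * (s + r)) (s≤s z≤n)) room)
  distinctB : Fin n → Fin n → Fin n → Bool
  distinctB u v z = not (eqFin u v) ∧ (not (eqFin u z) ∧ not (eqFin v z))
  class′ : Fin n → Fin n → Fin n → ℕ → Mat n → ℕ
  class′ u v z j M = reg₁ d M * ind (diff u v (adj M) ≡ᵇ j) * ind (m₀ ≤ᵇ diff v z (adj M))
  each : ∀ u v z (j : Fin (suc s)) → ∑ (mats n) (λ M → ind (distinctB u v z) * class′ u v z (toℕ j) M) * 4 ^ r ≤ totalCount n d
  each u v z j with eqFin u v in e₁ | eqFin u z in e₂ | eqFin v z in e₃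
  ... | true | _ | _ = ≤-trans (≤-reflexive (cong (_* 4 ^ r) (∑-zero (mats n)))) z≤n
  ... | false | true | _ = ≤-trans (≤-reflexive (cong (_* 4 ^ r) (∑-zero (mats n)))) z≤n
  ... | false | false | true = ≤-trans (≤-reflexive (cong (_* 4 ^ r) (∑-zero (mats n)))) z≤n
  ... | false | false | false = ≤-trans (≤-reflexive (cong (_* 4 ^ r) (∑-cong (mats n) λ M → +-identityʳ _)))
    (Codegree.#class-small {n} d m₀ {u} {v} {z} (eqFin-≢ e₁) (eqFin-≢ e₂) (eqFin-≢ e₃) r (toℕ j)
      (≤-trans (+-monoˡ-≤ 2 (*-monoʳ-≤ 3 (+-monoˡ-≤ r (≤-pred (Fin.toℕ<n j))))) room))
  cover : ∀ u v M → reg₁ d M * ind (not (eqFin u v) ∧ (diff u v (adj M) ≤ᵇ s)) ≤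
          ∑ [ n ] (λ z → ∑ [ suc s ] λ j → ind (distinctB u v z) * class′ u v z (toℕ j) M)
  cover u v M with isRegGraph d (adj M) in reg | eqFin u v in e₁ | diff u v (adj M) ≤ᵇ s in e₂
  ... | false | _ | _ = z≤n
  ... | true | true | _ = z≤n
  ... | true | false | false = z≤n
  ... | true | false | true with far-vertex {A = adj M} reg 2d≤n v
  ...   | z , far = begin
    1 ≡⟨ one ⟨
    term z j
      ≤⟨ ∑-∈ (term z) (∈-allFin j) ⟩
    ∑ [ suc s ] (term z)
      ≤⟨ ∑-∈ (λ z → ∑ [ suc s ] (term z)) (∈-allFin z) ⟩
    _ ∎
    where
    A = adj M
    d≤s : diff u v A ≤ s
    d≤s = ≤ᵇ-true e₂
    j : Fin (suc s)
    j = fromℕ< (s≤s d≤s)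
    m₀≤ : m₀ ≤ diff v z A
    m₀≤ = *-cancelˡ-≤ 2 (≤-trans 2m₀≤d far)
    v≢z : v ≢ z
    v≢z refl = <⇒≱ (≤-trans (s≤s z≤n) m₀>s) (≤-trans m₀≤ (≤-reflexive
      (trans (∑-cong [ n ] self) (∑-zero [ n ]))))
      where
      self : ∀ y → ind (A v y ∧ not (A v y)) ≡ 0
      self y with A v y
      ... | true = refl
      ... | false = refl
    -- The vertex far from v cannot be u, whose difference from v is at most s < m₀.
    u≢z : u ≢ z
    u≢z refl = <⇒≱ m₀>s (≤-trans m₀≤ (≤-trans (≤-reflexive
      (diff-sym v u A (trans (isRegGraph-deg {A = A} reg v) (sym (isRegGraph-deg {A = A} reg u))))) d≤s))
    term : Fin n → Fin (suc s) → ℕ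
    term z j = ind (not (eqFin u z) ∧ not (eqFin v z)) * (1 * ind (diff u v A ≡ᵇ toℕ j) * ind (m₀ ≤ᵇ diff v z A))
    one : term z j ≡ 1
    one rewrite eqFin-false u≢z | eqFin-false v≢z | ≡ᵇ-intro {diff u v A} (sym (Fin.toℕ-fromℕ< (s≤s d≤s))) | ≤ᵇ-intro m₀≤ = refl
  bad≤ : ∀ u v → bad u v * 4 ^ r ≤ n * (suc s * totalCount n d)
  bad≤ u v = begin
    bad u v * 4 ^ r ≤⟨ *-monoˡ-≤ (4 ^ r) (∑-mono (mats n) (cover u v)) ⟩
    ∑ (mats n) (λ M → ∑ [ n ] λ z → ∑ [ suc s ] λ j → ind (distinctB u v z) * class′ u v z (toℕ j) M) * 4 ^ r
      ≡⟨ cong (_* 4 ^ r) (trans (∑-swap (mats n) [ n ] _) (∑-cong [ n ] λ z → ∑-swap (mats n) [ suc s ] _)) ⟩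
    ∑ [ n ] (λ z → ∑ [ suc s ] λ j → ∑ (mats n) λ M → ind (distinctB u v z) * class′ u v z (toℕ j) M) * 4 ^ r
      ≡⟨ ∑∑-*ʳ [ n ] [ suc s ] (4 ^ r) (λ z j → ∑ (mats n) λ M → ind (distinctB u v z) * class′ u v z (toℕ j) M) ⟨
    ∑ [ n ] (λ z → ∑ [ suc s ] λ j → ∑ (mats n) (λ M → ind (distinctB u v z) * class′ u v z (toℕ j) M) * 4 ^ r)
      ≤⟨ ∑-mono [ n ] (λ z → ∑-mono [ suc s ] λ j → each u v z j) ⟩
    ∑ [ n ] (λ z → ∑ [ suc s ] λ j → totalCount n d)
      ≡⟨ trans (∑-cong [ n ] λ z → ∑-allFin-const (suc s) _) (∑-allFin-const n _) ⟩
    n * (suc s * totalCount n d) ∎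

-- Colour refinement

anyB : (Fin n → Bool) → Bool
anyB {n} f = not (allB [ n ] (not ∘ f))

anyB-elim : {f : Fin n → Bool} → anyB f ≡ true → ∃ λ x → f x ≡ true
anyB-elim {n} h with allB-false [ n ] (not-true h)
... | x , _ , e = x , not-false e

anyB-false : {f : Fin n → Bool} → anyB f ≡ false → ∀ x → f x ≡ false
anyB-false h x = not-true (allFin-true (not-false h) x)

anyB-intro : {f : Fin n → Bool} → ∀ x → f x ≡ true → anyB f ≡ true
anyB-intro {f = f} x fx with anyB f in e
... | true = refl
... | false = trans (sym (anyB-false e x)) fx

<ᵇ-true : ∀ {m n} → (m <ᵇ n) ≡ true → m < n
<ᵇ-true {m} {n} h = <ᵇ⇒< m n (Equivalence.from T-≡ h)

<ᵇ-intro : ∀ {m n} → m < n → (m <ᵇ n) ≡ true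
<ᵇ-intro h = Equivalence.to T-≡ (<⇒<ᵇ h)

module Classes {n} (_~_ : Fin n → Fin n → Bool)
               (~-sym : ∀ {u v} → (u ~ v) ≡ true → (v ~ u) ≡ true)
               (~-trans : ∀ {u v x} → (u ~ v) ≡ true → (v ~ x) ≡ true → (u ~ x) ≡ true) where

  -- `laterB` omits the last member of each class. Pairing a vertex with a later one is what makes a
  -- family of pairs satisfy `indepB`.
  laterB sharedB : Fin n → Bool
  laterB u = anyB (λ v → (toℕ u <ᵇ toℕ v) ∧ (u ~ v))
  sharedB u = anyB (λ v → not (eqFin u v) ∧ (u ~ v))

  later-intro : ∀ {u v} → toℕ u < toℕ v → (u ~ v) ≡ true → laterB u ≡ true
  later-intro {v = v} lt e = anyB-intro v (∧-intro (<ᵇ-intro lt) e)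

  unshared : ∀ {x} → sharedB x ≡ false → ∀ y → (y ~ x) ≡ true → y ≡ x
  unshared {x} h y e with eqFin x y in q
  ... | true = sym (eqFin-true q)
  ... | false = ⊥-elim (true≢false (trans (sym (∧-intro (cong not q) (~-sym e))) (anyB-false h y)))

  last-unique : ∀ x y → laterB x ≡ false → laterB y ≡ false → (x ~ y) ≡ true → x ≡ y
  last-unique x y hx hy e with <-cmp (toℕ x) (toℕ y)
  ... | tri< lt _ _ = ⊥-elim (true≢false (trans (sym (later-intro lt e)) hx))
  ... | tri≈ _ q _ = Fin.toℕ-injective q
  ... | tri> _ _ gt = ⊥-elim (true≢false (trans (sym (later-intro gt (~-sym e))) hy))

  -- A shared vertex that is last in its class is determined by any other member of the class.
  ∑shared≤ : ∑ [ n ] (ind ∘ sharedB) ≤ 2 * ∑ [ n ] (ind ∘ laterB)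
  ∑shared≤ = begin
    ∑ [ n ] (ind ∘ sharedB) ≤⟨ ∑-mono [ n ] pt ⟩
    ∑ [ n ] (λ x → ind (laterB x) + ∑ [ n ] (λ y → ind (laterB y) * ind (not (laterB x) ∧ (x ~ y))))
      ≡⟨ ∑-+ [ n ] _ _ ⟩
    R + ∑ [ n ] (λ x → ∑ [ n ] (λ y → ind (laterB y) * ind (not (laterB x) ∧ (x ~ y))))
      ≡⟨ cong (R +_) (∑-swap [ n ] [ n ] _) ⟩
    R + ∑ [ n ] (λ y → ∑ [ n ] (λ x → ind (laterB y) * ind (not (laterB x) ∧ (x ~ y))))
      ≤⟨ +-monoʳ-≤ R (∑-mono [ n ] λ y → ≤-trans (≤-reflexive (∑-*ˡ [ n ] (ind (laterB y)) _))
           (≤-trans (*-monoʳ-≤ (ind (laterB y)) (∑-ind-≤1 _ (one y))) (≤-reflexive (*-identityʳ _)))) ⟩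
    R + R ≡⟨ cong (R +_) (+-identityʳ R) ⟨
    2 * R ∎
    where
    open ≤-Reasoning
    R = ∑ [ n ] (ind ∘ laterB)
    one : ∀ y x x′ → (not (laterB x) ∧ (x ~ y)) ≡ true → (not (laterB x′) ∧ (x′ ~ y)) ≡ true → x ≡ x′
    one y x x′ h h′ = last-unique x x′ (not-true (proj₁ (∧-true h))) (not-true (proj₁ (∧-true h′)))
      (~-trans (proj₂ (∧-true {not (laterB x)} h)) (~-sym (proj₂ (∧-true {not (laterB x′)} h′))))
    pt : ∀ x → ind (sharedB x) ≤ ind (laterB x) + ∑ [ n ] (λ y → ind (laterB y) * ind (not (laterB x) ∧ (x ~ y)))
    pt x with sharedB x in sh | laterB x in la
    ... | false | _ = z≤n
    ... | true | true = s≤s z≤n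
    ... | true | false with anyB-elim sh
    ...   | y , h = ≤-trans (≤-reflexive (sym (cong₂ (λ β γ → ind β * ind γ) ly x~y)))
              (∑-∈ (λ y → ind (laterB y) * ind (x ~ y)) (∈-allFin y))
      where
      x~y : (x ~ y) ≡ true
      x~y = proj₂ (∧-true {not (eqFin x y)} h)
      ly : laterB y ≡ true
      ly with <-cmp (toℕ x) (toℕ y)
      ... | tri< lt _ _ = ⊥-elim (true≢false (trans (sym (later-intro lt x~y)) la))
      ... | tri≈ _ q _ = ⊥-elim (eqFin-≢ (not-true (proj₁ (∧-true h))) (Fin.toℕ-injective q))
      ... | tri> _ _ gt = later-intro gt (~-sym x~y)

  memB-above : ∀ {m} {x} (ps : Pairs n m) →
    VAll (λ q → toℕ x < toℕ (proj₁ q) × toℕ (proj₁ q) < toℕ (proj₂ q)) ps → memB x ps ≡ false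
  memB-above [] [] = refl
  memB-above {x = x} ((u , v) ∷ ps) ((x<u , u<v) ∷ h)
    rewrite eqFin-false {u = x} {u} (λ { refl → <-irrefl refl x<u })
          | eqFin-false {u = x} {v} (λ { refl → <-asym x<u u<v }) = memB-above ps h

  -- The list is read in increasing order, and each marked vertex is paired with a larger one of its
  -- class. It lies below every vertex of the pairs taken from the rest of the list, hence is new.
  extract : ∀ m xs → AllPairs (λ x y → toℕ x < toℕ y) xs → m ≤ ∑ xs (ind ∘ laterB) →
    ∃ λ (ps : Pairs n m) → indepB ps ≡ true ×
      VAll (λ q → proj₁ q ∈ xs × toℕ (proj₁ q) < toℕ (proj₂ q) × (proj₁ q ~ proj₂ q) ≡ true) ps
  extract zero xs _ _ = [] , refl , []
  extract (suc m) (x ∷ xs) (x<xs ∷ sorted) h with laterB x in la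
  ... | false with extract (suc m) xs sorted h
  ...   | ps , i , a = ps , i , VAll.map (λ { (p , q) → there p , q }) a
  extract (suc m) (x ∷ xs) (x<xs ∷ sorted) h | true
    with extract m xs sorted (≤-pred h) | anyB-elim la
  ... | ps , i , a | v , xv =
    (x , v) ∷ ps
    , ∧-intro (∧-intro (cong not (eqFin-false {u = x} {v} λ { refl → <-irrefl refl x<v }))
        (cong not (memB-above ps (VAll.map (λ { (p , lt , _) → All.lookup x<xs p , lt }) a)))) i
    , (here refl , x<v , proj₂ (∧-true {toℕ x <ᵇ toℕ v} xv)) ∷ VAll.map (λ { (p , q) → there p , q }) a
    where
    x<v : toℕ x < toℕ v
    x<v = <ᵇ-true (proj₁ (∧-true xv))

  many-pairs : ∀ m → m ≤ ∑ [ n ] (ind ∘ laterB) →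
    ∃ λ (ps : Pairs n m) → indepB ps ≡ true × VAll (λ q → (proj₁ q ~ proj₂ q) ≡ true) ps
  many-pairs m h with extract m [ n ] (AllPairs.tabulate⁺-< id) h
  ... | ps , i , a = ps , i , VAll.map (λ { (_ , _ , e) → e }) a

-- The exceptional events of the rounds and their effect on refinement

agree-intro : (p : Fin n → Fin k) (js : List (Fin k)) {u v : Fin n} {A : Adj n} →
              (∀ {j} → j ∈ js → degIn p A j u ≡ degIn p A j v) → agree p js u v A ≡ 1
agree-intro p [] h = refl
agree-intro p (j ∷ js) {u} {A = A} h =
  cong₂ _*_ (cong ind (≡ᵇ-intro {degIn p A j u} (h (here refl)))) (agree-intro p js (h ∘ there))

agreeAll-intro : ∀ {m} (p : Fin n → Fin k) (js : List (Fin k)) (ps : Pairs n m) {A : Adj n} →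
                 VAll (λ q → ∀ {j} → j ∈ js → degIn p A j (proj₁ q) ≡ degIn p A j (proj₂ q)) ps →
                 agreeAll p js ps A ≡ 1
agreeAll-intro p js [] [] = refl
agreeAll-intro p js (_ ∷ ps) (h ∷ hs) = cong₂ _*_ (agree-intro p js h) (agreeAll-intro p js ps hs)

allPairs : ∀ n m → List (Pairs n m)
allPairs n m = allVec m (cartesianProduct [ n ] [ n ])

∈-allPairs : ∀ {m} (ps : Pairs n m) → ps ∈ allPairs n m
∈-allPairs ps = ∈-allVec ps λ i → ∈-cartesianProduct⁺ (∈-allFin _) (∈-allFin _)

outside₁ : ∀ {m} → Pairs n m → Fin n → Bool
outside₁ ps x = not (memB x ps)

outside₂ : ∀ {m} → Vec Bool n → Pairs n m → Fin n → Bool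
outside₂ W ps x = not (memB x ps) ∧ not (lookup W x)

-- Colours that keep, outside the pairs, at least half of the n / 3k vertices guaranteed by balance.
colours₁ : ∀ {m} → (Fin n → Fin k) → Pairs n m → List (Fin k)
colours₁ {n} {k} p ps = filter (λ j → T? (n ≤ᵇ 6 * k * length (block (outside₁ ps) p j))) [ k ]

-- In round two every vertex with a unique colour serves as a class of its own, so the partition is
-- `id` and the colours are vertices. W stands for the vertices that still share a colour.
colours₂ : ∀ {m} → Vec Bool n → Pairs n m → List (Fin n)
colours₂ {n} W ps = filter (λ x → T? (outside₂ W ps x)) [ n ]

-- A number of witnesses rather than a truth value, so that its mean is a union bound.
event₁ : ℕ → (Fin n → Fin k) → Adj n → ℕ
event₁ {n} m p A = ∑ (allPairs n m) (λ ps → ind (indepB ps) * agreeAll p (colours₁ p ps) ps A)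

-- The set W of vertices sharing a colour after round one depends on the graph, hence the sum over
-- all small sets. In return the event no longer mentions the partition.
event₂ : ℕ → ℕ → Adj n → ℕ
event₂ {n} m₁ m₂ A = ∑ (allVec n bits) λ W → ∑ (allPairs n m₂) λ ps →
  ind (∑ [ n ] (λ x → ind (lookup W x)) ≤ᵇ 2 * m₁) * (ind (indepB ps) * agreeAll id (colours₂ W ps) ps A)

module Refinement {n k} (A : Adj n) (p : Fin n → Fin k) where

  nb : ℕ → Fin n → Fin n → ℕ
  nb t x u = countB [ n ] (λ y → A u y ∧ sameColour A p t y x)

  col-suc : ∀ t {u v} → sameColour A p (suc t) u v ≡ true →
            sameColour A p t u v ≡ true × (∀ x → nb t x u ≡ nb t x v)
  col-suc t {u} {v} h = proj₁ (∧-true h) , λ x → ≡ᵇ-true (allFin-true (proj₂ (∧-true {sameColour A p t u v} h)) x)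

  col-refl : ∀ t u → sameColour A p t u u ≡ true
  col-refl zero u = eqFin-refl (p u)
  col-refl (suc t) u = ∧-intro (col-refl t u) (allB-intro [ n ] λ x → ≡ᵇ-intro {nb t x u} refl)

  col-sym : ∀ t {u v} → sameColour A p t u v ≡ true → sameColour A p t v u ≡ true
  col-sym zero {u} {v} h = subst (λ z → eqFin (p v) z ≡ true) (sym (eqFin-true {u = p u} h)) (eqFin-refl (p v))
  col-sym (suc t) {u} {v} h with col-suc t h
  ... | e , f = ∧-intro (col-sym t e) (allB-intro [ n ] λ x → ≡ᵇ-intro {nb t x v} (sym (f x)))

  col-trans : ∀ t {u v y} → sameColour A p t u v ≡ true → sameColour A p t v y ≡ true → sameColour A p t u y ≡ true
  col-trans zero {u} {v} {y} h h′ = subst (λ z → eqFin (p u) z ≡ true) (eqFin-true {u = p v} h′) h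
  col-trans (suc t) {u} {v} {y} h h′ with col-suc t h | col-suc t h′
  ... | e , f | e′ , f′ = ∧-intro (col-trans t e e′)
    (allB-intro [ n ] λ x → ≡ᵇ-intro {nb t x u} (trans (f x) (f′ x)))

  module C t = Classes (sameColour A p t) (col-sym t) (col-trans t)

  nb-unshared : ∀ t {x} → C.sharedB t x ≡ false → ∀ u → nb t x u ≡ ind (A u x)
  nb-unshared t {x} h u = trans (countB≡∑ [ n ] _) (trans (∑-point x other) self)
    where
    other : ∀ y → y ≢ x → ind (A u y ∧ sameColour A p t y x) ≡ 0
    other y y≢x with A u y | sameColour A p t y x in e
    ... | false | _ = refl
    ... | true | false = refl
    ... | true | true = ⊥-elim (y≢x (C.unshared t h y e))
    self : ind (A u x ∧ sameColour A p t x x) ≡ ind (A u x)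
    self rewrite col-refl t x with A u x
    ... | true = refl
    ... | false = refl

  ind-injective : ∀ {b c} → ind b ≡ ind c → b ≡ c
  ind-injective {true} {true} h = refl
  ind-injective {false} {false} h = refl

  -- The number of neighbours carrying a colour that only x has is the indicator of adjacency to x.
  distinguish : ∀ t {x} → C.sharedB t x ≡ false → ∀ {u v} → sameColour A p (suc t) u v ≡ true → A u x ≡ A v x
  distinguish t {x} h {u} {v} e = ind-injective
    (trans (sym (nb-unshared t h u)) (trans (proj₂ (col-suc t e) x) (nb-unshared t h v)))

  discrete : ∀ m₁ m₂ s → 2 * m₂ ≤ s → event₁ m₁ p A ≡ 0 → event₂ m₁ m₂ A ≡ 0 → closePairs s A ≡ 0 →
             ∀ u v → sameColour A p 3 u v ≡ true → u ≡ v
  discrete m₁ m₂ s 2m₂≤s no₁ no₂ no₃ u v same with eqFin u v in e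
  ... | true = eqFin-true e
  ... | false = ⊥-elim (1+n≢0 (trans (sym close) far))
    where
    later₁ : ∑ [ n ] (ind ∘ C.laterB 1) ≤ m₁
    later₁ with ≤-total (∑ [ n ] (ind ∘ C.laterB 1)) m₁
    ... | inj₁ le = le
    ... | inj₂ ge with C.many-pairs 1 m₁ ge
    ...   | ps , ip , all = ⊥-elim (1+n≢0 (trans (sym (cong₂ _*_ (cong ind ip)
              (agreeAll-intro p (colours₁ p ps) ps (VAll.map agree₁ all))))
              (∑≡0 (λ ps → ind (indepB ps) * agreeAll p (colours₁ p ps) ps A) no₁ (∈-allPairs ps))))
      where
      agree₁ : ∀ {q} → sameColour A p 1 (proj₁ q) (proj₂ q) ≡ true →
               ∀ {j} → j ∈ colours₁ p ps → degIn p A j (proj₁ q) ≡ degIn p A j (proj₂ q)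
      -- Refinement compares counts only for colours realised by some vertex. A colour in `colours₁`
      -- is realised: n is positive, so its block is nonempty.
      agree₁ {y , z} h {j} j∈ with block (outside₁ ps) p j in eb
        | ≤ᵇ-true {n} (Equivalence.to T-≡ (proj₂ (∈-filter⁻ (λ j → T? (n ≤ᵇ 6 * k * length (block (outside₁ ps) p j))) {xs = allFin k} j∈)))
      ... | [] | le = ⊥-elim (<⇒≱ (≤-trans (s≤s z≤n) (Fin.toℕ<n u)) (≤-trans le (≤-reflexive (*-zeroʳ (6 * k)))))
      ... | x ∷ _ | _ with ∈-block {T = outside₁ ps} {p} {j} (subst (x ∈_) (sym eb) (here refl))
      ...   | _ , refl = trans (sym (countB≡∑ [ n ] _)) (trans (proj₂ (col-suc 0 h) x) (countB≡∑ [ n ] _))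
    shared₁ : ∑ [ n ] (ind ∘ C.sharedB 1) ≤ 2 * m₁
    shared₁ = ≤-trans (C.∑shared≤ 1) (*-monoʳ-≤ 2 later₁)
    W : Vec Bool n
    W = Vec.tabulate (C.sharedB 1)
    |W| : ∑ [ n ] (λ x → ind (lookup W x)) ≤ 2 * m₁
    |W| = ≤-trans (≤-reflexive (∑-cong [ n ] λ x → cong ind (Vec.lookup∘tabulate (C.sharedB 1) x))) shared₁
    later₂ : ∑ [ n ] (ind ∘ C.laterB 2) ≤ m₂
    later₂ with ≤-total (∑ [ n ] (ind ∘ C.laterB 2)) m₂
    ... | inj₁ le = le
    ... | inj₂ ge with C.many-pairs 2 m₂ ge
    ...   | ps , ip , all = ⊥-elim (1+n≢0 (trans (sym (cong₂ _*_ (cong ind (≤ᵇ-intro |W|))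
              (cong₂ _*_ (cong ind ip) (agreeAll-intro id (colours₂ W ps) ps (VAll.map agree₂ all)))))
              (∑≡0 _ (∑≡0 _ no₂ (∈-allVec W λ i → ∈-bits (lookup W i))) (∈-allPairs ps))))
      where
      ∈-bits : ∀ β → β ∈ bits
      ∈-bits true = here refl
      ∈-bits false = there (here refl)
      agree₂ : ∀ {q} → sameColour A p 2 (proj₁ q) (proj₂ q) ≡ true →
               ∀ {x} → x ∈ colours₂ W ps → degIn id A x (proj₁ q) ≡ degIn id A x (proj₂ q)
      agree₂ {y , z} h {x} x∈ = ∑-cong [ n ] eq
        where
        x-unshared : C.sharedB 1 x ≡ false
        x-unshared = trans (sym (Vec.lookup∘tabulate (C.sharedB 1) x)) (not-true (proj₂ (∧-true {not (memB x ps)}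
          (Equivalence.to T-≡ (proj₂ (∈-filter⁻ (λ x → T? (outside₂ W ps x)) {xs = allFin n} x∈))))))
        eq : ∀ t → ind (A y t ∧ eqFin t x) ≡ ind (A z t ∧ eqFin t x)
        eq t with eqFin t x in e
        ... | true = cong (λ β → ind (β ∧ true)) (subst (λ r → A y r ≡ A z r) (sym (eqFin-true {u = t} e)) (distinguish 1 {x} x-unshared {y} {z} h))
        ... | false with A y t | A z t
        ...   | true | true = refl
        ...   | true | false = refl
        ...   | false | true = refl
        ...   | false | false = refl
    diff≤ : diff u v A ≤ s
    diff≤ = ≤-trans (∑-mono [ n ] pt) (≤-trans (C.∑shared≤ 2) (≤-trans (*-monoʳ-≤ 2 later₂) 2m₂≤s))
      where
      pt : ∀ y → ind (A u y ∧ not (A v y)) ≤ ind (C.sharedB 2 y)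
      pt y with C.sharedB 2 y in sh
      ... | true = ind≤1 (A u y ∧ not (A v y))
      ... | false rewrite distinguish 2 {y} sh {u} {v} same with A v y
      ...   | true = z≤n
      ...   | false = z≤n
    close : ind (not (eqFin u v) ∧ (diff u v A ≤ᵇ s)) ≡ 1
    close = cong ind (∧-intro (cong not e) (≤ᵇ-intro diff≤))
    far : ind (not (eqFin u v) ∧ (diff u v A ≤ᵇ s)) ≡ 0
    far = ∑≡0 (λ v → ind (not (eqFin u v) ∧ (diff u v A ≤ᵇ s)))
            (∑≡0 (λ u → ∑ [ n ] λ v → ind (not (eqFin u v) ∧ (diff u v A ≤ᵇ s))) no₃ (∈-allFin u)) (∈-allFin v)

  discreteAfter-3 : ∀ m₁ m₂ s → 2 * m₂ ≤ s → event₁ m₁ p A ≡ 0 → event₂ m₁ m₂ A ≡ 0 → closePairs s A ≡ 0 →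
                    discreteAfter A p 3 ≡ true
  discreteAfter-3 m₁ m₂ s le no₁ no₂ no₃ = allB-intro [ n ] λ u → allB-intro [ n ] λ v → pt u v
    where
    pt : ∀ u v → (not (sameColour A p 3 u v) ∨ eqFin u v) ≡ true
    pt u v with sameColour A p 3 u v in e
    ... | false = refl
    ... | true = trans (cong (λ z → eqFin z v) (discrete m₁ m₂ s le no₁ no₂ no₃ u v e)) (eqFin-refl v)

-- Union bounds

eqFin-sym : (u v : Fin n) → eqFin u v ≡ eqFin v u
eqFin-sym u v = bool-ext (λ h → trans (cong (eqFin v) (eqFin-true {u = u} h)) (eqFin-refl v))
                         (λ h → trans (cong (eqFin u) (eqFin-true {u = v} h)) (eqFin-refl u))

length-block : (T : Fin n → Bool) (p : Fin n → Fin k) (j : Fin k) →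
               length (block T p j) ≡ ∑ [ n ] (λ y → ind (T y ∧ eqFin (p y) j))
length-block {n} T p j = length-filter (λ y → T y ∧ eqFin (p y) j) [ n ]

balanced-≥ : (p : Fin n → Fin k) → balanced p ≡ true → ∀ j → n ≤ 3 * k * ∑ [ n ] (λ y → ind (eqFin (p y) j))
balanced-≥ {n} {k} p h j = subst (λ z → n ≤ 3 * k * z) (countB≡∑ [ n ] _)
  (≤ᵇ-true (proj₁ (∧-true (allFin-true h j))))

-- A colour that is not kept has at least n / 6k vertices inside the pairs. The pairs cover at most
-- 2m ≤ n / 12 vertices, so at most half of the colours are lost.
many-colours : ∀ {m κ} (p : Fin n → Fin k) (ps : Pairs n m) → 0 < n → balanced p ≡ true → 24 * m ≤ n → k ≡ 2 * κ →
               κ ≤ length (colours₁ p ps)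
many-colours {n} {k} {m} {κ} p ps n>0 bal 24m≤n k≡ = *-cancelˡ-≤ 2 (≤-trans (≤-reflexive (sym k≡)) (+-cancelʳ-≤ k _ _ (begin
  k + k ≡⟨ s₀ k ⟨
  2 * k ≡⟨ cong (2 *_) (trans (sym (*-identityʳ k)) (sym (∑-allFin-const k 1))) ⟩
  2 * ∑ [ k ] (λ _ → 1) ≡⟨ cong (2 *_) (∑-cong [ k ] λ j → one (goodB j)) ⟩
  2 * ∑ [ k ] (λ j → ind (goodB j) + ind (not (goodB j))) ≡⟨ cong (2 *_) (∑-+ [ k ] _ _) ⟩
  2 * (∑ [ k ] (ind ∘ goodB) + bad) ≡⟨ *-distribˡ-+ 2 (∑ [ k ] (ind ∘ goodB)) bad ⟩
  2 * ∑ [ k ] (ind ∘ goodB) + 2 * bad ≤⟨ +-mono-≤ (≤-reflexive (cong (2 *_) (sym (length-filter goodB [ k ])))) bad≤ ⟩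
  2 * length (colours₁ p ps) + k ∎)))
  where
  open ≤-Reasoning
  s₀ : ∀ k → 2 * k ≡ k + k
  s₀ = solve-∀
  T = outside₁ ps
  goodB : Fin k → Bool
  goodB j = n ≤ᵇ 6 * k * length (block T p j)
  bad = ∑ [ k ] (λ j → ind (not (goodB j)))
  one : ∀ β → 1 ≡ ind β + ind (not β)
  one true = refl
  one false = refl
  inside : Fin k → ℕ
  inside j = ∑ [ n ] (λ y → ind (memB y ps) * ind (eqFin (p y) j))
  each : ∀ j → ind (not (goodB j)) * n ≤ 6 * k * inside j
  each j with goodB j in g
  ... | true = z≤n
  ... | false = ≤-trans (≤-reflexive (+-identityʳ n)) (+-cancelˡ-≤ n _ _ (begin
    n + n ≡⟨ s₀ n ⟨
    2 * n ≤⟨ *-monoʳ-≤ 2 (balanced-≥ p bal j) ⟩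
    2 * (3 * k * ∑ [ n ] (λ y → ind (eqFin (p y) j)))
      ≡⟨ cong (λ z → 2 * (3 * k * z)) (trans (∑-cong [ n ] split) (∑-+ [ n ] _ _)) ⟩
    2 * (3 * k * (∑ [ n ] (λ y → ind (T y ∧ eqFin (p y) j)) + inside j))
      ≡⟨ cong (λ z → 2 * (3 * k * (z + inside j))) (length-block T p j) ⟨
    2 * (3 * k * (length (block T p j) + inside j)) ≡⟨ s₁ k _ (inside j) ⟩
    6 * k * length (block T p j) + 6 * k * inside j
      ≤⟨ +-monoˡ-≤ (6 * k * inside j) (<⇒≤ (≤ᵇ-false g)) ⟩
    n + 6 * k * inside j ∎))
    where
    s₁ : ∀ k x y → 2 * (3 * k * (x + y)) ≡ 6 * k * x + 6 * k * y
    s₁ = solve-∀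
    split : ∀ y → ind (eqFin (p y) j) ≡ ind (T y ∧ eqFin (p y) j) + ind (memB y ps) * ind (eqFin (p y) j)
    split y with memB y ps
    ... | true = sym (+-identityʳ _)
    ... | false = sym (+-identityʳ _)
  bad≤ : 2 * bad ≤ k
  bad≤ = *-cancelʳ-≤ _ _ n {{>-nonZero n>0}} (begin
    2 * bad * n ≡⟨ *-assoc 2 bad n ⟩
    2 * (bad * n) ≡⟨ cong (2 *_) (∑-*ʳ [ k ] n _) ⟨
    2 * ∑ [ k ] (λ j → ind (not (goodB j)) * n) ≤⟨ *-monoʳ-≤ 2 (∑-mono [ k ] each) ⟩
    2 * ∑ [ k ] (λ j → 6 * k * inside j) ≡⟨ cong (2 *_) (∑-*ˡ [ k ] (6 * k) inside) ⟩
    2 * (6 * k * ∑ [ k ] inside) ≤⟨ *-monoʳ-≤ 2 (*-monoʳ-≤ (6 * k) inside≤) ⟩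
    2 * (6 * k * (m * 2)) ≡⟨ s₂ k m ⟩
    k * (24 * m) ≤⟨ *-monoʳ-≤ k 24m≤n ⟩
    k * n ∎)
    where
    s₂ : ∀ k m → 2 * (6 * k * (m * 2)) ≡ k * (24 * m)
    s₂ = solve-∀
    inside≤ : ∑ [ k ] inside ≤ m * 2
    inside≤ = ≤-trans (≤-reflexive (trans (∑-swap [ k ] [ n ] _) (∑-cong [ n ] λ y →
        trans (∑-*ˡ [ k ] (ind (memB y ps)) _) (trans (cong (ind (memB y ps) *_)
          (trans (∑-cong [ k ] λ j → cong ind (eqFin-sym (p y) j)) (∑-δ₁ (p y)))) (*-identityʳ _)))))
      (∑-memB ps)

many-outside : ∀ {m m₁} (W : Vec Bool n) (ps : Pairs n m) → ∑ [ n ] (λ x → ind (lookup W x)) ≤ 2 * m₁ →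
               4 * (m + m₁) ≤ n → n ≤ 2 * length (colours₂ W ps)
many-outside {n} {m} {m₁} W ps |W| small = +-cancelʳ-≤ n _ _ (begin
  n + n ≡⟨ s₀ n ⟨
  2 * n ≡⟨ cong (2 *_) (trans (sym (*-identityʳ n)) (sym (∑-allFin-const n 1))) ⟩
  2 * ∑ [ n ] (λ _ → 1) ≤⟨ *-monoʳ-≤ 2 (∑-mono [ n ] λ x → pt (memB x ps) (lookup W x)) ⟩
  2 * ∑ [ n ] (λ x → ind (outside₂ W ps x) + (ind (memB x ps) + ind (lookup W x)))
    ≡⟨ cong (2 *_) (trans (∑-+ [ n ] _ _) (cong₂ _+_ (sym (length-filter (outside₂ W ps) [ n ])) (∑-+ [ n ] _ _))) ⟩
  2 * (length (colours₂ W ps) + (∑ [ n ] (λ x → ind (memB x ps)) + ∑ [ n ] (λ x → ind (lookup W x))))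
    ≤⟨ *-monoʳ-≤ 2 (+-monoʳ-≤ (length (colours₂ W ps)) (+-mono-≤ (∑-memB ps) |W|)) ⟩
  2 * (length (colours₂ W ps) + (m * 2 + 2 * m₁)) ≡⟨ s₁ (length (colours₂ W ps)) m m₁ ⟩
  2 * length (colours₂ W ps) + 4 * (m + m₁) ≤⟨ +-monoʳ-≤ _ small ⟩
  2 * length (colours₂ W ps) + n ∎)
  where
  open ≤-Reasoning
  s₀ : ∀ k → 2 * k ≡ k + k
  s₀ = solve-∀
  s₁ : ∀ l m m₁ → 2 * (l + (m * 2 + 2 * m₁)) ≡ 2 * l + 4 * (m + m₁)
  s₁ = solve-∀
  pt : ∀ α β → 1 ≤ ind (not α ∧ not β) + (ind α + ind β)
  pt true β = s≤s z≤n
  pt false true = s≤s z≤n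
  pt false false = s≤s z≤n

-- Exponential gains and the first-moment bounds

^-distribʳ-* : ∀ t x y → (x * y) ^ t ≡ x ^ t * y ^ t
^-distribʳ-* zero x y = refl
^-distribʳ-* (suc t) x y rewrite ^-distribʳ-* t x y = shuffle x y (x ^ t) (y ^ t)
  where
  shuffle : ∀ x y a b → x * y * (a * b) ≡ x * a * (y * b)
  shuffle = solve-∀

-- Bernoulli's inequality for (1 + d / x)^c, cleared of denominators.
bernoulli : ∀ x d c → x ^ c * (x + c * d) ≤ (x + d) ^ c * x
bernoulli x d zero = ≤-reflexive (cong (1 *_) (+-identityʳ x))
bernoulli x d (suc c) = begin
  x * x ^ c * (x + suc c * d) ≤⟨ ≤-by (c * d * d * x ^ c) (s₁ x d c (x ^ c)) ⟩
  (x + d) * (x ^ c * (x + c * d)) ≤⟨ *-monoʳ-≤ (x + d) (bernoulli x d c) ⟩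
  (x + d) * ((x + d) ^ c * x) ≡⟨ *-assoc (x + d) _ x ⟨
  (x + d) ^ suc c * x ∎
  where
  open ≤-Reasoning
  s₁ : ∀ x d c y → (x + d) * (y * (x + c * d)) ≡ x * y * (x + (1 + c) * d) + c * d * d * y
  s₁ = solve-∀

doubling : ∀ x d c → 0 < x → x ≤ c * d → 2 * x ^ c ≤ (x + d) ^ c
doubling x d c x>0 x≤ = *-cancelʳ-≤ _ _ x {{>-nonZero x>0}} (begin
  2 * x ^ c * x ≡⟨ s₁ x (x ^ c) ⟩
  x ^ c * (x + x) ≤⟨ *-monoʳ-≤ (x ^ c) (+-monoʳ-≤ x x≤) ⟩
  x ^ c * (x + c * d) ≤⟨ bernoulli x d c ⟩
  (x + d) ^ c * x ∎)
  where
  open ≤-Reasoning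
  s₁ : ∀ x y → 2 * y * x ≡ y * (x + x)
  s₁ = solve-∀

-- The t factors 1 + d / x contain h groups of c, and each group is worth a factor 2.
doublings : ∀ x d c h t → 0 < x → x ≤ c * d → c * h ≤ t → 2 ^ h * x ^ t ≤ (x + d) ^ t
doublings x d c h t x>0 x≤ ch≤t = begin
  2 ^ h * x ^ t ≡⟨ cong (λ z → 2 ^ h * x ^ z) (m+[n∸m]≡n ch≤t) ⟨
  2 ^ h * x ^ (c * h + r) ≡⟨ cong (2 ^ h *_) (trans (^-distribˡ-+-* x (c * h) r) (cong (_* x ^ r) (sym (^-*-assoc x c h)))) ⟩
  2 ^ h * ((x ^ c) ^ h * x ^ r) ≡⟨ *-assoc (2 ^ h) _ _ ⟨
  2 ^ h * (x ^ c) ^ h * x ^ r ≡⟨ cong (_* x ^ r) (^-distribʳ-* h 2 (x ^ c)) ⟨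
  (2 * x ^ c) ^ h * x ^ r ≤⟨ *-mono-≤ (^-monoˡ-≤ h (doubling x d c x>0 x≤)) (^-monoˡ-≤ r (m≤m+n x d)) ⟩
  ((x + d) ^ c) ^ h * (x + d) ^ r ≡⟨ cong (_* (x + d) ^ r) (^-*-assoc (x + d) c h) ⟩
  (x + d) ^ (c * h) * (x + d) ^ r ≡⟨ ^-distribˡ-+-* (x + d) (c * h) r ⟨
  (x + d) ^ (c * h + r) ≡⟨ cong ((x + d) ^_) (m+[n∸m]≡n ch≤t) ⟩
  (x + d) ^ t ∎
  where
  open ≤-Reasoning
  r = t ∸ c * h

∑-ind-bound : (xs : List 𝒜) (β : 𝒜 → Bool) (F : 𝒜 → ℕ) (g c : ℕ) →
              (∀ x → β x ≡ true → F x * g ≤ c) → ∑ xs (λ x → ind (β x) * F x) * g ≤ length xs * c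
∑-ind-bound xs β F g c h = ≤-trans (≤-reflexive (sym (∑-*ʳ xs g _))) (∑-≤const xs c pt)
  where
  pt : ∀ x → ind (β x) * F x * g ≤ c
  pt x with β x in e
  ... | true = ≤-trans (≤-reflexive (cong (_* g) (+-identityʳ (F x)))) (h x e)
  ... | false = z≤n

length-cartesianProduct : (xs : List 𝒜) (ys : List ℬ) → length (cartesianProduct xs ys) ≡ length xs * length ys
length-cartesianProduct [] ys = refl
length-cartesianProduct (x ∷ xs) ys = trans (List.length-++ (map (x ,_) ys))
  (cong₂ _+_ (List.length-map (x ,_) ys) (length-cartesianProduct xs ys))

length-allPairs : ∀ n m → length (allPairs n m) ≡ (n * n) ^ m
length-allPairs n m = trans (length-allVec m _) (cong (_^ m)
  (trans (length-cartesianProduct [ n ] [ n ]) (cong₂ _*_ (length-allFin n) (length-allFin n))))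

length-allFuns : ∀ n k → length (allFuns n [ k ]) ≡ k ^ n
length-allFuns n k = trans (length≡∑ (allFuns n [ k ])) (trans (∑-allFuns n [ k ] (λ _ → 1))
  (trans (sym (length≡∑ (allVec n [ k ]))) (trans (length-allVec n [ k ]) (cong (_^ n) (length-allFin k)))))

event₁-some : (k m : ℕ) → Adj n → ℕ
event₁-some {n} k m A = ∑ (allFuns n [ k ]) (λ p → ind (balanced p) * event₁ m p A)

module Union (n d b : ℕ) (n≡ : n ≡ suc (d + b)) (d≥2 : 2 ≤ d) (b>0 : 0 < b) (2d≤n : 2 * d ≤ n) where
  open Weighted n d b

  private
    instance
      Q≢0 : NonZero (d + b)
      Q≢0 = >-nonZero (≤-trans b>0 (m≤n+m b d))
    d>0 : 0 < d
    d>0 = ≤-trans (s≤s z≤n) d≥2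
    n>0 : 0 < n
    n>0 = subst (0 <_) (sym n≡) (s≤s z≤n)

  S₁ c : ℕ
  S₁ = S (λ _ → 1)
  c = wt n d b (n * d)

  -- All d-regular graphs have the same weight c, so they form a uniformly weighted part of the sum.
  transfer : (F : Mat n → ℕ) → ∑ (mats n) (λ M → reg₁ d M * F M) * c ≤ S F
  transfer F = ≤-trans (≤-reflexive (sym (∑-*ʳ (mats n) c _))) (∑-mono (mats n) pt)
    where
    shuffle : ∀ f c → (f + 0) * c ≡ (c + 0) * f
    shuffle = solve-∀
    weight : ∀ M → isRegGraph d (adj M) ≡ true → c + 0 ≡ w M
    weight M reg rewrite proj₁ (∧-true {isSimpleGraph (adj M)} reg) = cong (λ e → wt n d b e + 0)
      (sym (trans (∑-cong [ n ] (isRegGraph-deg {A = adj M} reg)) (∑-allFin-const n d)))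
    pt : ∀ M → reg₁ d M * F M * c ≤ w M * F M
    pt M with isRegGraph d (adj M) in reg
    ... | false = z≤n
    ... | true = ≤-reflexive (trans (shuffle (F M) c) (cong (_* F M)
      (weight M reg)))

  module Round₁ (κ k e m₁ : ℕ) (k≡ : k ≡ 2 * κ) (k>0 : 0 < k) (24m₁≤n : 24 * m₁ ≤ n)
                (L-small : 48 * k * (2 * 2 ^ e * (2 * 2 ^ e)) ≤ d) where
    -- Anticoncentration bounds point probabilities by 2 / L; the extra factor 2 makes this exactly
    -- 2^-e.
    L = 2 * 2 ^ e

    L>0 : 0 < L
    L>0 = *-mono-≤ {1} {2} (s≤s z≤n) (m^n>0 2 e)

    -- As 2d ≤ n, a position at most L beyond the mode bound is still at most 3m / 4. The remaining
    -- md / 4 covers 2 L L (d + b) because m ≥ n / 6k and 48 k L L ≤ d.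
    room : ∀ m → n ≤ 6 * k * m → ∀ s → s * (d + b) ≤ suc m * d + L * (d + b) → s * d + 2 * L * L * (d + b) ≤ m * d
    room m n≤ s h = *-cancelˡ-≤ 4 (begin
      4 * (s * d + 2 * L * L * Q) ≡⟨ s₁ s d L Q ⟩
      4 * s * d + 8 * L * L * Q ≤⟨ +-mono-≤ (*-monoˡ-≤ d 4s≤) big ⟩
      3 * m * d + m * d ≡⟨ s₂ m d ⟩
      4 * (m * d) ∎)
      where
      open ≤-Reasoning
      Q = d + b
      s₁ : ∀ s d l q → 4 * (s * d + 2 * l * l * q) ≡ 4 * s * d + 8 * l * l * q
      s₁ = solve-∀
      s₂ : ∀ m d → 3 * m * d + m * d ≡ 4 * (m * d)
      s₂ = solve-∀
      s₃ : ∀ l k m → 8 * l * l * (6 * k * m) ≡ m * (48 * k * (l * l))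
      s₃ = solve-∀
      Q≤n : Q ≤ n
      Q≤n = ≤-trans (n≤1+n Q) (≤-reflexive (sym n≡))
      big : 8 * L * L * Q ≤ m * d
      big = begin
        8 * L * L * Q ≤⟨ *-monoʳ-≤ (8 * L * L) (≤-trans Q≤n n≤) ⟩
        8 * L * L * (6 * k * m) ≡⟨ s₃ L k m ⟩
        m * (48 * k * (L * L)) ≤⟨ *-monoʳ-≤ m L-small ⟩
        m * d ∎
      kL : k * L ≤ k * (L * L)
      kL = *-monoʳ-≤ k (≤-trans (≤-reflexive (sym (*-identityʳ L))) (*-monoʳ-≤ L L>0))
      m≥ : 8 * L + 6 ≤ m
      m≥ = *-cancelˡ-≤ (6 * k) {{m*n≢0 6 k {{_}} {{>-nonZero k>0}}}} (begin
        6 * k * (8 * L + 6) ≤⟨ *-monoʳ-≤ (6 * k) (+-monoʳ-≤ (8 * L) (*-monoʳ-≤ 6 L>0)) ⟩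
        6 * k * (8 * L + 6 * L) ≤⟨ ≤-by (12 * (k * L)) (s₄ k L) ⟩
        2 * (48 * (k * L)) ≤⟨ *-monoʳ-≤ 2 (*-monoʳ-≤ 48 kL) ⟩
        2 * (48 * (k * (L * L))) ≡⟨ cong (2 *_) (sym (*-assoc 48 k _)) ⟩
        2 * (48 * k * (L * L)) ≤⟨ *-monoʳ-≤ 2 L-small ⟩
        2 * d ≤⟨ ≤-trans 2d≤n n≤ ⟩
        6 * k * m ∎)
        where
        s₄ : ∀ k l → 2 * (48 * (k * l)) ≡ 6 * k * (8 * l + 6 * l) + 12 * (k * l)
        s₄ = solve-∀
      k≥1 : 48 ≤ d
      k≥1 = ≤-trans (≤-trans (≤-reflexive (sym (*-identityʳ 48)))
        (≤-trans (*-monoʳ-≤ 48 k>0) (≤-trans (≤-reflexive (sym (*-identityʳ (48 * k)))) (*-monoʳ-≤ (48 * k) (*-mono-≤ L>0 L>0))))) L-small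
      Q≥4 : 4 ≤ Q
      Q≥4 = ≤-trans (≤-trans (s≤s (s≤s (s≤s (s≤s z≤n)))) k≥1) (m≤m+n d b)
      2d≤ : 2 * d ≤ Q + 1
      2d≤ = ≤-trans 2d≤n (≤-reflexive (trans n≡ (+-comm 1 Q)))
      4s≤ : 4 * s ≤ 3 * m
      4s≤ = *-cancelʳ-≤ _ _ Q (begin
        4 * s * Q ≡⟨ *-assoc 4 s Q ⟩
        4 * (s * Q) ≤⟨ *-monoʳ-≤ 4 h ⟩
        4 * (suc m * d + L * Q) ≡⟨ t₁ m d L Q ⟩
        2 * suc m * (2 * d) + 4 * L * Q ≤⟨ +-monoˡ-≤ (4 * L * Q) (*-monoʳ-≤ (2 * suc m) 2d≤) ⟩
        2 * suc m * (Q + 1) + 4 * L * Q ≡⟨ t₂ m Q L ⟩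
        2 * (m * Q) + (2 * m + (2 * Q + 2 + 4 * L * Q)) ≤⟨ +-monoʳ-≤ (2 * (m * Q)) rest ⟩
        2 * (m * Q) + m * Q ≡⟨ t₃ m Q ⟩
        3 * m * Q ∎)
        where
        t₁ : ∀ m d l q → 4 * ((1 + m) * d + l * q) ≡ 2 * (1 + m) * (2 * d) + 4 * l * q
        t₁ = solve-∀
        t₂ : ∀ m q l → 2 * (1 + m) * (q + 1) + 4 * l * q ≡ 2 * (m * q) + (2 * m + (2 * q + 2 + 4 * l * q))
        t₂ = solve-∀
        t₃ : ∀ m q → 2 * (m * q) + m * q ≡ 3 * m * q
        t₃ = solve-∀
        t₄ : ∀ m q l → 2 * (2 * m + (2 * q + 2 + 4 * l * q)) ≡ m * 4 + (8 * l * q + 4 * q + 4)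
        t₄ = solve-∀
        t₅ : ∀ q l → (8 * l + 6) * q ≡ 8 * l * q + 4 * q + q + q
        t₅ = solve-∀
        rest : 2 * m + (2 * Q + 2 + 4 * L * Q) ≤ m * Q
        rest = *-cancelˡ-≤ 2 (begin
          2 * (2 * m + (2 * Q + 2 + 4 * L * Q)) ≡⟨ t₄ m Q L ⟩
          m * 4 + (8 * L * Q + 4 * Q + 4) ≤⟨ +-mono-≤ (*-monoʳ-≤ m Q≥4) (≤-trans (+-monoʳ-≤ (8 * L * Q + 4 * Q) Q≥4) (≤-trans (m≤m+n _ Q) (≤-reflexive (sym (t₅ Q L))))) ⟩
          m * Q + (8 * L + 6) * Q ≤⟨ +-monoʳ-≤ (m * Q) (*-monoˡ-≤ Q m≥) ⟩
          m * Q + m * Q ≡⟨ cong (m * Q +_) (+-identityʳ (m * Q)) ⟨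
          2 * (m * Q) ∎)

    bound : ∀ (p : Fin n → Fin k) (ps : Pairs n m₁) → balanced p ≡ true → indepB ps ≡ true →
            S (agreeAll p (colours₁ p ps) ps ∘ adj) * 2 ^ (e * (m₁ * κ)) ≤ S₁
    bound p ps bal ind-ps = ≤-trans (*-monoʳ-≤ X (^-monoʳ-≤ 2 (*-monoʳ-≤ e (*-monoʳ-≤ m₁ (many-colours p ps n>0 bal 24m₁≤n k≡)))))
      (*-cancelˡ-≤ (2 ^ t) {{m^n≢0 2 t}} (begin
        2 ^ t * (X * 2 ^ (e * t)) ≡⟨ shuffle (2 ^ t) X _ ⟩
        X * (2 ^ t * 2 ^ (e * t)) ≡⟨ cong (λ z → X * (2 ^ t * z)) (^-*-assoc 2 e t) ⟨
        X * (2 ^ t * (2 ^ e) ^ t) ≡⟨ cong (X *_) (^-distribʳ-* t 2 (2 ^ e)) ⟨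
        X * L ^ t ≤⟨ S-agreeAll ps (λ x h → cong not h) ind-ps js (AllPairs.filter⁺ _ (allFin-distinct k)) (All.tabulate bounded) ⟩
        2 ^ t * S₁ ∎))
      where
      open ≤-Reasoning
      js = colours₁ p ps
      X = S (agreeAll p js ps ∘ adj)
      t = m₁ * length js
      shuffle : ∀ x y z → x * (y * z) ≡ y * (x * z)
      shuffle = solve-∀
      open Agreement n d b (outside₁ ps) p L 2
      bounded : ∀ {j} → j ∈ js → Bounded j
      bounded {j} j∈ = Binomial.β-bound⇒ d b m L 2 (Binomial.anticoncentration d b m L L>0 b>0 (room m n≤))
        where
        m = length (block (outside₁ ps) p j)
        n≤ : n ≤ 6 * k * m
        n≤ = ≤ᵇ-true {n} (Equivalence.to T-≡ (proj₂ (∈-filter⁻ (λ j → T? (n ≤ᵇ 6 * k * length (block (outside₁ ps) p j))) {xs = allFin k} j∈)))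

    S-event₁ : S (event₁-some k m₁ ∘ adj) * 2 ^ (e * (m₁ * κ)) ≤ k ^ n * ((n * n) ^ m₁ * S₁)
    S-event₁ = begin
      S (event₁-some k m₁ ∘ adj) * g ≡⟨ cong (_* g) (trans (S-∑ (allFuns n [ k ]) _) (∑-cong (allFuns n [ k ]) λ p → S-*ˡ (ind (balanced p)) _)) ⟩
      ∑ (allFuns n [ k ]) (λ p → ind (balanced p) * S (event₁ m₁ p ∘ adj)) * g
        ≤⟨ ∑-ind-bound (allFuns n [ k ]) balanced (λ p → S (event₁ m₁ p ∘ adj)) g ((n * n) ^ m₁ * S₁) each ⟩
      length (allFuns n [ k ]) * ((n * n) ^ m₁ * S₁) ≡⟨ cong (_* ((n * n) ^ m₁ * S₁)) (length-allFuns n k) ⟩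
      k ^ n * ((n * n) ^ m₁ * S₁) ∎
      where
      open ≤-Reasoning
      g = 2 ^ (e * (m₁ * κ))
      each : ∀ p → balanced p ≡ true → S (event₁ m₁ p ∘ adj) * g ≤ (n * n) ^ m₁ * S₁
      each p bal = begin
        S (event₁ m₁ p ∘ adj) * g ≡⟨ cong (_* g) (trans (S-∑ (allPairs n m₁) _) (∑-cong (allPairs n m₁) λ ps → S-*ˡ (ind (indepB ps)) _)) ⟩
        ∑ (allPairs n m₁) (λ ps → ind (indepB ps) * S (agreeAll p (colours₁ p ps) ps ∘ adj)) * g
          ≤⟨ ∑-ind-bound (allPairs n m₁) indepB (λ ps → S (agreeAll p (colours₁ p ps) ps ∘ adj)) g S₁ (λ ps → bound p ps bal) ⟩
        length (allPairs n m₁) * S₁ ≡⟨ cong (_* S₁) (length-allPairs n m₁) ⟩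
        (n * n) ^ m₁ * S₁ ∎

  module Round₂ (m₁ m₂ h c₂ : ℕ) (small : 4 * (m₂ + m₁) ≤ n) (c₂-big : 2 * n ≤ c₂ * d)
                (h-small : ∀ t → n ≤ 2 * t → c₂ * h ≤ m₂ * t) where

    -- Chosen as 2n - d: the ratio den / 2n = 1 - d / 2n bounds the probability of either value of a
    -- single edge.
    den : ℕ
    den = 2 + d + 2 * b

    den+d : den + d ≡ 2 * n
    den+d = trans (s₁ d b) (cong (2 *_) (sym n≡))
      where
      s₁ : ∀ d b → 2 + d + 2 * b + d ≡ 2 * (1 + (d + b))
      s₁ = solve-∀

    -- When 2d = n the edge weight d is b + 1, so b alone would not bound both values of a bit.
    d≤b+1 : d ≤ b + 1
    d≤b+1 = +-cancelˡ-≤ d _ _ (≤-trans (≤-reflexive (s₁ d)) (≤-trans 2d≤n (≤-reflexive (trans n≡ (s₂ d b)))))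
      where
      s₁ : ∀ d → d + d ≡ 2 * d
      s₁ = solve-∀
      s₂ : ∀ d b → 1 + (d + b) ≡ d + (b + 1)
      s₂ = solve-∀

    one-bit : ∀ r t → 𝔼 d b 1 (λ i → ind (i + r ≡ᵇ t)) ≤ b + 1
    one-bit r t with suc r ≡ᵇ t in e | r ≡ᵇ t in f
    ... | true | true = ⊥-elim (1+n≢n (trans (≡ᵇ-true {suc r} e) (sym (≡ᵇ-true {r} f))))
    ... | true | false = ≤-trans (≤-reflexive (trans (cong₂ _+_ (*-identityʳ d) (*-zeroʳ b)) (+-identityʳ d))) d≤b+1
    ... | false | true = ≤-trans (≤-reflexive (cong₂ _+_ (*-zeroʳ d) (*-identityʳ b))) (m≤m+n b 1)
    ... | false | false = ≤-trans (≤-reflexive (cong₂ _+_ (*-zeroʳ d) (*-zeroʳ b))) z≤n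

    max-bit : (b + 1) * (2 * n) ≤ den * (d + b)
    max-bit = subst (λ z → (b + 1) * (2 * z) ≤ den * (d + b)) (sym n≡) (go d d≥2)
      where
      s₁ : ∀ d b → (2 + (2 + d) + 2 * b) * ((2 + d) + b) ≡ (b + 1) * (2 * (1 + ((2 + d) + b))) + (d * b + (d * d + 4 * d + 2))
      s₁ = solve-∀
      go : ∀ d → 2 ≤ d → (b + 1) * (2 * suc (d + b)) ≤ (2 + d + 2 * b) * (d + b)
      go (suc (suc d)) _ = ≤-by (d * b + (d * d + 4 * d + 2)) (s₁ d b)
      go (suc zero) (s≤s ())

    bound : ∀ (W : Vec Bool n) (ps : Pairs n m₂) → ∑ [ n ] (λ x → ind (lookup W x)) ≤ 2 * m₁ → indepB ps ≡ true →
            S (agreeAll id (colours₂ W ps) ps ∘ adj) * 2 ^ h ≤ S₁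
    bound W ps |W| ind-ps = *-cancelˡ-≤ (den ^ t) {{m^n≢0 den t}} (begin
      den ^ t * (X * 2 ^ h) ≡⟨ shuffle (den ^ t) X (2 ^ h) ⟩
      X * (2 ^ h * den ^ t) ≤⟨ *-monoʳ-≤ X (doublings den d c₂ h t (s≤s z≤n)
          (≤-trans (m≤m+n den d) (≤-trans (≤-reflexive den+d) c₂-big)) (h-small _ (many-outside W ps |W| small))) ⟩
      X * (den + d) ^ t ≡⟨ cong (λ z → X * z ^ t) den+d ⟩
      X * (2 * n) ^ t ≤⟨ S-agreeAll ps avoid ind-ps js (AllPairs.filter⁺ _ (allFin-distinct n)) (All.tabulate bounded) ⟩
      den ^ t * S₁ ∎)
      where
      open ≤-Reasoning
      js = colours₂ W ps
      X = S (agreeAll id js ps ∘ adj)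
      t = m₂ * length js
      shuffle : ∀ x y z → x * (y * z) ≡ y * (z * x)
      shuffle = solve-∀
      open Agreement n d b (outside₂ W ps) id (2 * n) den
      avoid : ∀ x → memB x ps ≡ true → outside₂ W ps x ≡ false
      avoid x e rewrite e = refl
      bounded : ∀ {j} → j ∈ js → Bounded j
      bounded {j} j∈ r t = subst (λ l → 𝔼 d b l (λ i → ind (i + r ≡ᵇ t)) * (2 * n) ≤ den * (d + b) ^ l) (sym len)
        (≤-trans (*-monoˡ-≤ (2 * n) (one-bit r t)) (≤-trans max-bit (≤-reflexive (cong (den *_) (sym (*-identityʳ (d + b)))))))
        where
        Tj : outside₂ W ps j ≡ true
        Tj = Equivalence.to T-≡ (proj₂ (∈-filter⁻ (λ x → T? (outside₂ W ps x)) {xs = allFin n} j∈))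
        other : ∀ y → y ≢ j → ind (outside₂ W ps y ∧ eqFin y j) ≡ 0
        other y y≢j rewrite eqFin-false y≢j with outside₂ W ps y
        ... | true = refl
        ... | false = refl
        self : ind (outside₂ W ps j ∧ eqFin j j) ≡ 1
        self rewrite eqFin-refl j | Tj = refl
        len : length (block (outside₂ W ps) id j) ≡ 1
        len = trans (length-block (outside₂ W ps) id j) (trans (∑-point j other) self)

    S-event₂ : S (event₂ m₁ m₂ ∘ adj) * 2 ^ h ≤ 2 ^ n * ((n * n) ^ m₂ * S₁)
    S-event₂ = begin
      S (event₂ m₁ m₂ ∘ adj) * g
        ≡⟨ cong (_* g) (trans (S-∑ sets _) (∑-cong sets λ W → trans (S-∑ (allPairs n m₂) _)
             (trans (∑-cong (allPairs n m₂) λ ps → trans (S-*ˡ (ind (smallB W)) _) (cong (ind (smallB W) *_) (S-*ˡ (ind (indepB ps)) _)))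
                    (∑-*ˡ (allPairs n m₂) (ind (smallB W)) _)))) ⟩
      ∑ sets (λ W → ind (smallB W) * ∑ (allPairs n m₂) (λ ps → ind (indepB ps) * S (agreeAll id (colours₂ W ps) ps ∘ adj))) * g
        ≤⟨ ∑-ind-bound sets smallB _ g ((n * n) ^ m₂ * S₁) each ⟩
      length sets * ((n * n) ^ m₂ * S₁)
        ≡⟨ cong (_* ((n * n) ^ m₂ * S₁)) (length-allVec n bits) ⟩
      2 ^ n * ((n * n) ^ m₂ * S₁) ∎
      where
      open ≤-Reasoning
      g = 2 ^ h
      sets = allVec n bits
      smallB : Vec Bool n → Bool
      smallB W = ∑ [ n ] (λ x → ind (lookup W x)) ≤ᵇ 2 * m₁
      each : ∀ W → smallB W ≡ true →
             ∑ (allPairs n m₂) (λ ps → ind (indepB ps) * S (agreeAll id (colours₂ W ps) ps ∘ adj)) * g ≤ (n * n) ^ m₂ * S₁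
      each W sm = ≤-trans (∑-ind-bound (allPairs n m₂) indepB _ g S₁ λ ps → bound W ps (≤ᵇ-true sm))
        (≤-reflexive (cong (_* S₁) (length-allPairs n m₂)))

badCount-split : ∀ k n d m₁ m₂ s → 2 * m₂ ≤ s →
  badCount k n d ≤
    ∑ (mats n) (λ M → reg₁ d M * event₁-some k m₁ (adj M)) +
    (∑ (mats n) (λ M → reg₁ d M * event₂ m₁ m₂ (adj M)) +
     ∑ (mats n) (λ M → reg₁ d M * closePairs s (adj M)))
badCount-split k n d m₁ m₂ s 2m₂≤s = begin
  badCount k n d ≡⟨ trans (countB≡∑ (allAdj n) _) (∑-allAdj {n} _) ⟩
  ∑ (mats n) (λ M → ind (isRegGraph d (adj M) ∧ not (goodGraph k (adj M))))
    ≤⟨ ∑-mono (mats n) (λ M → pt (adj M)) ⟩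
  ∑ (mats n) (λ M → reg₁ d M * event₁-some k m₁ (adj M) + (reg₁ d M * event₂ m₁ m₂ (adj M) + reg₁ d M * closePairs s (adj M)))
    ≡⟨ trans (∑-+ (mats n) _ _) (cong (∑ (mats n) (λ M → reg₁ d M * event₁-some k m₁ (adj M)) +_) (∑-+ (mats n) _ _)) ⟩
  _ ∎
  where
  open ≤-Reasoning
  pt : ∀ A → ind (isRegGraph d A ∧ not (goodGraph k A)) ≤
       ind (isRegGraph d A) * event₁-some k m₁ A + (ind (isRegGraph d A) * event₂ m₁ m₂ A + ind (isRegGraph d A) * closePairs s A)
  pt A with isRegGraph d A | goodGraph k A in good
  ... | false | _ = z≤n
  ... | true | true = z≤n
  ... | true | false with allB-false (allFuns n [ k ]) good
  ...   | p , p∈ , h = ≤-trans main (≤-reflexive (sym (cong₂ _+_ (+-identityʳ (event₁-some k m₁ A))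
            (cong₂ _+_ (+-identityʳ (event₂ m₁ m₂ A)) (+-identityʳ (closePairs s A))))))
    where
    bal : balanced p ≡ true
    bal = not-false (∨-falseˡ h)
    indiscrete : discreteAfter A p 3 ≡ false
    indiscrete = ∨-falseʳ {not (balanced p)} h
    main : 1 ≤ event₁-some k m₁ A + (event₂ m₁ m₂ A + closePairs s A)
    main with event₁-some k m₁ A in no₁ | event₂ m₁ m₂ A in no₂ | closePairs s A in no₃
    ... | suc _ | _ | _ = s≤s z≤n
    ... | zero | suc _ | _ = s≤s z≤n
    ... | zero | zero | suc _ = s≤s z≤n
    ... | zero | zero | zero = ⊥-elim (true≢false (trans (sym
      (Refinement.discreteAfter-3 A p m₁ m₂ s 2m₂≤s none₁ no₂ no₃)) indiscrete))
      where
      none₁ : event₁ m₁ p A ≡ 0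
      none₁ = trans (sym (trans (cong (λ β → ind β * event₁ m₁ p A) bal) (+-identityʳ _)))
        (∑≡0 (λ p → ind (balanced p) * event₁ m₁ p A) no₁ p∈)

-- Costs of the union bounds and the choice of constants

-- Y is the number of choices in a union bound, g the reciprocal of the probability of each, t the
-- number of all graphs; the conclusion is that the bad proportion is at most 1 / q.
absorb : ∀ X Y g t q → 0 < g → X * g ≤ Y * t → q * Y ≤ g → X * q ≤ t
absorb X Y g t q g>0 h cost = *-cancelʳ-≤ _ _ g {{>-nonZero g>0}} (begin
  X * q * g ≡⟨ s₁ X q g ⟩
  q * (X * g) ≤⟨ *-monoʳ-≤ q h ⟩
  q * (Y * t) ≡⟨ *-assoc q Y t ⟨
  q * Y * t ≤⟨ *-monoˡ-≤ t cost ⟩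
  g * t ≡⟨ *-comm g t ⟩
  t * g ∎)
  where
  open ≤-Reasoning
  s₁ : ∀ x q g → x * q * g ≡ q * (x * g)
  s₁ = solve-∀

*-square-cancel-≤ : ∀ x y → x * x ≤ y * y → x ≤ y
*-square-cancel-≤ x y h with x ≤? y
... | yes le = le
... | no nle = ⊥-elim (<⇒≱ (*-mono-< (≰⇒> nle) (≰⇒> nle)) h)

^-cancel-≤ : ∀ t x y → 0 < t → x ^ t ≤ y ^ t → x ≤ y
^-cancel-≤ t x y t>0 h with x ≤? y
... | yes le = le
... | no nle = ⊥-elim (<⇒≱ (^-monoˡ-< t {{>-nonZero t>0}} (≰⇒> nle)) h)

module Cost (n ℓ Q : ℕ) (n<2^ℓ : suc n ≤ 2 ^ ℓ) (Q≤ : Q ≤ suc n) where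

  U^ : ∀ t → suc n ^ t ≤ 2 ^ (ℓ * t)
  U^ t = ≤-trans (^-monoˡ-≤ t n<2^ℓ) (≤-reflexive (^-*-assoc 2 ℓ t))

  n²≤ : suc (n * n) ≤ suc n ^ 2
  n²≤ = ≤-by (2 * n) (s₁ n)
    where
    s₁ : ∀ n → (1 + n) * ((1 + n) * 1) ≡ 1 + (n * n) + 2 * n
    s₁ = solve-∀

  -- The factors are the target accuracy, the partitions or sets, the families of pairs, the numbers
  -- of edges and the degree sequences. Each is at most a power of n + 1, and the exponents add up
  -- to 2n + 2m + 3 ≤ 3n.
  union-cost : ∀ x m → x ≤ suc n → 2 * m + 3 ≤ n →
               Q * (x ^ n * (n * n) ^ m * (suc (n * n) * suc n ^ n)) ≤ 2 ^ (ℓ * (3 * n))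
  union-cost x m x≤ 2m≤ = begin
    Q * (x ^ n * (n * n) ^ m * (suc (n * n) * U ^ n))
      ≤⟨ *-mono-≤ (≤-trans Q≤ (≤-reflexive (sym (*-identityʳ U))))
           (*-mono-≤ (*-mono-≤ (^-monoˡ-≤ n x≤) (≤-trans (^-monoˡ-≤ m (≤-trans (n≤1+n _) n²≤)) (≤-reflexive (^-*-assoc U 2 m))))
                     (*-monoˡ-≤ (U ^ n) n²≤)) ⟩
    U ^ 1 * (U ^ n * U ^ (2 * m) * (U ^ 2 * U ^ n)) ≡⟨ powers ⟨
    U ^ (1 + (n + 2 * m + (2 + n))) ≡⟨ cong (U ^_) (s₁ n m) ⟩
    U ^ (2 * n + (2 * m + 3)) ≤⟨ ^-monoʳ-≤ U (+-monoʳ-≤ (2 * n) 2m≤) ⟩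
    U ^ (2 * n + n) ≡⟨ cong (U ^_) (s₂ n) ⟩
    U ^ (3 * n) ≤⟨ U^ (3 * n) ⟩
    2 ^ (ℓ * (3 * n)) ∎
    where
    open ≤-Reasoning
    U = suc n
    s₁ : ∀ n m → 1 + (n + 2 * m + (2 + n)) ≡ 2 * n + (2 * m + 3)
    s₁ = solve-∀
    s₂ : ∀ n → 2 * n + n ≡ 3 * n
    s₂ = solve-∀
    powers : U ^ (1 + (n + 2 * m + (2 + n))) ≡ U ^ 1 * (U ^ n * U ^ (2 * m) * (U ^ 2 * U ^ n))
    powers = trans (^-distribˡ-+-* U 1 (n + 2 * m + (2 + n))) (cong (U ^ 1 *_) (trans (^-distribˡ-+-* U (n + 2 * m) (2 + n))
      (cong₂ _*_ (^-distribˡ-+-* U n (2 * m)) (^-distribˡ-+-* U 2 n))))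

  close-cost : ∀ s → suc s ≤ suc n → Q * (n * n * n * suc s) ≤ 2 ^ (ℓ * 5)
  close-cost s s≤ = begin
    Q * (n * n * n * suc s) ≤⟨ *-mono-≤ Q≤ (*-mono-≤ (*-mono-≤ (*-mono-≤ (n≤1+n n) (n≤1+n n)) (n≤1+n n)) s≤) ⟩
    U * (U * U * U * U) ≡⟨ s₁ U ⟩
    U ^ 5 ≤⟨ U^ 5 ⟩
    2 ^ (ℓ * 5) ∎
    where
    open ≤-Reasoning
    U = suc n
    s₁ : ∀ u → u * (u * u * u * u) ≡ u * (u * (u * (u * (u * 1))))
    s₁ = solve-∀

module Finite (k κ n d ℓ q H : ℕ) (k≡ : k ≡ 2 * κ) (κ≥ : 4608 ≤ κ)
              (n<2^ℓ : suc n ≤ 2 ^ ℓ) (dense : 2304 * n * ℓ ≤ d * d) (2d≤n : 2 * d ≤ n) (2H≡ : 2 * H ≡ n * d)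
              (e : ℕ) (L-small : 192 * k * (2 ^ e * 2 ^ e) ≤ d) (e≥ : ℓ ≤ 32 * e) (ℓ>0 : 0 < ℓ)
              (4q≤ : 4 * q ≤ suc n) (k≤ : k ≤ suc n) (n≥ : 48 ≤ n) where

  private
    d≤n : d ≤ n
    d≤n = ≤-trans (m≤m+n d (d + 0)) 2d≤n
    n>0 : 0 < n
    n>0 = ≤-trans (s≤s z≤n) n≥
    d≥ : 2304 * ℓ ≤ d
    d≥ = *-cancelʳ-≤ _ _ n {{>-nonZero n>0}} (≤-trans (≤-reflexive (s₁ n ℓ)) (≤-trans dense (*-monoʳ-≤ d d≤n)))
      where
      s₁ : ∀ n l → 2304 * l * n ≡ 2304 * n * l
      s₁ = solve-∀
    d≥2304 : 2304 ≤ d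
    d≥2304 = ≤-trans (*-monoʳ-≤ 2304 ℓ>0) d≥
    d≥2 : 2 ≤ d
    d≥2 = ≤-trans (s≤s (s≤s z≤n)) d≥2304
    instance
      d≢0 : NonZero d
      d≢0 = >-nonZero (≤-trans (s≤s z≤n) d≥2)
    d+2≤n : suc (suc d) ≤ n
    d+2≤n = ≤-trans (≤-trans (+-monoˡ-≤ d d≥2) (≤-reflexive (cong (d +_) (sym (+-identityʳ d))))) 2d≤n
    b : ℕ
    b = n ∸ suc d
    b>0 : 0 < b
    b>0 = m<n⇒0<n∸m d+2≤n
    n≡ : n ≡ suc (d + b)
    n≡ = sym (m+[n∸m]≡n (≤-trans (n≤1+n (suc d)) d+2≤n))
    m₁ x : ℕ
    -- Half of the colours survive as long as 24 m₁ ≤ n. The number x of pairs in round two leaves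
    -- at most 2x ≤ d / 32 vertices sharing a colour.
    m₁ = n / 24
    x = d / 64
    24m₁≤n : 24 * m₁ ≤ n
    24m₁≤n = ≤-trans (≤-reflexive (*-comm 24 m₁)) (m/n*n≤m n 24)
    m₁>0 : 0 < m₁
    m₁>0 = m≥n⇒m/n>0 {n} {24} (≤-trans (m≤m+n 24 24) n≥)
    n≤48m₁ : n ≤ 48 * m₁
    n≤48m₁ = begin
      n ≡⟨ m≡m%n+[m/n]*n n 24 ⟩
      n % 24 + m₁ * 24 ≤⟨ +-monoˡ-≤ (m₁ * 24) (≤-trans (<⇒≤ (m%n<n n 24)) (*-monoˡ-≤ 24 m₁>0)) ⟩
      m₁ * 24 + m₁ * 24 ≡⟨ s₁ m₁ ⟩
      48 * m₁ ∎
      where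
      open ≤-Reasoning
      s₁ : ∀ m → m * 24 + m * 24 ≡ 48 * m
      s₁ = solve-∀
    64x≤d : 64 * x ≤ d
    64x≤d = ≤-trans (≤-reflexive (*-comm 64 x)) (m/n*n≤m d 64)
    x>0 : 0 < x
    x>0 = m≥n⇒m/n>0 {d} {64} (≤-trans (m≤m+n 64 2240) d≥2304)
    d<64+64x : d < 64 + 64 * x
    d<64+64x = ≤-trans (s≤s (≤-reflexive (m≡m%n+[m/n]*n d 64)))
      (+-mono-≤ (m%n<n d 64) (≤-reflexive (*-comm x 64)))
    d≤128x : d ≤ 128 * x
    d≤128x = ≤-trans (<⇒≤ d<64+64x) (≤-trans (+-monoˡ-≤ (64 * x) (*-monoʳ-≤ 64 x>0)) (≤-reflexive (s₁ x)))
      where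
      s₁ : ∀ x → 64 * x + 64 * x ≡ 128 * x
      s₁ = solve-∀
    ℓ≤x : ℓ ≤ x
    ℓ≤x = ≤-pred (*-cancelˡ-< 64 ℓ (suc x) (begin-strict
      64 * ℓ ≤⟨ *-monoˡ-≤ ℓ (m≤m+n 64 2240) ⟩
      2304 * ℓ ≤⟨ d≥ ⟩
      d <⟨ d<64+64x ⟩
      64 + 64 * x ≡⟨ *-suc 64 x ⟨
      64 * suc x ∎))
      where open ≤-Reasoning
    128x≤n : 128 * x ≤ n
    128x≤n = ≤-trans (≤-reflexive (*-assoc 2 64 x)) (≤-trans (*-monoʳ-≤ 2 64x≤d) 2d≤n)
    small : 4 * (x + m₁) ≤ n
    small = *-cancelˡ-≤ 12 (begin
      12 * (4 * (x + m₁)) ≤⟨ ≤-by (80 * x) (s₁ x m₁) ⟩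
      128 * x + 2 * (24 * m₁) ≤⟨ +-mono-≤ 128x≤n (*-monoʳ-≤ 2 24m₁≤n) ⟩
      n + 2 * n ≤⟨ ≤-by (9 * n) (s₂ n) ⟩
      12 * n ∎)
      where
      open ≤-Reasoning
      s₁ : ∀ x m → 128 * x + 2 * (24 * m) ≡ 12 * (4 * (x + m)) + 80 * x
      s₁ = solve-∀
      s₂ : ∀ n → 12 * n ≡ n + 2 * n + 9 * n
      s₂ = solve-∀
    2m+3≤ : ∀ m → 24 * m ≤ n → 2 * m + 3 ≤ n
    2m+3≤ m h = *-cancelˡ-≤ 12 (begin
      12 * (2 * m + 3) ≡⟨ s₁ m ⟩
      24 * m + 36 ≤⟨ +-mono-≤ h (≤-trans (m≤m+n 36 12) n≥) ⟩
      n + n ≤⟨ ≤-by (10 * n) (s₂ n) ⟩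
      12 * n ∎)
      where
      open ≤-Reasoning
      s₁ : ∀ m → 12 * (2 * m + 3) ≡ 24 * m + 36
      s₁ = solve-∀
      s₂ : ∀ n → 12 * n ≡ n + n + 10 * n
      s₂ = solve-∀
    24x≤n : 24 * x ≤ n
    24x≤n = ≤-trans (*-monoˡ-≤ x (m≤m+n 24 104)) 128x≤n
    h c₂ : ℕ
    h = ℓ * (3 * n)
    -- About 2n / d factors 2n / (2n - d) are worth one doubling; the successor rounds the quotient
    -- up.
    c₂ = suc (2 * n / d)
    c₂-big : 2 * n ≤ c₂ * d
    c₂-big = ≤-trans (≤-reflexive (m≡m%n+[m/n]*n (2 * n) d)) (+-monoˡ-≤ (2 * n / d * d) (<⇒≤ (m%n<n (2 * n) d)))
    c₂-small : c₂ * d ≤ 3 * n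
    c₂-small = +-mono-≤ d≤n (m/n*n≤m (2 * n) d)
    -- The density constant is 2304 = 3 * 3 * 256: c₂ ≤ 3n / d and h = 3nℓ on one side, x ≥ d / 128
    -- and t ≥ n / 2 on the other.
    h-small : ∀ t → n ≤ 2 * t → c₂ * h ≤ x * t
    h-small t n≤2t = *-cancelʳ-≤ _ _ (256 * d) {{m*n≢0 256 d}} (begin
      c₂ * (ℓ * (3 * n)) * (256 * d) ≡⟨ s₁ c₂ ℓ n d ⟩
      c₂ * d * (768 * n * ℓ) ≤⟨ *-monoˡ-≤ (768 * n * ℓ) c₂-small ⟩
      3 * n * (768 * n * ℓ) ≡⟨ s₂ n ℓ ⟩
      n * (2304 * n * ℓ) ≤⟨ *-mono-≤ n≤2t (≤-trans dense (*-monoˡ-≤ d d≤128x)) ⟩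
      2 * t * (128 * x * d) ≡⟨ s₃ t x d ⟩
      x * t * (256 * d) ∎)
      where
      open ≤-Reasoning
      s₁ : ∀ c l n d → c * (l * (3 * n)) * (256 * d) ≡ c * d * (768 * n * l)
      s₁ = solve-∀
      s₂ : ∀ n l → 3 * n * (768 * n * l) ≡ n * (2304 * n * l)
      s₂ = solve-∀
      s₃ : ∀ t x d → 2 * t * (128 * x * d) ≡ x * t * (256 * d)
      s₃ = solve-∀
    k>0 : 0 < k
    k>0 = ≤-trans (≤-trans (s≤s z≤n) κ≥) (≤-trans (m≤m+n κ (κ + 0)) (≤-reflexive (sym k≡)))
    L-small′ : 48 * k * (2 * 2 ^ e * (2 * 2 ^ e)) ≤ d
    L-small′ = ≤-trans (≤-reflexive (s₁ k (2 ^ e))) L-small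
      where
      s₁ : ∀ k y → 48 * k * (2 * y * (2 * y)) ≡ 192 * k * (y * y)
      s₁ = solve-∀

  open Weighted n d b using (w; S)
  open Union n d b n≡ d≥2 b>0 2d≤n
  open Levels n d b n≡ (≤-trans (s≤s z≤n) d≥2) b>0 H 2H≡ using (S₁≤total)
  open Cost n ℓ (4 * q) n<2^ℓ 4q≤

  private
    tot V : ℕ
    tot = totalCount n d
    V = suc (n * n) * suc n ^ n

    c>0 : 0 < c
    c>0 = *-mono-≤ (m^n>0 d ⌊ n * d /2⌋) (m^n>0 b {{>-nonZero b>0}} ⌊ n * n ∸ n * d /2⌋)

    compare-S₁ : ∀ (F : Mat n → ℕ) g Y → S F * g ≤ Y * S₁ → 0 < g → 4 * q * (Y * V) ≤ g →
              ∑ (mats n) (λ M → reg₁ d M * F M) * (4 * q) ≤ tot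
    compare-S₁ F g Y bound g>0 cost = absorb X (Y * V) g tot (4 * q) g>0
      (*-cancelʳ-≤ _ _ c {{>-nonZero c>0}} (begin
        X * g * c ≡⟨ s₁ X g c ⟩
        X * c * g ≤⟨ *-monoˡ-≤ g (transfer F) ⟩
        S F * g ≤⟨ bound ⟩
        Y * S₁ ≤⟨ *-monoʳ-≤ Y S₁≤total ⟩
        Y * (V * tot * c) ≡⟨ s₂ Y V tot c ⟩
        Y * V * tot * c ∎)) cost
      where
      open ≤-Reasoning
      X = ∑ (mats n) (λ M → reg₁ d M * F M)
      s₁ : ∀ x g c → x * g * c ≡ x * c * g
      s₁ = solve-∀
      s₂ : ∀ y v t c → y * (v * t * c) ≡ y * v * t * c
      s₂ = solve-∀

    rare₁ : ∑ (mats n) (λ M → reg₁ d M * event₁-some k m₁ (adj M)) * (4 * q) ≤ tot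
    rare₁ = compare-S₁ _ (2 ^ (e * (m₁ * κ))) (k ^ n * (n * n) ^ m₁)
      (≤-trans (Round₁.S-event₁ κ k e m₁ k≡ k>0 24m₁≤n L-small′) (≤-reflexive (sym (*-assoc (k ^ n) _ S₁))))
      (m^n>0 2 (e * (m₁ * κ)))
      (≤-trans (union-cost k m₁ k≤ (2m+3≤ m₁ 24m₁≤n)) (^-monoʳ-≤ 2 (begin
        -- The product 32 * 3 * 48 = 4608 fixes κ: 32 from ℓ ≤ 32e, 3 from the cost exponent, 48
        -- from n ≤ 48 m₁.
        ℓ * (3 * n) ≤⟨ *-mono-≤ e≥ (*-monoʳ-≤ 3 n≤48m₁) ⟩
        32 * e * (3 * (48 * m₁)) ≡⟨ s₁ e m₁ ⟩
        e * (m₁ * 4608) ≤⟨ *-monoʳ-≤ e (*-monoʳ-≤ m₁ κ≥) ⟩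
        e * (m₁ * κ) ∎)))
      where
      open ≤-Reasoning
      s₁ : ∀ e m → 32 * e * (3 * (48 * m)) ≡ e * (m * 4608)
      s₁ = solve-∀

    rare₂ : ∑ (mats n) (λ M → reg₁ d M * event₂ m₁ x (adj M)) * (4 * q) ≤ tot
    rare₂ = compare-S₁ _ (2 ^ h) (2 ^ n * (n * n) ^ x)
      (≤-trans (Round₂.S-event₂ m₁ x h c₂ small c₂-big h-small) (≤-reflexive (sym (*-assoc (2 ^ n) _ S₁))))
      (m^n>0 2 h)
      (union-cost 2 x (≤-trans (m≤m+n 2 46) (≤-trans n≥ (n≤1+n n))) (2m+3≤ x 24x≤n))

    rare₃ : ∑ (mats n) (λ M → reg₁ d M * closePairs (2 * x) (adj M)) * (4 * q) ≤ tot
    rare₃ = absorb (∑ (mats n) (λ M → reg₁ d M * closePairs (2 * x) (adj M))) (n * n * n * suc (2 * x)) (4 ^ (3 * x)) tot (4 * q) (m^n>0 4 (3 * x))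
      -- For s = 2x and a climb of r = 3x classes, 3 (s + r) + 2 is the value 15x + 2 taken for m₀,
      -- still at most d / 2. The gain 4^(3x) beats the cost 2^(5ℓ) because ℓ ≤ x.
      (≤-trans (closePairs-rare n d (15 * x + 2) (2 * x) (3 * x) 2d≤n 2m₀≤d (≤-reflexive (s₁ x)))
               (≤-reflexive (s₂ n (suc (2 * x)) tot)))
      (≤-trans (close-cost (2 * x) (s≤s 2x≤n)) (≤-trans (^-monoʳ-≤ 2 5ℓ≤) (≤-reflexive (sym (^-*-assoc 2 2 (3 * x))))))
      where
      s₁ : ∀ x → 3 * (2 * x + 3 * x) + 2 ≡ 15 * x + 2
      s₁ = solve-∀
      s₂ : ∀ n s t → n * (n * (n * (s * t))) ≡ n * n * n * s * t
      s₂ = solve-∀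
      s₃ : ∀ x → 2 * (15 * x + 2) + 30 * x ≡ 60 * x + 4
      s₃ = solve-∀
      s₄ : ∀ x → 60 * x + 4 * x ≡ 64 * x
      s₄ = solve-∀
      s₅ : ∀ x → 2 * (3 * x) ≡ x * 5 + x
      s₅ = solve-∀
      2m₀≤d : 2 * (15 * x + 2) ≤ d
      2m₀≤d = ≤-trans (m≤m+n _ (30 * x)) (≤-trans (≤-reflexive (s₃ x))
        (≤-trans (+-monoʳ-≤ (60 * x) (*-monoʳ-≤ 4 x>0)) (≤-trans (≤-reflexive (s₄ x)) 64x≤d)))
      2x≤n : 2 * x ≤ n
      2x≤n = ≤-trans (*-monoˡ-≤ x (m≤m+n 2 126)) 128x≤n
      5ℓ≤ : ℓ * 5 ≤ 2 * (3 * x)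
      5ℓ≤ = ≤-trans (*-monoˡ-≤ 5 ℓ≤x) (≤-trans (m≤m+n _ x) (≤-reflexive (sym (s₅ x))))

  badCount-rare : badCount k n d * (4 * q) ≤ 3 * totalCount n d
  badCount-rare = begin
    badCount k n d * (4 * q) ≤⟨ *-monoˡ-≤ (4 * q) (badCount-split k n d m₁ x (2 * x) ≤-refl) ⟩
    (X₁ + (X₂ + X₃)) * (4 * q) ≡⟨ s₁ X₁ X₂ X₃ (4 * q) ⟩
    X₁ * (4 * q) + (X₂ * (4 * q) + (X₃ * (4 * q) + 0)) ≤⟨ +-mono-≤ rare₁ (+-mono-≤ rare₂ (+-monoˡ-≤ 0 rare₃)) ⟩
    3 * totalCount n d ∎
    where
    open ≤-Reasoning
    X₁ = ∑ (mats n) (λ M → reg₁ d M * event₁-some k m₁ (adj M))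
    X₂ = ∑ (mats n) (λ M → reg₁ d M * event₂ m₁ x (adj M))
    X₃ = ∑ (mats n) (λ M → reg₁ d M * closePairs (2 * x) (adj M))
    s₁ : ∀ x y z q → (x + (y + z)) * q ≡ x * q + (y * q + (z * q + 0))
    s₁ = solve-∀

  -- Regular graphs exist without a construction: the empty graph makes the weighted total positive,
  -- and popularity bounds that total by a multiple of the number of regular graphs.
  totalCount>0 : 0 < totalCount n d
  totalCount>0 with totalCount n d in eq
  ... | suc _ = s≤s z≤n
  ... | zero = ⊥-elim (<⇒≱ S₁>0 (≤-trans S₁≤total (≤-reflexive (trans (cong (λ z → V * z * c) eq) (cong (_* c) (*-zeroʳ V))))))
    where
    O : Mat n
    O = Vec.replicate n (Vec.replicate n false)
    O-false : ∀ u v → adj O u v ≡ false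
    O-false u v = trans (adj-lookup O u v)
      (trans (cong (λ r → lookup r v) (Vec.lookup-replicate u (Vec.replicate n false))) (Vec.lookup-replicate v false))
    O-simple : isSimpleGraph (adj O) ≡ true
    O-simple = simple-complete (record { irrefl = λ u → O-false u u ; symm = λ u v → trans (O-false u v) (sym (O-false v u)) })
    O∈ : O ∈ mats n
    O∈ = ∈-allVec O λ i → ∈-allVec (lookup O i) λ j → ∈-bits (lookup (lookup O i) j)
      where
      ∈-bits : ∀ β → β ∈ bits
      ∈-bits true = here refl
      ∈-bits false = there (here refl)
    S₁>0 : 0 < S₁
    S₁>0 = ≤-trans (≤-trans (*-mono-≤ {1} {w O} w>0 (≤-refl {1}))
             (≤-refl {w O * 1})) (∑-∈ (λ M → w M * 1) O∈)
      where
      w>0 : 0 < w O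
      w>0 = ≤-trans (*-mono-≤ (m^n>0 d ⌊ e₂ (adj O) /2⌋) (m^n>0 b {{>-nonZero b>0}} ⌊ n * n ∸ e₂ (adj O) /2⌋))
        (≤-trans (m≤m+n _ 0) (≤-reflexive (cong (λ β → ind β * wt n d b (e₂ (adj O))) (sym O-simple))))

-- Asymptotics

log₂ : ∀ n → 0 < n → ∃ λ ℓ → n < 2 ^ ℓ × 2 ^ ℓ ≤ 2 * n
log₂ (suc zero) _ = 1 , ≤-refl , ≤-refl
log₂ (suc (suc n)) _ with log₂ (suc n) (s≤s z≤n)
... | ℓ , lo , hi with m≤n⇒m<n∨m≡n lo
...   | inj₁ lt = ℓ , lt , ≤-trans hi (*-monoʳ-≤ 2 (n≤1+n (suc n)))
...   | inj₂ eq = suc ℓ , ≤-trans (m<m+n (suc (suc n)) {suc (suc n) + 0} (s≤s z≤n)) (≤-reflexive (cong (2 *_) eq))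
                  , ≤-reflexive (cong (2 *_) (sym eq))

n<2^n : ∀ n → n < 2 ^ n
n<2^n zero = s≤s z≤n
n<2^n (suc n) = ≤-trans (+-mono-≤ (m^n>0 2 n) (n<2^n n)) (≤-reflexive (cong (2 ^ n +_) (sym (+-identityʳ _))))

-- Writing ℓ ≈ 2 b t, the power (K ℓ) ^ b is at most (2 K b) ^ b (2 ^ t) ^ b, and
-- (2 ^ t) ^ 2b = 2 ^ (2 b t).
poly≤exp : ∀ K b → 0 < b → ∃ λ ℓ₀ → ∀ ℓ → ℓ₀ ≤ ℓ → 2 * (K * ℓ) ^ b ≤ 2 ^ ℓ
poly≤exp K b b>0 = 2 * (K * c) * c , go
  where
  c = 2 * b
  instance
    c≢0 : NonZero c
    c≢0 = m*n≢0 2 b {{_}} {{>-nonZero b>0}}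
  two : ∀ x → 2 * x ^ b ≤ (2 * x) ^ b
  two x = ≤-trans (*-monoˡ-≤ (x ^ b) (≤-trans (≤-reflexive refl) (^-monoʳ-≤ 2 b>0))) (≤-reflexive (sym (^-distribʳ-* b 2 x)))
  go : ∀ ℓ → 2 * (K * c) * c ≤ ℓ → 2 * (K * ℓ) ^ b ≤ 2 ^ ℓ
  go ℓ h = begin
    2 * (K * ℓ) ^ b ≤⟨ *-monoʳ-≤ 2 (^-monoˡ-≤ b (≤-trans (*-monoʳ-≤ K ℓ≤) (≤-reflexive (sym (*-assoc K c y))))) ⟩
    2 * (K * c * y) ^ b ≡⟨ cong (2 *_) (^-distribʳ-* b (K * c) y) ⟩
    2 * ((K * c) ^ b * y ^ b) ≡⟨ *-assoc 2 ((K * c) ^ b) (y ^ b) ⟨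
    2 * (K * c) ^ b * y ^ b ≤⟨ *-monoˡ-≤ (y ^ b) (≤-trans (two (K * c)) (^-monoˡ-≤ b (≤-trans t≥ (<⇒≤ (n<2^n t))))) ⟩
    y ^ b * y ^ b ≡⟨ cong₂ _*_ (^-*-assoc 2 t b) (^-*-assoc 2 t b) ⟩
    2 ^ (t * b) * 2 ^ (t * b) ≡⟨ ^-distribˡ-+-* 2 (t * b) (t * b) ⟨
    2 ^ (t * b + t * b) ≡⟨ cong (2 ^_) (s₁ t b) ⟩
    2 ^ (t * c) ≤⟨ ^-monoʳ-≤ 2 (m/n*n≤m ℓ c) ⟩
    2 ^ ℓ ∎
    where
    open ≤-Reasoning
    t = ℓ / c
    y = 2 ^ t
    s₁ : ∀ t b → t * b + t * b ≡ t * (2 * b)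
    s₁ = solve-∀
    t≥ : 2 * (K * c) ≤ t
    t≥ = ≤-trans (≤-reflexive (sym (m*n/n≡m (2 * (K * c)) c))) (/-monoˡ-≤ c h)
    ℓ≤ : ℓ ≤ c * y
    ℓ≤ = begin
      ℓ ≡⟨ m≡m%n+[m/n]*n ℓ c ⟩
      ℓ % c + t * c ≤⟨ +-monoˡ-≤ (t * c) (<⇒≤ (m%n<n ℓ c)) ⟩
      suc t * c ≡⟨ *-comm (suc t) c ⟩
      c * suc t ≤⟨ *-monoʳ-≤ c (n<2^n t) ⟩
      c * y ∎

-- With ε = a / b, the b-th power makes all exponents integral. Of the surplus n^(2a) a single
-- factor n is spent, to absorb (K ℓ)^b.
dense-eventually : ∀ K a b n d ℓ → 0 < a → 0 < b → 0 < n → n ^ (b + 2 * a) ≤ d ^ (2 * b) → (K * ℓ) ^ b ≤ n →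
                   K * n * ℓ ≤ d * d
dense-eventually K a b n d ℓ a>0 b>0 n>0 h small = ^-cancel-≤ b _ _ b>0 (begin
  (K * n * ℓ) ^ b ≡⟨ cong (_^ b) (s₁ K n ℓ) ⟩
  (K * ℓ * n) ^ b ≡⟨ ^-distribʳ-* b (K * ℓ) n ⟩
  (K * ℓ) ^ b * n ^ b ≤⟨ *-monoˡ-≤ (n ^ b) small ⟩
  n * n ^ b ≤⟨ ^-monoʳ-≤ n {{>-nonZero n>0}} (≤-trans (≤-reflexive (+-comm 1 b)) (+-monoʳ-≤ b (*-mono-≤ {1} {2} (s≤s z≤n) a>0))) ⟩
  n ^ (b + 2 * a) ≤⟨ h ⟩
  d ^ (2 * b) ≡⟨ ^-*-assoc d 2 b ⟨
  (d ^ 2) ^ b ≡⟨ cong (λ z → (d * z) ^ b) (*-identityʳ d) ⟩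
  (d * d) ^ b ∎)
  where
  open ≤-Reasoning
  s₁ : ∀ k n l → k * n * l ≡ k * l * n
  s₁ = solve-∀

-- Taking e = ℓ / 16 makes 2^(2e) about n^(1/8). The constant 192 k ≤ 2^r fits as well because 1 +
-- 2r + 4e ≤ 43 + 4e ≤ 16e for e ≥ 4, so the product is at most the square root of n, hence at most
-- d.
scale-small : ∀ k n d ℓ r → r ≤ 21 → 192 * k ≤ 2 ^ r → 64 ≤ ℓ → 2 ^ ℓ ≤ 2 * n → n ≤ d * d →
              192 * k * (2 ^ (ℓ / 16) * 2 ^ (ℓ / 16)) ≤ d
scale-small k n d ℓ r r≤ k≤ ℓ≥ 2^ℓ≤ n≤ = ≤-trans (*-mono-≤ k≤ (≤-reflexive (sym (^-distribˡ-+-* 2 e e))))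
  (≤-trans (≤-reflexive (sym (^-distribˡ-+-* 2 r (e + e)))) (*-square-cancel-≤ _ _ (≤-trans (*-cancelˡ-≤ 2 (begin
    2 * (y * y) ≡⟨ cong (2 *_) (^-distribˡ-+-* 2 (r + (e + e)) (r + (e + e))) ⟨
    2 ^ suc (r + (e + e) + (r + (e + e))) ≤⟨ ^-monoʳ-≤ 2 exponent ⟩
    2 ^ ℓ ≤⟨ 2^ℓ≤ ⟩
    2 * n ∎)) n≤)))
  where
  open ≤-Reasoning
  e = ℓ / 16
  y = 2 ^ (r + (e + e))
  e≥4 : 4 ≤ e
  e≥4 = /-monoˡ-≤ 16 ℓ≥
  s₁ : ∀ r e → 1 + (r + (e + e) + (r + (e + e))) ≡ 1 + 2 * r + 4 * e
  s₁ = solve-∀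
  s₂ : ∀ e → 12 * e + 4 * e ≡ e * 16
  s₂ = solve-∀
  exponent : suc (r + (e + e) + (r + (e + e))) ≤ ℓ
  exponent = begin
    suc (r + (e + e) + (r + (e + e))) ≡⟨ s₁ r e ⟩
    suc (2 * r) + 4 * e
      ≤⟨ +-monoˡ-≤ (4 * e) (≤-trans (s≤s (*-monoʳ-≤ 2 r≤)) (≤-trans (m≤m+n 43 5) (*-monoʳ-≤ 12 e≥4))) ⟩
    12 * e + 4 * e ≡⟨ s₂ e ⟩
    e * 16 ≤⟨ m/n*n≤m ℓ 16 ⟩
    ℓ ∎

bad-rare-at : ∀ (k κ r a b n d ℓ H p q : ℕ) → k ≡ 2 * κ → 4608 ≤ κ → r ≤ 21 → 192 * k ≤ 2 ^ r →
  0 < a → 0 < b → 0 < p → 0 < q →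
  n ^ (b + 2 * a) ≤ d ^ (2 * b) → 2 * d ≤ n → d * n ≡ H * 2 →
  n < 2 ^ ℓ → 2 ^ ℓ ≤ 2 * n → 64 ≤ ℓ → (2304 * ℓ) ^ b ≤ n → 4 * q ≤ n → k ≤ n → 48 ≤ n →
  badCount k n d * q < p * totalCount n d
bad-rare-at k κ r a b n d ℓ H p q k≡ κ≥ r≤ k-bound a>0 b>0 p>0 q>0 large 2d≤n dn≡ n<2^ℓ 2^ℓ≤2n ℓ≥64 small 4q≤n k≤n n≥48 =
  ≤-trans strict (≤-trans (≤-reflexive (sym (*-identityˡ tot))) (*-monoˡ-≤ tot p>0))
  where
  tot = totalCount n d
  n>0 : 0 < n
  n>0 = ≤-trans (s≤s z≤n) n≥48
  ℓ>0 : 0 < ℓ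
  ℓ>0 = ≤-trans (s≤s z≤n) ℓ≥64
  dense : 2304 * n * ℓ ≤ d * d
  dense = dense-eventually 2304 a b n d ℓ a>0 b>0 n>0 large small
  n≤d² : n ≤ d * d
  n≤d² = ≤-trans (m≤n*m n 2304) (≤-trans (m≤m*n (2304 * n) ℓ {{>-nonZero ℓ>0}}) dense)
  ℓ≤32e : ℓ ≤ 32 * (ℓ / 16)
  ℓ≤32e = begin
    ℓ ≡⟨ m≡m%n+[m/n]*n ℓ 16 ⟩
    ℓ % 16 + ℓ / 16 * 16 ≤⟨ +-monoˡ-≤ (ℓ / 16 * 16) (≤-trans (<⇒≤ (m%n<n ℓ 16)) (*-monoˡ-≤ 16 (m≥n⇒m/n>0 {ℓ} {16} (≤-trans (m≤m+n 16 48) ℓ≥64)))) ⟩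
    ℓ / 16 * 16 + ℓ / 16 * 16 ≡⟨ s₁ (ℓ / 16) ⟩
    32 * (ℓ / 16) ∎
    where
    open ≤-Reasoning
    s₁ : ∀ x → x * 16 + x * 16 ≡ 32 * x
    s₁ = solve-∀
  module F = Finite k κ n d ℓ q H k≡ κ≥ n<2^ℓ dense 2d≤n
    (trans (*-comm 2 H) (trans (sym dn≡) (*-comm d n)))
    (ℓ / 16) (scale-small k n d ℓ r r≤ k-bound ℓ≥64 2^ℓ≤2n n≤d²) ℓ≤32e ℓ>0
    (≤-trans 4q≤n (n≤1+n n)) (≤-trans k≤n (n≤1+n n)) n≥48
  -- Three events of proportion at most 1 / 4q leave 3 / 4q in total, strictly less than 1 / q
  -- because regular graphs exist.
  strict : badCount k n d * q < tot
  strict = ≰⇒> λ tot≤ → <⇒≱ (m<n+m (3 * tot) F.totalCount>0) (≤-trans (*-monoʳ-≤ 4 tot≤)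
    (≤-trans (≤-reflexive (s₁ (badCount k n d) q)) F.badCount-rare))
    where
    s₁ : ∀ x q → 4 * (x * q) ≡ x * (4 * q)
    s₁ = solve-∀

bad-rare-eventually : ∀ (k κ r : ℕ) → k ≡ 2 * κ → 4608 ≤ κ → r ≤ 21 → 192 * k ≤ 2 ^ r →
  (a b : ℕ) → 0 < a → 0 < b → (d : ℕ → ℕ) →
  (Σ ℕ λ n₀ → (n : ℕ) → n₀ ≤ n →
    (n ^ (b + 2 * a) ≤ d n ^ (2 * b)) × (2 * d n ≤ n) × (2 ∣ d n * n)) →
  (p q : ℕ) → 0 < p → 0 < q →
  (∃ λ ℓ₀ → ∀ ℓ → ℓ₀ ≤ ℓ → 2 * (2304 * ℓ) ^ b ≤ 2 ^ ℓ) →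
  Σ ℕ λ N → (n : ℕ) → N ≤ n → badCount k n (d n) * q < p * totalCount n (d n)
bad-rare-eventually k κ r k≡ κ≥ r≤ k-bound a b a>0 b>0 d (n₀ , regime) p q p>0 q>0 (ℓ₀ , poly) =
  n₀ + (2 ^ (ℓ₀ + 64) + (4 * q + (k + 48))) , λ n N≤n →
    let 1+N : 2 ^ (ℓ₀ + 64) + (4 * q + (k + 48)) ≤ n
        1+N = ≤-trans (m≤n+m (2 ^ (ℓ₀ + 64) + (4 * q + (k + 48))) n₀) N≤n
        2+N : 4 * q + (k + 48) ≤ n
        2+N = ≤-trans (m≤n+m (4 * q + (k + 48)) (2 ^ (ℓ₀ + 64))) 1+N
        3+N : k + 48 ≤ n
        3+N = ≤-trans (m≤n+m (k + 48) (4 * q)) 2+N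
    in finish n (regime n (≤-trans (m≤m+n n₀ _) N≤n)) (≤-trans (m≤m+n (2 ^ (ℓ₀ + 64)) _) 1+N)
         (≤-trans (m≤m+n (4 * q) (k + 48)) 2+N) (≤-trans (m≤m+n k 48) 3+N) (≤-trans (m≤n+m 48 k) 3+N)
  where
  finish : ∀ n → (n ^ (b + 2 * a) ≤ d n ^ (2 * b)) × (2 * d n ≤ n) × (2 ∣ d n * n) →
           2 ^ (ℓ₀ + 64) ≤ n → 4 * q ≤ n → k ≤ n → 48 ≤ n → badCount k n (d n) * q < p * totalCount n (d n)
  finish n (large , 2d≤n , divides H dn≡) n≥ 4q≤n k≤n n≥48 = at-scale (log₂ n (≤-trans (m^n>0 2 (ℓ₀ + 64)) n≥))
    where
    at-scale : (∃ λ ℓ → n < 2 ^ ℓ × 2 ^ ℓ ≤ 2 * n) → badCount k n (d n) * q < p * totalCount n (d n)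
    at-scale (ℓ , n<2^ℓ , 2^ℓ≤2n) =
      bad-rare-at k κ r a b n (d n) ℓ H p q k≡ κ≥ r≤ k-bound a>0 b>0 p>0 q>0 large 2d≤n dn≡ n<2^ℓ 2^ℓ≤2n
        (≤-trans (m≤n+m 64 ℓ₀) ℓ≥)
        -- Only 2^ℓ ≤ 2n is known, so the factor 2 in the growth estimate is cancelled here.
        (*-cancelˡ-≤ 2 (≤-trans (poly ℓ (≤-trans (m≤m+n ℓ₀ 64) ℓ≥)) 2^ℓ≤2n)) 4q≤n k≤n n≥48
      where
      ℓ≥ : ℓ₀ + 64 ≤ ℓ
      ℓ≥ = ≮⇒≥ λ lt → <⇒≱ n<2^ℓ (≤-trans (^-monoʳ-≤ 2 (<⇒≤ lt)) n≥)

theorem10 : Σ ℕ λ k → 0 < k ×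
    ((a b : ℕ) → 0 < a → 0 < b → (d : ℕ → ℕ) →
    (Σ ℕ λ n₀ → (n : ℕ) → n₀ ≤ n →
    (n ^ (b + 2 * a) ≤ d n ^ (2 * b)) × (2 * d n ≤ n) × (2 ∣ d n * n)) →
    (p q : ℕ) → 0 < p → 0 < q →
    Σ ℕ λ N → (n : ℕ) → N ≤ n → badCount k n (d n) * q < p * totalCount n (d n))
theorem10 = 9216 , s≤s z≤n , λ a b a>0 b>0 d regime p q p>0 q>0 →
  -- The exponent 21 is forced by 192 * 9216 = 1769472, which lies between 2^20 and 2^21.
  bad-rare-eventually 9216 4608 21 refl ≤-refl ≤-refl (≤ᵇ⇒≤ (192 * 9216) (2 ^ 21) _) a b a>0 b>0 d regime p q p>0 q>0
    (poly≤exp 2304 b b>0)
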